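{- For any constant $\epsilon>0$, the problem WMMVC restricted to instances $(G=(V,E),w)$ in which $G$ is a bipartite graph and $w(v)\in\{1,1+\frac{1}{|V|}\}$ for all $v\in V$ cannot be solved in time $O^*((2-\epsilon)^{vc_w})$ unless the Strong Exponential Time Hypothesis (SETH) fails.
   Context: A vertex cover of a graph $G=(V,E)$ is a set of vertices containing at least one endpoint of every edge; it is minimal if no proper subset of it is a vertex cover. In the Weighted Maximal Minimal Vertex Cover problem (WMMVC), the input is a graph $G=(V,E)$ and a weight function $w:V\rightarrow\mathbb{R}^{\geq 1}$, and the task is to find the maximum weight $\sum_{v\in S}w(v)$ of a set $S\subseteq V$ that is a minimal vertex cover of $G$. $vc_w$ denotes the minimum weight of a vertex cover of $G$. The notation $O^*$ hides factors polynomial in the input size. SETH is the standard hypothesis that for every $\delta>0$ there is an integer $k$ such that $k$-SAT on $n$ variables cannot be solved in time $O^*((2-\delta)^n)$. -}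

module Defs where

open import Data.Bool.Base using (Bool; true; false; if_then_else_)
open import Data.Fin.Base using (Fin; toℕ)
open import Data.Fin.Properties using (nonZeroIndex)
open import Data.Fin.Subset using (Subset; _∈_; _⊂_)
open import Data.Integer.Base using (+_; ∣_∣)
open import Data.List.Base using (List; []; _∷_; length; tabulate)
open import Data.List.Relation.Unary.All using (All)
open import Data.List.Relation.Unary.Any using (Any)
open import Data.Nat.Base as ℕ using (ℕ; zero; suc)
open import Data.Product.Base using (Σ; ∃; ∃-syntax; _×_; _,_; proj₁; proj₂)
open import Data.Rational.Base
  using (ℚ; 0ℚ; 1ℚ; _+_; _-_; _*_; _/_; _⊔_; _≤_; _<_; ↥_; ↧ₙ_; +-*-rawSemiring)
open import Data.Sum.Base using (_⊎_)
open import Data.Vec.Base using (Vec; []; _∷_; lookup)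
open import Function.Bundles using (_⇔_)
open import Relation.Binary.PropositionalEquality using (_≡_; _≢_)
open import Relation.Nullary using (¬_)

open import Algebra.Definitions.RawSemiring +-*-rawSemiring using (_^_; sum)

------------------------------------------------------------------------
-- Real constants (two-sided Dedekind cuts)

record ℝ : Set₁ where
  field
    L U          : ℚ → Set
    L-inhabited  : ∃[ q ] L q
    U-inhabited  : ∃[ q ] U q
    L-rounded    : ∀ q → L q ⇔ (∃[ r ] (q < r × L r))
    U-rounded    : ∀ q → U q ⇔ (∃[ r ] (r < q × U r))
    disjoint     : ∀ q → ¬ (L q × U q)
    located      : ∀ {q r} → q < r → L q ⊎ U r

Positive : ℝ → Set
Positive ε = ℝ.L ε 0ℚ

fromℕ : ℕ → ℚ
fromℕ n = + n / 1

-- For x = a/b ≥ 0 in lowest terms, the real inequality  t ≤ P · (2 - ε)^x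
-- says  t^b ≤ P^b · (2 - ε)^a,  that is, t^b ≤ P^b · (2 - r)^a  for every
-- rational r < ε.  The base is cut off at 0, since a rational power of a
-- negative number is not defined; this only concerns ε > 2.
infix 4 _≤_·[2-_]^_
_≤_·[2-_]^_ : ℕ → ℕ → ℝ → ℚ → Set
t ≤ P ·[2- ε ]^ x =
  ∀ r → ℝ.L ε r →
  fromℕ t ^ ↧ₙ x ≤ fromℕ P ^ ↧ₙ x * ((fromℕ 2 - r) ⊔ 0ℚ) ^ ∣ ↥ x ∣

------------------------------------------------------------------------
-- The machine model

-- Programs compute on binary trees, as in Jones's WHILE language, with
-- `let` and loop-bound variables in place of a mutable store.
-- Every construct costs one unit.  Subtrees are shared and never copied, so a
-- RAM executes a run with constant overhead per unit; conversely, with its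
-- memory held in a balanced tree, a RAM is simulated with overhead
-- polylogarithmic in the running time.  Under single-exponential running times
-- both overheads are polynomial in the input size, hence absorbed by O*.  (For
-- Turing machines the overhead could be quadratic in the running time.)

data Tree : Set where
  leaf : Tree
  node : Tree → Tree → Tree

size : Tree → ℕ
size leaf       = 1
size (node l r) = suc (size l ℕ.+ size r)

data Exp (n : ℕ) : Set where
  var    : Fin n → Exp n
  leaf   : Exp n
  node   : Exp n → Exp n → Exp n
  case   : Exp n → Exp n → Exp (suc (suc n)) → Exp n
  let′   : Exp n → Exp (suc n) → Exp n
  -- while e c b: starting with x = e, replace x by b as long as c is not leaf.
  while  : Exp n → Exp (suc n) → Exp (suc n) → Exp n

Program : Set
Program = Exp 1

infix 4 _⊢_⇓_∥_ _⊢while_body_from_⇓_∥_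

mutual

  -- ρ ⊢ e ⇓ v ∥ t : in environment ρ, e evaluates to v at cost t.
  data _⊢_⇓_∥_ {n} (ρ : Vec Tree n) : Exp n → Tree → ℕ → Set where
    ⇓var   : ∀ i → ρ ⊢ var i ⇓ lookup ρ i ∥ 1
    ⇓leaf  : ρ ⊢ leaf ⇓ leaf ∥ 1
    ⇓node  : ∀ {e₁ e₂ v₁ v₂ t₁ t₂} →
             ρ ⊢ e₁ ⇓ v₁ ∥ t₁ →
             ρ ⊢ e₂ ⇓ v₂ ∥ t₂ →
             ρ ⊢ node e₁ e₂ ⇓ node v₁ v₂ ∥ suc (t₁ ℕ.+ t₂)
    ⇓case₀ : ∀ {e e₁ e₂ v t₁ t₂} →
             ρ ⊢ e ⇓ leaf ∥ t₁ →
             ρ ⊢ e₁ ⇓ v ∥ t₂ →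
             ρ ⊢ case e e₁ e₂ ⇓ v ∥ suc (t₁ ℕ.+ t₂)
    ⇓case₁ : ∀ {e e₁ e₂ l r v t₁ t₂} →
             ρ ⊢ e ⇓ node l r ∥ t₁ →
             l ∷ r ∷ ρ ⊢ e₂ ⇓ v ∥ t₂ →
             ρ ⊢ case e e₁ e₂ ⇓ v ∥ suc (t₁ ℕ.+ t₂)
    ⇓let   : ∀ {e₁ e₂ v₁ v₂ t₁ t₂} →
             ρ ⊢ e₁ ⇓ v₁ ∥ t₁ →
             v₁ ∷ ρ ⊢ e₂ ⇓ v₂ ∥ t₂ →
             ρ ⊢ let′ e₁ e₂ ⇓ v₂ ∥ suc (t₁ ℕ.+ t₂)
    ⇓while : ∀ {e c b v w t₁ t₂} →
             ρ ⊢ e ⇓ v ∥ t₁ →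
             ρ ⊢while c body b from v ⇓ w ∥ t₂ →
             ρ ⊢ while e c b ⇓ w ∥ suc (t₁ ℕ.+ t₂)

  data _⊢while_body_from_⇓_∥_ {n} (ρ : Vec Tree n) (c b : Exp (suc n)) :
       Tree → Tree → ℕ → Set where
    stop : ∀ {v t} →
           v ∷ ρ ⊢ c ⇓ leaf ∥ t →
           ρ ⊢while c body b from v ⇓ v ∥ suc t
    step : ∀ {v v′ w l r t₁ t₂ t₃} →
           v ∷ ρ ⊢ c ⇓ node l r ∥ t₁ →
           v ∷ ρ ⊢ b ⇓ v′ ∥ t₂ →
           ρ ⊢while c body b from v′ ⇓ w ∥ t₃ →
           ρ ⊢while c body b from v ⇓ w ∥ suc (t₁ ℕ.+ t₂ ℕ.+ t₃)

-- Some program solves the problem in time O*((2 - ε)^x), where x is the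
-- parameter of the instance.  As size ≥ 1, the factors C · size^d bound all
-- polynomials in the input size.
SolvableInTime-O*[2-_]^param :
  ℝ → {Instance : Set} →
  (encode  : Instance → Tree) →
  (Answer  : Instance → Tree → Set) →
  (IsParam : Instance → ℚ → Set) → Set
SolvableInTime-O*[2- ε ]^param encode Answer IsParam =
  Σ Program λ p → ∃[ C ] ∃[ d ] ∀ I →
  ∃[ out ] ∃[ t ] ∃[ x ]
    ( (encode I ∷ [] ⊢ p ⇓ out ∥ t)
    × Answer I out
    × IsParam I x
    × t ≤ C ℕ.* size (encode I) ℕ.^ d ·[2- ε ]^ x )

------------------------------------------------------------------------
-- Encodings

-- Numbers are written in unary.  Those that occur below (variable indices,
-- numerators and denominators of weights in {1, 1 + 1/|V|} and of sums of
-- these) are polynomially bounded in the number of variables or vertices, so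
-- binary notation would change sizes only polynomially.

encℕ : ℕ → Tree
encℕ zero    = leaf
encℕ (suc n) = node leaf (encℕ n)

encBool : Bool → Tree
encBool false = leaf
encBool true  = node leaf leaf

encList : {A : Set} → (A → Tree) → List A → Tree
encList enc []       = leaf
encList enc (x ∷ xs) = node (enc x) (encList enc xs)

-- The sign is dropped: only nonnegative rationals are encoded.
encℚ : ℚ → Tree
encℚ q = node (encℕ ∣ ↥ q ∣) (encℕ (↧ₙ q))

------------------------------------------------------------------------
-- k-SAT and SETH

Literal : ℕ → Set
Literal n = Fin n × Bool

record kCNF (k : ℕ) : Set where
  field
    #vars   : ℕ
    clauses : List (List (Literal #vars))
    width   : All (λ c → length c ℕ.≤ k) clauses

Satisfiable : ∀ {k} → kCNF k → Set
Satisfiable φ =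
  Σ (Fin #vars → Bool) λ a →
    All (Any (λ ℓ → a (proj₁ ℓ) ≡ proj₂ ℓ)) clauses
  where open kCNF φ

encLiteral : ∀ {n} → Literal n → Tree
encLiteral (i , b) = node (encBool b) (encℕ (toℕ i))

encCNF : ∀ {k} → kCNF k → Tree
encCNF φ = node (encℕ #vars) (encList (encList encLiteral) clauses)
  where open kCNF φ

SAT-Answer : ∀ {k} → kCNF k → Tree → Set
SAT-Answer φ out =
    (out ≡ encBool true × Satisfiable φ)
  ⊎ (out ≡ encBool false × ¬ Satisfiable φ)

kSAT-Solvable : ℕ → ℝ → Set
kSAT-Solvable k δ =
  SolvableInTime-O*[2- δ ]^param (encCNF {k}) SAT-Answer
    (λ φ x → x ≡ fromℕ (kCNF.#vars φ))

SETH : Set₁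
SETH = ∀ (δ : ℝ) → Positive δ → ∃[ k ] ¬ kSAT-Solvable k δ

------------------------------------------------------------------------
-- Weighted maximal minimal vertex cover

record Graph : Set where
  field
    ∣V∣    : ℕ
    adj    : Fin ∣V∣ → Fin ∣V∣ → Bool
    symm   : ∀ u v → adj u v ≡ adj v u
    irrefl : ∀ v → adj v v ≡ false

  VertexCover : Subset ∣V∣ → Set
  VertexCover S = ∀ u v → adj u v ≡ true → u ∈ S ⊎ v ∈ S

  MinimalVertexCover : Subset ∣V∣ → Set
  MinimalVertexCover S = VertexCover S × (∀ S′ → S′ ⊂ S → ¬ VertexCover S′)

  Bipartite : Set
  Bipartite = Σ (Fin ∣V∣ → Bool) λ side → ∀ u v → adj u v ≡ true → side u ≢ side v

record WeightedGraph : Set where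
  field
    graph : Graph

  open Graph graph public

  field
    w   : Fin ∣V∣ → ℚ
    1≤w : ∀ v → 1ℚ ≤ w v

  weight : Subset ∣V∣ → ℚ
  weight S = sum (λ v → if lookup S v then w v else 0ℚ)

  IsVCw : ℚ → Set
  IsVCw x = (∃[ S ] (VertexCover S × weight S ≡ x))
          × (∀ S → VertexCover S → x ≤ weight S)

  IsWMMVC : ℚ → Set
  IsWMMVC x = (∃[ S ] (MinimalVertexCover S × weight S ≡ x))
            × (∀ S → MinimalVertexCover S → weight S ≤ x)

encWeightedGraph : WeightedGraph → Tree
encWeightedGraph I =
  node (encList (encList encBool) (tabulate λ u → tabulate λ v → adj u v))
       (encList encℚ (tabulate w))
  where open WeightedGraph I

record RestrictedInstance : Set where
  field
    weightedGraph : WeightedGraph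

  open WeightedGraph weightedGraph public

  field
    bipartite : Bipartite
    weights   : ∀ v → w v ≡ 1ℚ ⊎ w v ≡ 1ℚ + _/_ (+ 1) ∣V∣ {{nonZeroIndex v}}

WMMVC-Answer : WeightedGraph → Tree → Set
WMMVC-Answer I out = ∃[ x ] (WeightedGraph.IsWMMVC I x × out ≡ encℚ x)

RestrictedWMMVC-Solvable : ℝ → Set
RestrictedWMMVC-Solvable ε =
  SolvableInTime-O*[2- ε ]^param
    (λ I → encWeightedGraph (weightedGraph I))
    (λ I → WMMVC-Answer (weightedGraph I))
    (λ I → WeightedGraph.IsVCw (weightedGraph I))
  where open RestrictedInstance

{-# OPTIONS --safe #-}

-- Blocks of t variables are coded by the w-element subsets of blocks of
-- L = t + ℓ vertices, where 2^t ≤ L C w and (2 - ε)^L ≤ (2 - δ)^t for a suitable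
-- δ > 0.  The blocks together form one side A of a bipartite graph.  The other
-- side consists of rows, each adjacent to some set of vertices of A: a private
-- neighbour for every vertex of A and, as constraints, all sets of more than w
-- vertices of one block and, for every clause, all unions of codewords that
-- falsify each of its literals.
--
-- A row lies in a minimal vertex cover S iff its neighbourhood is not contained
-- in S.  So if S contains all constraints, then it has at most w vertices in each
-- block, and if it has exactly w in each, these code a satisfying assignment.
-- With weight 1 + 1/|V| on A and weight 1 on the rows, S weighs |A| plus the
-- number of constraints in S plus |S ∩ A|/|V|, where the last summand is less
-- than 1: as S ∩ A loses a vertex, S gains its private neighbour.  Hence the
-- formula is satisfiable iff the maximum weight of a minimal vertex cover is
-- |A| + #constraints + w · #blocks / |V|.  Since A is a vertex cover of weight
-- less than |A| + 1 = L · #blocks + 1, time (2 - ε)^vc_w is within (2 - δ)^n up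
-- to a constant factor.

module Submission where

open import Defs

-- A row can only forbid that some set lies inside S, so the expressible conditions are closed under
-- removing vertices, and no single vertex can stand for both values of a variable. A pair of
-- vertices per variable would repair this but double the exponent. Among sets of one fixed size,
-- inclusion is equality: a row for a `w`-set T says precisely that the block is not T. The rows for
-- oversized sets cap a block at `w`, and the surplus 1/|V| per column rewards reaching the cap, so
-- the maximum enforces the size from both sides.
--
-- The price of a fixed size is small. Some binomial coefficient of L is at least 2^L / (L + 1),
-- hence at least 2^t once L + 1 ≤ 2^ℓ. For a rational r ≤ 1 below ε, put δ = r/2 and η = r/4; then
-- (2 - r)(1 + η) ≤ 2 - δ, and with t = s ℓ and (1 + η)^s ≥ 2 the slack of t variables pays for ℓ
-- extra vertices.
--
-- The block length depends on ε alone. The clause width k affects only the polynomial factor, as a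
-- clause yields at most (1 + 2^L)^k rows. Since solvability speaks of actual programs, the
-- reduction is itself a program with a proven cost bound.

-- Programs with certified polynomial cost

module While where

  open import Data.Bool.Base using (Bool; true; false; if_then_else_)
  open import Data.Fin.Base using (Fin; zero; suc; lift)
  open import Data.List.Base as List
    using (List; []; _∷_; _++_; length; foldr; null; drop; _ʳ++_)
  open import Data.List.Membership.Propositional using (_∈_)
  import Data.List.Membership.Propositional.Properties as ∈
  open import Data.List.Properties using (ʳ++-defn; length-reverse; reverse-selfInverse)
  open import Data.List.Relation.Unary.Any using (here; there)
  open import Data.Nat.Base
  open import Data.Nat.Properties
  open import Data.Product.Base using (Σ; ∃-syntax; _×_; _,_; proj₁; proj₂)
  open import Data.Unit.Base using (⊤; tt)
  open import Data.Vec.Base using (Vec; []; _∷_; lookup)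
  open import Function.Base using (_∘_; id)
  open import Relation.Binary.PropositionalEquality

  Renames : ∀ {m n} → (Fin m → Fin n) → Vec Tree m → Vec Tree n → Set
  Renames σ ρ ρ′ = ∀ i → lookup ρ′ (σ i) ≡ lookup ρ i

  ren : ∀ {m n} → (Fin m → Fin n) → Exp m → Exp n
  ren σ (var i)       = var (σ i)
  ren σ leaf          = leaf
  ren σ (node e f)    = node (ren σ e) (ren σ f)
  ren σ (case e f g)  = case (ren σ e) (ren σ f) (ren (lift 2 σ) g)
  ren σ (let′ e f)    = let′ (ren σ e) (ren (lift 1 σ) f)
  ren σ (while e c b) = while (ren σ e) (ren (lift 1 σ) c) (ren (lift 1 σ) b)

  lift-renames : ∀ {m n} {σ : Fin m → Fin n} {ρ ρ′} v →
                 Renames σ ρ ρ′ → Renames (lift 1 σ) (v ∷ ρ) (v ∷ ρ′)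
  lift-renames v eq zero    = refl
  lift-renames v eq (suc i) = eq i

  lift₂-renames : ∀ {m n} {σ : Fin m → Fin n} {ρ ρ′} u v →
                  Renames σ ρ ρ′ → Renames (lift 2 σ) (u ∷ v ∷ ρ) (u ∷ v ∷ ρ′)
  lift₂-renames u v eq zero          = refl
  lift₂-renames u v eq (suc zero)    = refl
  lift₂-renames u v eq (suc (suc i)) = eq i

  mutual

    ren-⇓ : ∀ {m n} {σ : Fin m → Fin n} {ρ ρ′ e v t} → Renames σ ρ ρ′ →
            ρ ⊢ e ⇓ v ∥ t → ρ′ ⊢ ren σ e ⇓ v ∥ t
    ren-⇓ {σ = σ} {ρ′ = ρ′} eq (⇓var i) = subst (ρ′ ⊢ var (σ i) ⇓_∥ 1) (eq i) (⇓var (σ i))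
    ren-⇓ eq ⇓leaf         = ⇓leaf
    ren-⇓ eq (⇓node d₁ d₂)  = ⇓node (ren-⇓ eq d₁) (ren-⇓ eq d₂)
    ren-⇓ eq (⇓case₀ d₁ d₂) = ⇓case₀ (ren-⇓ eq d₁) (ren-⇓ eq d₂)
    ren-⇓ eq (⇓case₁ d₁ d₂) = ⇓case₁ (ren-⇓ eq d₁) (ren-⇓ (lift₂-renames _ _ eq) d₂)
    ren-⇓ eq (⇓let d₁ d₂)   = ⇓let (ren-⇓ eq d₁) (ren-⇓ (lift-renames _ eq) d₂)
    ren-⇓ eq (⇓while d w)   = ⇓while (ren-⇓ eq d) (ren-while eq w)

    ren-while : ∀ {m n} {σ : Fin m → Fin n} {ρ ρ′ c b v w t} → Renames σ ρ ρ′ →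
                ρ ⊢while c body b from v ⇓ w ∥ t →
                ρ′ ⊢while ren (lift 1 σ) c body ren (lift 1 σ) b from v ⇓ w ∥ t
    ren-while eq (stop d)       = stop (ren-⇓ (lift-renames _ eq) d)
    ren-while eq (step d₁ d₂ w) =
      step (ren-⇓ (lift-renames _ eq) d₁) (ren-⇓ (lift-renames _ eq) d₂) (ren-while eq w)

  infix 4 _⊢_⇓_within_
  _⊢_⇓_within_ : ∀ {n} → Vec Tree n → Exp n → Tree → ℕ → Set
  ρ ⊢ e ⇓ v within c = ∃[ t ] (ρ ⊢ e ⇓ v ∥ t × t ≤ c)

  -- A family of environments, one for each point.  The points carry all that is
  -- known about the values in the environment, so that programs need only be
  -- correct, and only polynomial in bd, on values that actually occur.
  record Ctx : Set₁ where
    field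
      Pt    : Set
      bd    : Pt → ℕ
      arity : ℕ
      env   : Pt → Vec Tree arity
  open Ctx public

  extend : (Γ : Ctx) {Y : Set} → (Y → Pt Γ) → (Y → Tree) → Ctx
  extend Γ {Y} π v = record
    { Pt = Y ; bd = bd Γ ∘ π ; arity = suc (arity Γ) ; env = λ y → v y ∷ env Γ (π y) }

  -- The base `suc (bd Γ x)` is positive, which makes the bound monotone in the degree.
  record Poly (Γ : Ctx) (g : Pt Γ → ℕ) : Set where
    constructor poly
    field
      coeff deg : ℕ
      bound     : ∀ x → g x ≤ coeff * suc (bd Γ x) ^ deg
  open Poly public

  module _ {Γ : Ctx} where

    poly-≤ : {g h : Pt Γ → ℕ} → Poly Γ h → (∀ x → g x ≤ h x) → Poly Γ g
    poly-≤ (poly C d b) le = poly C d λ x → ≤-trans (le x) (b x)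

    poly-const : ∀ c → Poly Γ (λ _ → c)
    poly-const c = poly c 0 λ x → ≤-reflexive (sym (*-identityʳ c))

    poly-bd : Poly Γ (bd Γ)
    poly-bd = poly 1 1 λ x → ≤-trans (n≤1+n _) (≤-reflexive (sym (trans (*-identityˡ _) (*-identityʳ _))))

    poly-* : {g h : Pt Γ → ℕ} → Poly Γ g → Poly Γ h → Poly Γ (λ x → g x * h x)
    poly-* (poly C d b) (poly C′ d′ b′) = poly (C * C′) (d + d′) λ x → begin
      _                                                     ≤⟨ *-mono-≤ (b x) (b′ x) ⟩
      (C * suc (bd Γ x) ^ d) * (C′ * suc (bd Γ x) ^ d′)     ≡⟨ [m*n]*[o*p]≡[m*o]*[n*p] C _ C′ _ ⟩
      (C * C′) * (suc (bd Γ x) ^ d * suc (bd Γ x) ^ d′)     ≡⟨ cong (C * C′ *_) (^-distribˡ-+-* _ d d′) ⟨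
      (C * C′) * suc (bd Γ x) ^ (d + d′)                    ∎
      where open ≤-Reasoning

    poly-+ : {g h : Pt Γ → ℕ} → Poly Γ g → Poly Γ h → Poly Γ (λ x → g x + h x)
    poly-+ (poly C d b) (poly C′ d′ b′) = poly (C + C′) (d + d′) λ x → begin
      _                                                      ≤⟨ +-mono-≤ (b x) (b′ x) ⟩
      C * suc (bd Γ x) ^ d + C′ * suc (bd Γ x) ^ d′          ≤⟨ +-mono-≤ (*-monoʳ-≤ C (^-monoʳ-≤ _ (m≤m+n d d′)))
                                                                          (*-monoʳ-≤ C′ (^-monoʳ-≤ _ (m≤n+m d′ d))) ⟩
      C * suc (bd Γ x) ^ (d + d′) + C′ * suc (bd Γ x) ^ (d + d′) ≡⟨ *-distribʳ-+ _ C C′ ⟨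
      (C + C′) * suc (bd Γ x) ^ (d + d′)                     ∎
      where open ≤-Reasoning

    poly-suc : {g : Pt Γ → ℕ} → Poly Γ g → Poly Γ (suc ∘ g)
    poly-suc = poly-+ (poly-const 1)

  poly-reindex : {Γ Δ : Ctx} (h : Pt Δ → Pt Γ) → (∀ y → bd Γ (h y) ≡ bd Δ y) →
                 {g : Pt Γ → ℕ} → Poly Γ g → Poly Δ (g ∘ h)
  poly-reindex h eq (poly C d b) =
    poly C d λ y → subst (λ m → _ ≤ C * suc m ^ d) (eq y) (b (h y))

  record Repr : Set₁ where
    constructor repr
    field
      Carrier : Set
      enc     : Carrier → Tree
  open Repr public

  nat bool unit : Repr
  nat  = repr ℕ encℕ
  bool = repr Bool encBool
  unit = repr ⊤ λ _ → leaf

  list : Repr → Repr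
  list (repr A e) = repr (List A) (encList e)

  pair : Repr → Repr → Repr
  pair (repr A e) (repr B f) = repr (A × B) λ (a , b) → node (e a) (f b)

  -- Cost alone would not compose: the cost of a loop depends on the size of the list it runs over,
  -- so the output size is bounded along with the cost.
  record Prog (Γ : Ctx) (R : Repr) (f : Pt Γ → Carrier R) : Set where
    constructor prog
    field
      exp       : Exp (arity Γ)
      cost      : Pt Γ → ℕ
      poly-cost : Poly Γ cost
      poly-size : Poly Γ (size ∘ enc R ∘ f)
      run       : ∀ x → env Γ x ⊢ exp ⇓ enc R (f x) within cost x
  open Prog public

  reindex : ∀ {Γ Δ R f} (h : Pt Δ → Pt Γ) (σ : Fin (arity Γ) → Fin (arity Δ)) →
            (∀ y → bd Γ (h y) ≡ bd Δ y) → (∀ y → Renames σ (env Γ (h y)) (env Δ y)) →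
            Prog Γ R f → Prog Δ R (f ∘ h)
  reindex h σ eq ren-env (prog e c pc ps r) = prog
    (ren σ e) (c ∘ h) (poly-reindex h eq pc) (poly-reindex h eq ps)
    λ y → let t , d , le = r (h y) in t , ren-⇓ (ren-env y) d , le

  wk : ∀ {Γ Y} {π : Y → Pt Γ} {v : Y → Tree} {R f} → Prog Γ R f → Prog (extend Γ π v) R (f ∘ π)
  wk {π = π} = reindex π suc (λ _ → refl) (λ _ _ → refl)

  -- A program sees only trees, so it computes every function with the same encoded values. This
  -- lets numbers be handled as lists and tuples be reread at another type.
  recode : ∀ {Γ R S f g} → (∀ x → enc R (f x) ≡ enc S (g x)) → Prog Γ R f → Prog Γ S g
  recode {Γ} eq (prog e c pc ps r) = prog e c pc
    (poly-≤ ps λ x → ≤-reflexive (cong size (sym (eq x))))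
    λ x → subst (env Γ x ⊢ e ⇓_within c x) (eq x) (r x)

  cast : ∀ {Γ R f g} → (∀ x → f x ≡ g x) → Prog Γ R f → Prog Γ R g
  cast {R = R} eq = recode λ x → cong (enc R) (eq x)

  varᵖ : ∀ {Γ R f} i → (∀ x → lookup (env Γ x) i ≡ enc R (f x)) →
         Poly Γ (size ∘ enc R ∘ f) → Prog Γ R f
  varᵖ {Γ} i eq ps = prog (var i) (λ _ → 1) (poly-const 1) ps
    λ x → 1 , subst (env Γ x ⊢ var i ⇓_∥ 1) (eq x) (⇓var i) , ≤-refl

  quoteᵗ : ∀ {n} → Tree → Exp n
  quoteᵗ leaf       = leaf
  quoteᵗ (node l r) = node (quoteᵗ l) (quoteᵗ r)

  quoteᵗ-⇓ : ∀ {n} {ρ : Vec Tree n} v → ρ ⊢ quoteᵗ v ⇓ v ∥ size v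
  quoteᵗ-⇓ leaf       = ⇓leaf
  quoteᵗ-⇓ (node l r) = ⇓node (quoteᵗ-⇓ l) (quoteᵗ-⇓ r)

  constᵖ : ∀ {Γ R} (v : Carrier R) → Prog Γ R (λ _ → v)
  constᵖ {R = R} v = prog (quoteᵗ (enc R v)) (λ _ → size (enc R v)) (poly-const _) (poly-const _)
    λ x → _ , quoteᵗ-⇓ (enc R v) , ≤-refl

  nodeᵖ : ∀ {Γ R S T f g h} → (∀ x → node (enc R (f x)) (enc S (g x)) ≡ enc T (h x)) →
          Prog Γ R f → Prog Γ S g → Prog Γ T h
  nodeᵖ {Γ} eq (prog e c pc ps r) (prog e′ c′ pc′ ps′ r′) = prog
    (node e e′) (λ x → suc (c x + c′ x)) (poly-suc (poly-+ pc pc′))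
    (poly-≤ (poly-suc (poly-+ ps ps′)) λ x → ≤-reflexive (cong size (sym (eq x))))
    λ x → let t , d , le = r x ; t′ , d′ , le′ = r′ x in
    suc (t + t′) , subst (env Γ x ⊢ _ ⇓_∥ _) (eq x) (⇓node d d′) , s≤s (+-mono-≤ le le′)

  pairᵖ : ∀ {Γ R S f g} → Prog Γ R f → Prog Γ S g → Prog Γ (pair R S) (λ x → f x , g x)
  pairᵖ = nodeᵖ λ _ → refl

  consᵖ : ∀ {Γ R f l} → Prog Γ R f → Prog Γ (list R) l → Prog Γ (list R) (λ x → f x ∷ l x)
  consᵖ = nodeᵖ λ _ → refl

  sucᵖ : ∀ {Γ i} → Prog Γ nat i → Prog Γ nat (suc ∘ i)
  sucᵖ = nodeᵖ {R = unit} (λ _ → refl) (constᵖ tt)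

  leftᵉ rightᵉ : ∀ {n} → Exp n → Exp n
  leftᵉ  e = case e leaf (var zero)
  rightᵉ e = case e leaf (var (suc zero))

  fstᵖ : ∀ {Γ R S f} → Prog Γ (pair R S) f → Prog Γ R (proj₁ ∘ f)
  fstᵖ (prog e c pc ps r) = prog (leftᵉ e) (λ x → suc (c x + 1))
    (poly-suc (poly-+ pc (poly-const 1)))
    (poly-≤ ps λ x → ≤-trans (m≤m+n _ _) (n≤1+n _))
    λ x → let t , d , le = r x in _ , ⇓case₁ d (⇓var zero) , s≤s (+-monoˡ-≤ 1 le)

  sndᵖ : ∀ {Γ R S f} → Prog Γ (pair R S) f → Prog Γ S (proj₂ ∘ f)
  sndᵖ (prog e c pc ps r) = prog (rightᵉ e) (λ x → suc (c x + 1))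
    (poly-suc (poly-+ pc (poly-const 1)))
    (poly-≤ ps λ x → ≤-trans (m≤n+m _ _) (n≤1+n _))
    λ x → let t , d , le = r x in _ , ⇓case₁ d (⇓var (suc zero)) , s≤s (+-monoˡ-≤ 1 le)

  -- The value at `leaf` matches `drop 1 [] = []` and `pred 0 = 0`, so a single program serves for
  -- both functions.
  right : Tree → Tree
  right leaf       = leaf
  right (node l r) = r

  size-right : ∀ v → size (right v) ≤ size v
  size-right leaf       = ≤-refl
  size-right (node l r) = ≤-trans (m≤n+m _ _) (n≤1+n _)

  rightᵉ-⇓ : ∀ {n} {ρ : Vec Tree n} {e v t} → ρ ⊢ e ⇓ v ∥ t → ρ ⊢ rightᵉ e ⇓ right v ∥ suc (t + 1)
  rightᵉ-⇓ {v = leaf}     d = ⇓case₀ d ⇓leaf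
  rightᵉ-⇓ {v = node l r} d = ⇓case₁ d (⇓var (suc zero))

  rightᵖ : ∀ {Γ R S f g} → (∀ x → right (enc R (f x)) ≡ enc S (g x)) → Prog Γ R f → Prog Γ S g
  rightᵖ {Γ} {R} {f = f} eq (prog e c pc ps r) = prog (rightᵉ e) (λ x → suc (c x + 1))
    (poly-suc (poly-+ pc (poly-const 1)))
    (poly-≤ ps λ x → ≤-trans (≤-reflexive (cong size (sym (eq x)))) (size-right (enc R (f x))))
    λ x → let t , d , le = r x in
    _ , subst (env Γ x ⊢ rightᵉ e ⇓_∥ _) (eq x) (rightᵉ-⇓ d) , s≤s (+-monoˡ-≤ 1 le)

  tailᵖ : ∀ {Γ R l} → Prog Γ (list R) l → Prog Γ (list R) (drop 1 ∘ l)
  tailᵖ {R = R} {l} = rightᵖ λ x → tail-enc (l x)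
    where
    tail-enc : ∀ xs → right (encList (enc R) xs) ≡ encList (enc R) (drop 1 xs)
    tail-enc []       = refl
    tail-enc (x ∷ xs) = refl

  predᵖ : ∀ {Γ i} → Prog Γ nat i → Prog Γ nat (pred ∘ i)
  predᵖ {i = i} = rightᵖ λ x → pred-enc (i x)
    where
    pred-enc : ∀ n → right (encℕ n) ≡ encℕ (pred n)
    pred-enc zero    = refl
    pred-enc (suc n) = refl

  headᵖ : ∀ {Γ R l f} → (∀ x → ∃[ xs ] l x ≡ f x ∷ xs) → Prog Γ (list R) l → Prog Γ R f
  headᵖ {R = R} {l} nonempty P =
    fstᵖ {S = list R} (recode {g = λ x → _ , proj₁ (nonempty x)} (λ x → cong (encList (enc R)) (proj₂ (nonempty x))) P)

  shift₂ : ∀ {n} → Fin n → Fin (suc (suc n))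
  shift₂ i = suc (suc i)

  ifᵖ : ∀ {Γ R b f g} → Prog Γ bool b → Prog Γ R f → Prog Γ R g →
        Prog Γ R (λ x → if b x then f x else g x)
  ifᵖ {Γ} {R} {b} {f} {g} (prog e c pc ps r) (prog e₁ c₁ pc₁ ps₁ r₁) (prog e₂ c₂ pc₂ ps₂ r₂) = prog
    (case e e₂ (ren shift₂ e₁)) (λ x → suc (c x + (c₁ x + c₂ x)))
    (poly-suc (poly-+ pc (poly-+ pc₁ pc₂)))
    (poly-≤ (poly-+ ps₁ ps₂) λ x → size-if (b x))
    λ x → let t , d , le = r x in branch x (b x) d le
    where
    size-if : ∀ {x} β → size (enc R (if β then f x else g x)) ≤ size (enc R (f x)) + size (enc R (g x))
    size-if false = m≤n+m _ _
    size-if true  = m≤m+n _ _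

    branch : ∀ x β {t} → env Γ x ⊢ e ⇓ encBool β ∥ t → t ≤ c x →
             env Γ x ⊢ case e e₂ (ren shift₂ e₁) ⇓ enc R (if β then f x else g x)
               within suc (c x + (c₁ x + c₂ x))
    branch x false d le = let t′ , d′ , le′ = r₂ x in
      _ , ⇓case₀ d d′ , s≤s (+-mono-≤ le (≤-trans le′ (m≤n+m _ _)))
    branch x true d le = let t′ , d′ , le′ = r₁ x in
      _ , ⇓case₁ d (ren-⇓ (λ _ → refl) d′) , s≤s (+-mono-≤ le (≤-trans le′ (m≤m+n _ _)))

  isLeaf : Tree → Bool
  isLeaf leaf       = true
  isLeaf (node _ _) = false

  isLeafᵖ : ∀ {Γ R f b} → (∀ x → isLeaf (enc R (f x)) ≡ b x) → Prog Γ R f → Prog Γ bool b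
  isLeafᵖ {Γ} {R} {f} {b} eq (prog e c pc ps r) = prog e′
    (λ x → suc (c x + 3)) (poly-suc (poly-+ pc (poly-const 3)))
    (poly-≤ (poly-const 3) λ x → size-bool (b x))
    λ x → let t , d , le = r x in
    subst (λ β → env Γ x ⊢ e′ ⇓ encBool β within suc (c x + 3)) (eq x) (decide (enc R (f x)) d le)
    where
    e′ = case e (node leaf leaf) leaf

    size-bool : ∀ β → size (encBool β) ≤ 3
    size-bool false = s≤s z≤n
    size-bool true  = ≤-refl

    decide : ∀ {ρ t k} v → ρ ⊢ e ⇓ v ∥ t → t ≤ k → ρ ⊢ e′ ⇓ encBool (isLeaf v) within suc (k + 3)
    decide leaf       d le = _ , ⇓case₀ d (⇓node ⇓leaf ⇓leaf) , s≤s (+-monoˡ-≤ 3 le)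
    decide (node _ _) d le = _ , ⇓case₁ d ⇓leaf , s≤s (+-mono-≤ le (s≤s z≤n))

  nullᵖ : ∀ {Γ R l} → Prog Γ (list R) l → Prog Γ bool (null ∘ l)
  nullᵖ {R = R} {l} = isLeafᵖ λ x → null-enc (l x)
    where
    null-enc : ∀ xs → isLeaf (encList (enc R) xs) ≡ null xs
    null-enc []       = refl
    null-enc (x ∷ xs) = refl

  -- The state is the pair of the remaining elements and the accumulator.
  loopᵉ : ∀ {n} → Exp n → Exp n → Exp (suc (suc n)) → Exp n
  loopᵉ {n} e z s = rightᵉ (while (node e z) (leftᵉ (var zero))
    (case (var zero) leaf (case (var zero) leaf (node (var (suc zero)) (ren σ s)))))
    where
    -- The loop binds the state and the two `case`s bind four more variables; 0 is the head of the
    -- remaining list and 3 the accumulator.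
    σ : Fin (2 + n) → Fin (5 + n)
    σ zero          = zero
    σ (suc zero)    = suc (suc (suc zero))
    σ (suc (suc i)) = suc (suc (suc (suc (suc i))))

  module _ {n} {ρ : Vec Tree n} {A : Set} (encA : A → Tree) (acc : List A → Tree)
           (c : ℕ) {e z : Exp n} {s : Exp (suc (suc n))} where

    -- A round costs 10 units beyond the body: 3 for the test, 6 for taking the state apart and
    -- rebuilding it, 1 for the loop. The body has to be correct only at states that the run
    -- reaches, which is what the equation between reversed appends records.
    loop-⇓ : ∀ xs ys {t₁ t₂} → ρ ⊢ e ⇓ encList encA xs ∥ t₁ → ρ ⊢ z ⇓ acc ys ∥ t₂ →
             (∀ zs a us → zs ʳ++ (a ∷ us) ≡ xs ʳ++ ys →
               encA a ∷ acc us ∷ ρ ⊢ s ⇓ acc (a ∷ us) within c) →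
             ρ ⊢ loopᵉ e z s ⇓ acc (xs ʳ++ ys) within t₁ + t₂ + length xs * (c + 10) + 10
    loop-⇓ xs ys {t₁} {t₂} d₁ d₂ ok =
      let t , w , le = iterate xs ys ok in
      suc (suc (suc (t₁ + t₂) + t) + 1) , ⇓case₁ (⇓while (⇓node d₁ d₂) w) (⇓var (suc zero)) , (begin
      suc (suc (suc (t₁ + t₂) + t) + 1)                    ≡⟨ cong suc (+-comm _ 1) ⟩
      4 + (t₁ + t₂ + t)                                    ≤⟨ +-monoʳ-≤ 4 (+-monoʳ-≤ (t₁ + t₂) le) ⟩
      4 + (t₁ + t₂ + (length xs * (c + 10) + 6))           ≡⟨ cong (4 +_) (+-assoc (t₁ + t₂) _ 6) ⟨
      4 + ((t₁ + t₂ + length xs * (c + 10)) + 6)           ≡⟨ +-comm 4 _ ⟩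
      (t₁ + t₂ + length xs * (c + 10)) + 6 + 4             ≡⟨ +-assoc (t₁ + t₂ + length xs * (c + 10)) 6 4 ⟩
      t₁ + t₂ + length xs * (c + 10) + 10                  ∎)
      where
      open ≤-Reasoning hiding (stop)

      iterate : ∀ xs ys →
                (∀ zs a us → zs ʳ++ (a ∷ us) ≡ xs ʳ++ ys →
                  encA a ∷ acc us ∷ ρ ⊢ s ⇓ acc (a ∷ us) within c) →
                ∃[ t ] ((ρ ⊢while leftᵉ (var zero) body
                          case (var zero) leaf (case (var zero) leaf (node (var (suc zero)) (ren _ s)))
                          from node (encList encA xs) (acc ys) ⇓ node leaf (acc (xs ʳ++ ys)) ∥ t)
                        × t ≤ length xs * (c + 10) + 6)
      iterate []       ys ok = _ , stop (⇓case₁ (⇓var zero) (⇓var zero)) , s≤s (s≤s (s≤s (s≤s z≤n)))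
      iterate (x ∷ xs) ys ok =
        let t , d , le = ok xs x ys refl
            t′ , w , le′ = iterate xs (x ∷ ys) ok in
        _ ,
        step (⇓case₁ (⇓var zero) (⇓var zero))
          (⇓case₁ (⇓var zero) (⇓case₁ (⇓var zero) (⇓node (⇓var (suc zero))
            (ren-⇓ (λ { zero → refl ; (suc zero) → refl ; (suc (suc i)) → refl }) d))))
          w ,
        (begin
        suc (3 + (6 + t) + t′)                   ≡⟨ refl ⟩
        10 + t + t′                              ≡⟨ cong (_+ t′) (+-comm 10 t) ⟩
        t + 10 + t′                              ≤⟨ +-mono-≤ (+-monoˡ-≤ 10 le) le′ ⟩
        c + 10 + (length xs * (c + 10) + 6)      ≡⟨ +-assoc (c + 10) _ 6 ⟨
        c + 10 + length xs * (c + 10) + 6        ∎)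

  length≤size : ∀ {A : Set} (e : A → Tree) xs → length xs ≤ size (encList e xs)
  length≤size e []       = z≤n
  length≤size e (x ∷ xs) = s≤s (≤-trans (length≤size e xs) (m≤n+m _ _))

  ∈⇒size≤ : ∀ {A : Set} (e : A → Tree) {x xs} → x ∈ xs → size (e x) ≤ size (encList e xs)
  ∈⇒size≤ e (here refl) = ≤-trans (m≤m+n _ _) (n≤1+n _)
  ∈⇒size≤ e (there x∈)  = ≤-trans (∈⇒size≤ e x∈) (≤-trans (m≤n+m _ _) (n≤1+n _))

  size-++ : ∀ {A : Set} (e : A → Tree) xs ys →
            size (encList e (xs ++ ys)) ≤ size (encList e xs) + size (encList e ys)
  size-++ e []       ys = n≤1+n _
  size-++ e (x ∷ xs) ys = s≤s (≤-trans (+-monoʳ-≤ (size (e x)) (size-++ e xs ys))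
    (≤-reflexive (sym (+-assoc (size (e x)) _ _))))

  -- A right fold runs over the reversed list: `after` has been processed, and
  -- `before` is still to come, nearest element first.
  record Split {A : Set} (xs : List A) : Set where
    constructor split
    field
      before : List A
      this   : A
      after  : List A
      splits : before ʳ++ (this ∷ after) ≡ xs
  open Split public

  this∈ : ∀ {A : Set} {xs : List A} (s : Split xs) → this s ∈ xs
  this∈ (split zs a us eq) =
    subst (a ∈_) (trans (sym (ʳ++-defn zs)) eq) (∈.∈-++⁺ʳ (List.reverse zs) (here refl))

  module _ {Γ : Ctx} {R S : Repr} (l : Pt Γ → List (Carrier R))
           (f : Pt Γ → Carrier R → Carrier S → Carrier S) (z : Pt Γ → Carrier S) where

    StepPt : Set
    StepPt = Σ (Pt Γ) (Split ∘ l)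

    element : StepPt → Carrier R
    element (x , s) = this s

    result : StepPt → Carrier S
    result (x , s) = foldr (f x) (z x) (after s)

    Acc Step : Ctx
    Acc  = extend Γ {StepPt} proj₁ (enc S ∘ result)
    Step = extend Acc id (enc R ∘ element)

  wkStep : ∀ {Γ R S l f z T g} → Prog Γ T g → Prog (Step {Γ} {R} {S} l f z) T (g ∘ proj₁)
  wkStep {Γ} {R} {S} {l} {f} {z} P =
    wk {Acc {Γ} {R} {S} l f z} {π = id} {v = enc R ∘ element {Γ} {R} {S} l f z} (wk P)

  module _ {Γ : Ctx} {R S : Repr} {l : Pt Γ → List (Carrier R)}
           {f : Pt Γ → Carrier R → Carrier S → Carrier S} {z : Pt Γ → Carrier S} where

    private
      Δ : Ctx
      Δ = Step {Γ} {R} {S} l f z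

    -- Iterating a polynomial step can produce exponentially large values. Hence a polynomial bound
    -- `s` on all intermediate accumulators is asked for; with it, a step that is polynomial in `bd`
    -- yields a polynomial loop.
    foldrᵖ : (s : Pt Γ → ℕ) → Poly Γ s →
             (∀ x zs us → zs ʳ++ us ≡ l x → size (enc S (foldr (f x) (z x) us)) ≤ s x) →
             Prog Γ (list R) l → Prog Γ S z →
             ((∀ {T k} → Prog Γ T k → Prog Δ T (k ∘ proj₁)) →
              Prog Δ R (element {Γ} {R} {S} l f z) → Prog Δ S (result {Γ} {R} {S} l f z) →
              Prog Δ S (λ y → f (proj₁ y) (this (proj₂ y)) (result {Γ} {R} {S} l f z y))) →
             Prog Γ S (λ x → foldr (f x) (z x) (l x))
    foldrᵖ s ps size≤ (prog e c pc pl r) (prog e₀ c₀ pc₀ _ r₀) step′ = prog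
      -- The inner loop pushes the elements onto an empty list and thereby reverses it, so that the
      -- outer loop consumes the last element first.
      (loopᵉ (loopᵉ e leaf (node (var zero) (var (suc zero)))) e₀ (exp body))
      total
      (poly-+ (poly-+ (poly-+
        (poly-+ (poly-+ (poly-+ pc (poly-const 1)) (poly-* plen (poly-const 13))) (poly-const 10))
        pc₀) (poly-* plen (poly-+ pstep (poly-const 10)))) (poly-const 10))
      (poly-≤ ps λ x → size≤ x [] (l x) refl)
      λ x →
        let t₁ , d₁ , le₁ = r x
            t₂ , d₂ , le₂ = r₀ x
            t₃ , d₃ , le₃ = loop-⇓ {ρ = env Γ x} (enc R) (encList (enc R)) 3 (l x) [] d₁ ⇓leaf
                              λ zs a us _ → 3 , ⇓node (⇓var zero) (⇓var (suc zero)) , ≤-refl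
            rev = l x ʳ++ []
            back : rev ʳ++ [] ≡ l x
            back = reverse-selfInverse (refl {x = List.reverse (l x)})
            t₄ , d₄ , le₄ = loop-⇓ {ρ = env Γ x} (enc R) (λ us → enc S (foldr (f x) (z x) us))
                              (step-bound x) {s = exp body} rev [] d₃ d₂
                              λ zs a us eq →
                                let y = x , split zs a us (trans eq back)
                                    t , d , le = run body y
                                in t , d , ≤-trans le (bound (poly-cost body) y)
        in t₄ ,
           subst (λ us → env Γ x ⊢ _ ⇓ enc S (foldr (f x) (z x) us) ∥ t₄) back d₄ ,
           ≤-trans le₄ (+-monoˡ-≤ 10 (+-mono-≤
             (+-mono-≤ (≤-trans le₃ (+-monoˡ-≤ 10 (+-monoˡ-≤ (length (l x) * 13) (+-monoˡ-≤ 1 le₁)))) le₂)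
             (≤-reflexive (cong (_* (step-bound x + 10)) (length-rev (l x))))))
      where
      psize-this : Poly Δ (size ∘ enc R ∘ element {Γ} {R} {S} l f z)
      psize-this = poly-≤ (poly-reindex {Γ} {Δ} proj₁ (λ _ → refl) pl) λ (x , p) → ∈⇒size≤ (enc R) (this∈ p)

      psize-acc : Poly Δ (size ∘ enc S ∘ result {Γ} {R} {S} l f z)
      psize-acc = poly-≤ (poly-reindex {Γ} {Δ} proj₁ (λ _ → refl) ps) λ where
        (x , split zs a us eq) → size≤ x (a ∷ zs) us eq

      body : Prog Δ S _
      body = step′ (wkStep {S = S} {f = f} {z = z}) (varᵖ zero (λ _ → refl) psize-this) (varᵖ (suc zero) (λ _ → refl) psize-acc)

      -- One bound serves all rounds, because `bd` of the step context depends only on the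
      -- underlying point and not on the split.
      step-bound : Pt Γ → ℕ
      step-bound x = coeff (poly-cost body) * suc (bd Γ x) ^ deg (poly-cost body)

      pstep : Poly Γ step-bound
      pstep = poly (coeff (poly-cost body)) (deg (poly-cost body)) λ _ → ≤-refl

      plen : Poly Γ (length ∘ l)
      plen = poly-≤ pl λ x → length≤size (enc R) (l x)

      total : Pt Γ → ℕ
      total x = c x + 1 + length (l x) * 13 + 10 + c₀ x + length (l x) * (step-bound x + 10) + 10

      length-rev : ∀ xs → length (xs ʳ++ []) ≡ length xs
      length-rev = length-reverse

-- A library of list and number programs

module Combinators where

  open While
  open import Data.Bool.Base using (Bool; true; false; if_then_else_)
  open import Data.Fin.Base using (Fin; zero; suc; toℕ)
  open import Data.List.Base as List
    using (List; []; _∷_; _++_; length; map; foldr; concatMap; replicate; null; drop; _ʳ++_; downFrom; tabulate)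
  open import Data.List.Membership.Propositional using (_∈_)
  open import Data.List.Properties using (map-cong; tabulate-cong; map-replicate; length-replicate; ʳ++-defn)
  open import Data.List.Relation.Unary.Any using (here; there)
  open import Data.List.Membership.Propositional.Properties using (∈-++⁺ʳ)
  open import Data.Nat.Base
  open import Data.Nat.GeneralisedArithmetic using (fold)
  open import Data.Nat.Properties
  open import Data.Product.Base using (Σ; ∃-syntax; _×_; _,_; proj₁; proj₂)
  open import Data.Unit.Base using (⊤; tt)
  open import Function.Base using (_∘_)
  open import Relation.Binary.PropositionalEquality

  size-suffix : ∀ {A : Set} (e : A → Tree) zs us {xs} → zs ʳ++ us ≡ xs →
                size (encList e us) ≤ size (encList e xs)
  size-suffix e []       us refl = ≤-refl
  size-suffix e (z ∷ zs) us eq   =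
    ≤-trans (≤-trans (m≤n+m _ _) (n≤1+n _)) (size-suffix e zs (z ∷ us) eq)

  length-suffix : ∀ {A : Set} (zs us : List A) {xs} → zs ʳ++ us ≡ xs → length us ≤ length xs
  length-suffix []       us refl = ≤-refl
  length-suffix (z ∷ zs) us eq   = ≤-trans (n≤1+n _) (length-suffix zs (z ∷ us) eq)

  foldr-∷ : ∀ {A : Set} (xs ys : List A) → foldr _∷_ ys xs ≡ xs ++ ys
  foldr-∷ []       ys = refl
  foldr-∷ (x ∷ xs) ys = cong (x ∷_) (foldr-∷ xs ys)

  appendᵖ : ∀ {Γ R l l′} → Prog Γ (list R) l → Prog Γ (list R) l′ → Prog Γ (list R) (λ x → l x ++ l′ x)
  appendᵖ {Γ} {R} {l} {l′} P Q = cast (λ x → foldr-∷ (l x) (l′ x))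
    (foldrᵖ _ (poly-+ (poly-size P) (poly-size Q))
      (λ x zs us eq → ≤-trans (≤-reflexive (cong (size ∘ encList (enc R)) (foldr-∷ us (l′ x))))
        (≤-trans (size-++ (enc R) us (l′ x)) (+-monoˡ-≤ _ (size-suffix (enc R) zs us eq))))
      P Q λ _ → consᵖ)

  ElemPt : (Γ : Ctx) {A : Set} → (Pt Γ → List A) → Set
  ElemPt Γ l = Σ (Pt Γ) λ x → ∃[ a ] a ∈ l x

  -- A point remembers that the element occurs in the list, so the body may rely on properties of
  -- the members, such as the width of a clause.
  Elem : (Γ : Ctx) (R : Repr) → (Pt Γ → List (Carrier R)) → Ctx
  Elem Γ R l = extend Γ {ElemPt Γ l} proj₁ (λ (_ , a , _) → enc R a)

  wkElem : ∀ {Γ R l T k} → Prog Γ T k → Prog (Elem Γ R l) T (k ∘ proj₁)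
  wkElem {Γ} {R} {l} = wk {Γ} {ElemPt Γ l} {proj₁} {λ (_ , a , _) → enc R a}

  module _ {Γ : Ctx} {R S : Repr} {l : Pt Γ → List (Carrier R)}
           {g : ElemPt Γ l → List (Carrier S)}
           {h : Pt Γ → Carrier R → List (Carrier S)}
           (agree : ∀ y → g y ≡ h (proj₁ y) (proj₁ (proj₂ y))) where

    -- The size bound that `foldrᵖ` asks for comes for free: an intermediate result concatenates at
    -- most `length (l x)` outputs of the body, all within one bound that depends on `x` only.
    concatMapᵖ : Prog Γ (list R) l →
      ((∀ {T k} → Prog Γ T k → Prog (Elem Γ R l) T (k ∘ proj₁)) →
       Prog (Elem Γ R l) R (λ y → proj₁ (proj₂ y)) → Prog (Elem Γ R l) (list S) g) →
      Prog Γ (list S) (λ x → concatMap (h x) (l x))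
    concatMapᵖ P body = cast (λ x → foldr-concatMap (h x) (l x))
      (foldrᵖ {f = λ x a b → h x a ++ b} {z = λ _ → []} total
        (poly-suc (poly-* (poly-size P) pbound))
        (λ x zs us eq → ≤-trans (linear x us λ {a} a∈ → subst (a ∈_) eq (∈-ʳ++ zs a∈))
          (s≤s (*-monoˡ-≤ (bound-at x) (≤-trans (length-suffix zs us eq) (length≤size (enc R) (l x))))))
        P (constᵖ []) λ _ _ acc → appendᵖ (reindex {Γ = Elem Γ R l} toElem σ (λ _ → refl)
          (λ { _ zero → refl ; _ (suc i) → refl }) (cast agree B)) acc)
      where
      B = body wkElem (varᵖ zero (λ _ → refl)
        (poly-≤ (poly-reindex {Γ} {Elem Γ R l} proj₁ (λ _ → refl) (poly-size P)) λ (_ , _ , a∈) → ∈⇒size≤ (enc R) a∈))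

      bound-at : Pt Γ → ℕ
      bound-at x = coeff (poly-size B) * suc (bd Γ x) ^ deg (poly-size B)

      pbound : Poly Γ bound-at
      pbound = poly (coeff (poly-size B)) (deg (poly-size B)) λ _ → ≤-refl

      total : Pt Γ → ℕ
      total x = suc (size (encList (enc R) (l x)) * bound-at x)

      toElem : StepPt {Γ} {R} {list S} l (λ x a b → h x a ++ b) (λ _ → []) → ElemPt Γ l
      toElem (x , s) = x , this s , this∈ s

      σ : Fin (suc (arity Γ)) → Fin (suc (suc (arity Γ)))
      σ zero    = zero
      σ (suc i) = suc (suc i)

      ∈-ʳ++ : ∀ {a} zs {us : List (Carrier R)} → a ∈ us → a ∈ zs ʳ++ us
      ∈-ʳ++ zs {us} a∈ = subst (_ ∈_) (sym (ʳ++-defn zs)) (∈-++⁺ʳ (List.reverse zs) a∈)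

      foldr-concatMap : ∀ (k : Carrier R → List (Carrier S)) xs →
                        foldr (λ a b → k a ++ b) [] xs ≡ concatMap k xs
      foldr-concatMap k []       = refl
      foldr-concatMap k (x ∷ xs) = cong (k x ++_) (foldr-concatMap k xs)

      linear : ∀ x us → (∀ {a} → a ∈ us → a ∈ l x) →
               size (encList (enc S) (foldr (λ a b → h x a ++ b) [] us)) ≤ suc (length us * bound-at x)
      linear x []       us⊆ = ≤-refl
      linear x (a ∷ us) us⊆ = begin
        _                                               ≤⟨ size-++ (enc S) (h x a) _ ⟩
        size (encList (enc S) (h x a)) + _              ≤⟨ +-mono-≤
            (subst (λ ys → size (encList (enc S) ys) ≤ bound-at x) (agree (x , a , us⊆ (here refl)))
              (bound (poly-size B) (x , a , us⊆ (here refl))))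
            (linear x us (us⊆ ∘ there)) ⟩
        bound-at x + suc (length us * bound-at x)       ≡⟨ +-suc _ _ ⟩
        suc (bound-at x + length us * bound-at x)       ∎
        where open ≤-Reasoning

  mapᵖ : ∀ {Γ R S} {l : Pt Γ → List (Carrier R)} {g : ElemPt Γ l → Carrier S}
         {h : Pt Γ → Carrier R → Carrier S} →
         (∀ y → g y ≡ h (proj₁ y) (proj₁ (proj₂ y))) →
         Prog Γ (list R) l →
         ((∀ {T k} → Prog Γ T k → Prog (Elem Γ R l) T (k ∘ proj₁)) →
          Prog (Elem Γ R l) R (λ y → proj₁ (proj₂ y)) → Prog (Elem Γ R l) S g) →
         Prog Γ (list S) (λ x → map (h x) (l x))
  mapᵖ {l = l} {h = h} agree P body = cast (λ x → concatMap-[-] (h x) (l x))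
    (concatMapᵖ {h = λ x a → h x a ∷ []} (λ y → cong (_∷ []) (agree y)) P λ up a → consᵖ (body up a) (constᵖ []))
    where
    concatMap-[-] : ∀ {A B : Set} (k : A → B) xs → concatMap (λ a → k a ∷ []) xs ≡ map k xs
    concatMap-[-] k []       = refl
    concatMap-[-] k (x ∷ xs) = cong (k x ∷_) (concatMap-[-] k xs)

  size-mono : ∀ {m n} → m ≤ n → size (encℕ m) ≤ size (encℕ n)
  size-mono {n = zero}  z≤n     = ≤-refl
  size-mono {n = suc n} z≤n     = s≤s z≤n
  size-mono             (s≤s p) = s≤s (s≤s (size-mono p))

  n≤size : ∀ n → n ≤ size (encℕ n)
  n≤size zero    = z≤n
  n≤size (suc n) = s≤s (≤-trans (n≤size n) (n≤1+n _))

  encℕ-replicate : ∀ n → encℕ n ≡ encList (enc unit) (replicate n tt)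
  encℕ-replicate zero    = refl
  encℕ-replicate (suc n) = cong (node leaf) (encℕ-replicate n)

  -- A unary numeral is already the tree of a list of leaves, so list programs do arithmetic.
  toUnary : ∀ {Γ i} → Prog Γ nat i → Prog Γ (list unit) (λ x → replicate (i x) tt)
  toUnary {i = i} = recode λ x → encℕ-replicate (i x)

  lengthᵖ : ∀ {Γ R l} → Prog Γ (list R) l → Prog Γ nat (length ∘ l)
  lengthᵖ {l = l} P = recode (λ x → sym (encℕ-length (l x)))
    (mapᵖ {g = λ _ → tt} {h = λ _ _ → tt} (λ _ → refl) P λ _ _ → constᵖ tt)
    where
    encℕ-length : ∀ {A : Set} (xs : List A) → encℕ (length xs) ≡ encList (enc unit) (map (λ _ → tt) xs)
    encℕ-length []       = refl
    encℕ-length (x ∷ xs) = cong (node leaf) (encℕ-length xs)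

  addᵖ : ∀ {Γ i j} → Prog Γ nat i → Prog Γ nat j → Prog Γ nat (λ x → i x + j x)
  addᵖ {i = i} {j} P Q = recode (λ x → sym (encℕ-+ (i x) (j x))) (appendᵖ (toUnary P) (toUnary Q))
    where
    encℕ-+ : ∀ m n → encℕ (m + n) ≡ encList (enc unit) (replicate m tt ++ replicate n tt)
    encℕ-+ zero    n = encℕ-replicate n
    encℕ-+ (suc m) n = cong (node leaf) (encℕ-+ m n)

  replicateᵖ : ∀ {Γ R i v} → Prog Γ nat i → Prog Γ R v → Prog Γ (list R) (λ x → replicate (i x) (v x))
  replicateᵖ {i = i} {v} P Q = cast (λ x → map-replicate (λ _ → v x) (i x) tt)
    (mapᵖ {h = λ x _ → v x} (λ _ → refl) (toUnary P) λ up _ → up Q)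

  mulᵖ : ∀ {Γ i j} → Prog Γ nat i → Prog Γ nat j → Prog Γ nat (λ x → i x * j x)
  mulᵖ {i = i} {j} P Q = recode (λ x → trans (cong (encList (enc unit)) (concat-replicate (i x) (j x))) (sym (encℕ-replicate (i x * j x))))
    (concatMapᵖ {h = λ x _ → replicate (j x) tt} (λ _ → refl) (toUnary P) λ up _ → up (toUnary Q))
    where
    replicate-+ : ∀ m n → replicate m tt ++ replicate n tt ≡ replicate (m + n) tt
    replicate-+ zero    n = refl
    replicate-+ (suc m) n = cong (tt ∷_) (replicate-+ m n)

    concat-replicate : ∀ m n → concatMap (λ _ → replicate n tt) (replicate m tt) ≡ replicate (m * n) tt
    concat-replicate zero    n = refl
    concat-replicate (suc m) n = trans (cong (replicate n tt ++_) (concat-replicate m n)) (replicate-+ n (m * n))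

  -- The body is polymorphic in its context: it sees the accumulator and whatever was available
  -- outside, but not the loop counter.
  foldᵖ : ∀ {Γ S i} {f : Pt Γ → Carrier S → Carrier S} {z : Pt Γ → Carrier S}
          (s : Pt Γ → ℕ) → Poly Γ s →
          (∀ x j → j ≤ i x → size (enc S (fold (z x) (f x) j)) ≤ s x) →
          Prog Γ nat i → Prog Γ S z →
          (∀ {Δ} {h : Pt Δ → Pt Γ} {a : Pt Δ → Carrier S} → (∀ {R g} → Prog Γ R g → Prog Δ R (g ∘ h)) →
            Prog Δ S a → Prog Δ S (λ y → f (h y) (a y))) →
          Prog Γ S (λ x → fold (z x) (f x) (i x))
  foldᵖ {S = S} {i} {f} {z} s ps size≤ P Z body = cast (λ x → foldr-replicate (f x) (z x) (i x))
    (foldrᵖ {f = λ x _ → f x} s ps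
      (λ x zs us eq → ≤-trans (≤-reflexive (cong (size ∘ enc S) (foldr-length (f x) (z x) us)))
        (size≤ x (length us) (≤-trans (length-suffix zs us eq) (≤-reflexive (length-replicate (i x))))))
      (toUnary P) Z λ up _ acc → body {h = proj₁} up acc)
    where
    foldr-length : ∀ {A : Set} (g : A → A) a (us : List ⊤) → foldr (λ _ → g) a us ≡ fold a g (length us)
    foldr-length g a []       = refl
    foldr-length g a (_ ∷ us) = cong g (foldr-length g a us)

    foldr-replicate : ∀ {A : Set} (g : A → A) a n → foldr (λ _ → g) a (replicate n tt) ≡ fold a g n
    foldr-replicate g a n = trans (foldr-length g a (replicate n tt)) (cong (fold a g) (length-replicate n))

  monusᵖ : ∀ {Γ i j} → Prog Γ nat i → Prog Γ nat j → Prog Γ nat (λ x → i x ∸ j x)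
  monusᵖ {i = i} {j} P Q = cast (λ x → fold-pred (i x) (j x))
    (foldᵖ {f = λ _ → pred} _ (poly-size P) (λ x k _ → shrinks (i x) k) Q P λ _ → predᵖ)
    where
    fold-pred : ∀ m n → fold m pred n ≡ m ∸ n
    fold-pred m zero    = refl
    fold-pred m (suc n) = trans (cong pred (fold-pred m n)) (pred[m∸n]≡m∸[1+n] m n)

    size-pred : ∀ m → size (encℕ (pred m)) ≤ size (encℕ m)
    size-pred zero    = ≤-refl
    size-pred (suc m) = m≤n+m _ 2

    shrinks : ∀ m k → size (encℕ (fold m pred k)) ≤ size (encℕ m)
    shrinks m zero    = ≤-refl
    shrinks m (suc k) = ≤-trans (size-pred (fold m pred k)) (shrinks m k)

  -- Two numbers agree when both truncated differences vanish.
  equalᵖ : ∀ {Γ i j} → Prog Γ nat i → Prog Γ nat j → Prog Γ bool (λ x → i x ≡ᵇ j x)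
  equalᵖ {i = i} {j} P Q = cast (λ x → by-monus (i x) (j x))
    (ifᵖ (isZeroᵖ (monusᵖ P Q)) (isZeroᵖ (monusᵖ Q P)) (constᵖ false))
    where
    isZero : ℕ → Bool
    isZero zero    = true
    isZero (suc _) = false

    isZeroᵖ : ∀ {Γ i} → Prog Γ nat i → Prog Γ bool (isZero ∘ i)
    isZeroᵖ {i = i} = isLeafᵖ λ x → isZero-enc (i x)
      where
      isZero-enc : ∀ n → isLeaf (encℕ n) ≡ isZero n
      isZero-enc zero    = refl
      isZero-enc (suc n) = refl

    by-monus : ∀ m n → (if isZero (m ∸ n) then isZero (n ∸ m) else false) ≡ (m ≡ᵇ n)
    by-monus zero    zero    = refl
    by-monus zero    (suc n) = refl
    by-monus (suc m) zero    = refl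
    by-monus (suc m) (suc n) = by-monus m n

  nth : List Bool → ℕ → Bool
  nth []       _       = false
  nth (b ∷ bs) zero    = b
  nth (b ∷ bs) (suc i) = nth bs i

  nthᵖ : ∀ {Γ l i} → Prog Γ (list bool) l → Prog Γ nat i → Prog Γ bool (λ x → nth (l x) (i x))
  nthᵖ {Γ} {l} {i} P Q = cast (λ x → nth-fold (l x) (i x))
    (leftᵖ (foldᵖ {f = λ _ → drop 1} _ (poly-size P) (λ x k _ → shrinks (l x) k) Q P λ _ → tailᵖ))
    where
    leftᵖ : ∀ {Γ l} → Prog Γ (list bool) l → Prog Γ bool (λ x → nth (l x) 0)
    leftᵖ {l = l} P = cast (λ x → if-null (l x)) (ifᵖ (nullᵖ P) (constᵖ false) (headOrᵖ P))
      where
      if-null : ∀ xs → (if null xs then false else nth xs 0) ≡ nth xs 0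
      if-null []       = refl
      if-null (x ∷ xs) = refl

      headOrᵖ : ∀ {Γ l} → Prog Γ (list bool) l → Prog Γ bool (λ x → nth (l x) 0)
      headOrᵖ {Γ} {l} (prog e c pc ps r) = prog (leftᵉ e) (λ x → suc (c x + 1))
        (poly-suc (poly-+ pc (poly-const 1))) (poly-≤ (poly-const 3) λ x → size-bool (nth (l x) 0))
        λ x → let t , d , le = r x in _ , head-⇓ (l x) d , s≤s (+-monoˡ-≤ 1 le)
        where
        size-bool : ∀ β → size (encBool β) ≤ 3
        size-bool false = s≤s z≤n
        size-bool true  = ≤-refl

        head-⇓ : ∀ {ρ t} xs → ρ ⊢ e ⇓ encList encBool xs ∥ t → ρ ⊢ leftᵉ e ⇓ encBool (nth xs 0) ∥ suc (t + 1)
        head-⇓ []       d = ⇓case₀ d ⇓leaf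
        head-⇓ (x ∷ xs) d = ⇓case₁ d (⇓var zero)

    nth-drop : ∀ xs k → nth (drop 1 xs) k ≡ nth xs (suc k)
    nth-drop []       k = refl
    nth-drop (x ∷ xs) k = refl

    nth-fold : ∀ xs k → nth (fold xs (drop 1) k) 0 ≡ nth xs k
    nth-fold xs k = trans (shifted 0 k) (cong (nth xs) (+-identityʳ k))
      where
      shifted : ∀ m k → nth (fold xs (drop 1) k) m ≡ nth xs (k + m)
      shifted m zero    = refl
      shifted m (suc k) = trans (nth-drop (fold xs (drop 1) k) m)
        (trans (shifted (suc m) k) (cong (nth xs) (+-suc k m)))

    size-drop : ∀ xs → size (encList encBool (drop 1 xs)) ≤ size (encList encBool xs)
    size-drop []       = ≤-refl
    size-drop (x ∷ xs) = ≤-trans (m≤n+m _ _) (n≤1+n _)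

    shrinks : ∀ xs k → size (encList encBool (fold xs (drop 1) k)) ≤ size (encList encBool xs)
    shrinks xs zero    = ≤-refl
    shrinks xs (suc k) = ≤-trans (size-drop (fold xs (drop 1) k)) (shrinks xs k)

  downFromᵖ : ∀ {Γ i} → Prog Γ nat i → Prog Γ (list nat) (downFrom ∘ i)
  downFromᵖ {Γ} {i} P = cast (λ x → cong proj₂ (fold-next (i x)))
    (sndᵖ (foldᵖ {S = pair nat (list nat)} {f = λ _ → next} _
      (poly-suc (poly-+ (poly-size P) (poly-suc (poly-* (poly-size P) (poly-suc (poly-size P))))))
      (λ x k k≤ → ≤-trans (≤-reflexive (cong (size ∘ enc (pair nat (list nat))) (fold-next k)))
        (s≤s (+-mono-≤ (size-mono k≤) (≤-trans (size-downFrom k)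
          (s≤s (*-mono-≤ (≤-trans k≤ (n≤size (i x))) (s≤s (size-mono k≤))))))))
      P (constᵖ (0 , [])) λ _ acc → pairᵖ (sucᵖ (fstᵖ acc)) (consᵖ (fstᵖ acc) (sndᵖ acc))))
    where
    next : ℕ × List ℕ → ℕ × List ℕ
    next (j , js) = suc j , j ∷ js

    fold-next : ∀ n → fold (0 , []) next n ≡ (n , downFrom n)
    fold-next zero    = refl
    fold-next (suc n) = cong next (fold-next n)

    size-downFrom : ∀ n → size (encList encℕ (downFrom n)) ≤ suc (n * suc (size (encℕ n)))
    size-downFrom zero    = ≤-refl
    size-downFrom (suc n) = s≤s (begin
      size (encℕ n) + size (encList encℕ (downFrom n))       ≤⟨ +-mono-≤ grow (size-downFrom n) ⟩
      size (encℕ (suc n)) + suc (n * suc (size (encℕ n)))    ≡⟨ +-suc (size (encℕ (suc n))) _ ⟩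
      suc (size (encℕ (suc n))) + n * suc (size (encℕ n))    ≤⟨ +-monoʳ-≤ (suc (size (encℕ (suc n)))) (*-monoʳ-≤ n (s≤s grow)) ⟩
      suc n * suc (size (encℕ (suc n)))                      ∎)
      where
      open ≤-Reasoning
      grow : size (encℕ n) ≤ size (encℕ (suc n))
      grow = size-mono (n≤1+n n)

  tabulateᵖ : ∀ {Γ R i} {h : Pt Γ → ℕ → Carrier R} → Prog Γ nat i →
              (∀ {Δ} {π : Pt Δ → Pt Γ} {a : Pt Δ → ℕ} → (∀ {R g} → Prog Γ R g → Prog Δ R (g ∘ π)) →
                Prog Δ nat a → Prog Δ R (λ y → h (π y) (a y))) →
              Prog Γ (list R) (λ x → tabulate {n = i x} (h x ∘ toℕ))
  tabulateᵖ {i = i} {h} P body = cast (λ x → map-downFrom (h x) 0 (i x))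
    -- `downFrom` starts with the largest index, so the entry for j is mirrored to restore
    -- increasing order.
    (mapᵖ {h = λ x j → h x (i x ∸ suc j)} (λ _ → refl) (downFromᵖ P)
      λ up j → body {π = proj₁} up (monusᵖ (up P) (sucᵖ j)))
    where
    map-downFrom : ∀ {A : Set} (k : ℕ → A) c n →
                   map (λ j → k (c + n ∸ suc j)) (downFrom n) ≡ tabulate {n = n} (λ a → k (c + toℕ a))
    map-downFrom k c zero    = refl
    map-downFrom k c (suc n) = cong₂ _∷_
      (cong k (trans (cong (_∸ suc n) (+-suc c n)) (trans (m+n∸n≡m c n) (sym (+-identityʳ c)))))
      (trans (map-cong (λ j → cong (λ m → k (m ∸ suc j)) (+-suc c n)) (downFrom n))
        (trans (map-downFrom k (suc c) n) (tabulate-cong λ a → cong k (sym (+-suc c (toℕ a))))))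

-- Constant-weight codes from large binomial coefficients

module Code where

  open import Data.Bool.Base using (Bool; true; false)
  open import Data.Fin.Base using (Fin; toℕ; fromℕ<; finToFun; funToFin)
  open import Data.Fin.Properties using (finToFun-funToFin; toℕ<n; fromℕ<-toℕ; 2↔Bool)
  open import Data.Fin.Subset using (∣_∣)
  open import Data.Nat.Base
  open import Data.Nat.Combinatorics using (_C_; nCk+nC[k+1]≡[n+1]C[k+1]; k>n⇒nCk≡0)
  open import Data.Nat.Properties
  open import Data.Product.Base using (∃-syntax; _×_; _,_)
  open import Data.Vec.Base using (Vec; []; _∷_)
  open import Function.Bundles using (Inverse)
  open import Relation.Binary.PropositionalEquality
  open import Relation.Nullary using (yes; no; contradiction)

  ∑< : (ℕ → ℕ) → ℕ → ℕ
  ∑< f zero    = 0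
  ∑< f (suc n) = ∑< f n + f n

  -- Pascal's rule summed up. The coefficient at 0 has no left parent, hence the two different
  -- lengths on the right.
  ∑<-C-step : ∀ n k → ∑< (suc n C_) (suc k) ≡ ∑< (n C_) k + ∑< (n C_) (suc k)
  ∑<-C-step n zero    = refl
  ∑<-C-step n (suc k) = begin
    ∑< (suc n C_) (suc k) + suc n C suc k                       ≡⟨ cong₂ _+_ (∑<-C-step n k) (sym (nCk+nC[k+1]≡[n+1]C[k+1] n k)) ⟩
    (∑< (n C_) k + ∑< (n C_) (suc k)) + (n C k + n C suc k)     ≡⟨ interchange (∑< (n C_) k) _ (n C k) _ ⟩
    (∑< (n C_) k + n C k) + (∑< (n C_) (suc k) + n C suc k)     ∎
    where
    open ≡-Reasoning
    interchange : ∀ a b c d → (a + b) + (c + d) ≡ (a + c) + (b + d)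
    interchange a b c d = begin
      (a + b) + (c + d) ≡⟨ +-assoc a b (c + d) ⟩
      a + (b + (c + d)) ≡⟨ cong (a +_) (trans (sym (+-assoc b c d)) (trans (cong (_+ d) (+-comm b c)) (+-assoc c b d))) ⟩
      a + (c + (b + d)) ≡⟨ +-assoc a c (b + d) ⟨
      (a + c) + (b + d) ∎

  ∑<-C : ∀ n → ∑< (n C_) (suc n) ≡ 2 ^ n
  ∑<-C zero    = refl
  ∑<-C (suc n) = begin
    ∑< (suc n C_) (suc (suc n))                        ≡⟨ ∑<-C-step n (suc n) ⟩
    ∑< (n C_) (suc n) + (∑< (n C_) (suc n) + n C suc n) ≡⟨ cong₂ (λ a b → a + (b + n C suc n)) (∑<-C n) (∑<-C n) ⟩
    2 ^ n + (2 ^ n + n C suc n)                        ≡⟨ cong (λ c → 2 ^ n + (2 ^ n + c)) (k>n⇒nCk≡0 (n<1+n n)) ⟩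
    2 ^ suc n                                          ∎
    where open ≡-Reasoning

  -- The witness is the index of the largest summand so far; for the empty sum any index will do.
  ∑<-average : ∀ f n → ∃[ w ] ∑< f n ≤ n * f w
  ∑<-average f zero    = 0 , z≤n
  ∑<-average f (suc n) with ∑<-average f n
  ... | w , le with f w ≤? f n
  ... | yes fw≤fn = n , ≤-trans (≤-reflexive (+-comm (∑< f n) (f n)))
                          (+-monoʳ-≤ (f n) (≤-trans le (*-monoʳ-≤ n fw≤fn)))
  ... | no fw≰fn  = w , ≤-trans (≤-reflexive (+-comm (∑< f n) (f n)))
                          (+-mono-≤ (<⇒≤ (≰⇒> fw≰fn)) le)

  -- The `suc (t + ℓ)` coefficients sum to 2^(t + ℓ), so the largest is at least 2^(t + ℓ) / (t + ℓ
  -- + 1), and the hypothesis bounds the divisor by 2^ℓ.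
  large-binomial : ∀ t ℓ → suc (t + ℓ) ≤ 2 ^ ℓ → ∃[ w ] 2 ^ t ≤ (t + ℓ) C w
  large-binomial t ℓ small with ∑<-average ((t + ℓ) C_) (suc (t + ℓ))
  ... | w , le = w , *-cancelˡ-≤ (2 ^ ℓ) ⦃ m^n≢0 2 ℓ ⦄ (begin
    2 ^ ℓ * 2 ^ t                             ≡⟨ *-comm (2 ^ ℓ) (2 ^ t) ⟩
    2 ^ t * 2 ^ ℓ                             ≡⟨ ^-distribˡ-+-* 2 t ℓ ⟨
    2 ^ (t + ℓ)                               ≡⟨ ∑<-C (t + ℓ) ⟨
    ∑< ((t + ℓ) C_) (suc (t + ℓ))              ≤⟨ le ⟩
    suc (t + ℓ) * ((t + ℓ) C w)               ≤⟨ *-monoˡ-≤ _ small ⟩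
    2 ^ ℓ * ((t + ℓ) C w)                     ∎)
    where open ≤-Reasoning

  -- Position of a set of size w in the lexicographic order (the combinatorial
  -- number system); the value on other sets is irrelevant.
  rank : ∀ {n} → ℕ → Vec Bool n → ℕ
  rank w       []          = 0
  rank zero    (_ ∷ T)     = rank zero T
  rank (suc w) (true ∷ T)  = rank w T
  rank {suc n} (suc w) (false ∷ T) = n C w + rank (suc w) T

  -- By Pascal's rule, the sets that contain the first element take up the ranks below `n C w`, and
  -- those that avoid it the following `n C suc w`.
  unrank : ∀ n w {i} → i < n C w → ∃[ T ] ∣ T ∣ ≡ w × rank {n} w T ≡ i
  unrank zero    zero    (s≤s z≤n) = [] , refl , refl
  unrank zero    (suc w) ()
  unrank (suc n) zero    {i} i<    with unrank n zero {i} i<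
  ... | T , card , eq = false ∷ T , card , eq
  unrank (suc n) (suc w) {i} i<    with i <? n C w
  ... | yes i<C = let T , card , eq = unrank n w i<C in true ∷ T , cong suc card , eq
  ... | no  i≮C = let T , card , eq = unrank n (suc w) {i ∸ n C w} i∸C< in
                  false ∷ T , card , trans (cong (n C w +_) eq) (m+[n∸m]≡n (≮⇒≥ i≮C))
    where
    i∸C< : i ∸ n C w < n C suc w
    i∸C< = +-cancelˡ-< (n C w) _ _ (subst₂ _<_ (sym (m+[n∸m]≡n (≮⇒≥ i≮C))) (sym (nCk+nC[k+1]≡[n+1]C[k+1] n w)) i<)

  -- `decode` is total, so every `w`-set stands for some values, whether or not it is a codeword. A
  -- full block therefore always yields an assignment.
  record ConstantWeightCode (t L w : ℕ) : Set where
    field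
      decode     : Vec Bool L → Fin t → Bool
      encode     : (Fin t → Bool) → Vec Bool L
      weight     : ∀ v → ∣ encode v ∣ ≡ w
      decode-encode : ∀ v r → decode (encode v) r ≡ v r

  module _ {t L w} (2^t≤C : 2 ^ t ≤ L C w) where

    private
      open Inverse 2↔Bool using (to; from; strictlyInverseˡ)

      index : (Fin t → Bool) → Fin (2 ^ t)
      index v = funToFin (λ r → from (v r))

      codeword : ∀ v → ∃[ T ] ∣ T ∣ ≡ w × rank {L} w T ≡ toℕ (index v)
      codeword v = unrank L w (<-≤-trans (toℕ<n (index v)) 2^t≤C)

      decode′ : Vec Bool L → Fin t → Bool
      decode′ T r with rank w T <? 2 ^ t
      ... | yes lt = to (finToFun (fromℕ< lt) r)
      -- Sets ranked beyond the 2^t indices get an arbitrary value.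
      ... | no  _  = false

      decode-index : ∀ v T → rank w T ≡ toℕ (index v) → ∀ r → decode′ T r ≡ v r
      decode-index v T eq r with rank w T <? 2 ^ t
      ... | no ≮   = contradiction (subst (_< 2 ^ t) (sym eq) (toℕ<n (index v))) ≮
      ... | yes lt = begin
        to (finToFun (fromℕ< lt) r)        ≡⟨ cong (λ i → to (finToFun i r)) (trans (fromℕ<-cong′ lt) (fromℕ<-toℕ (index v) (toℕ<n (index v)))) ⟩
        to (finToFun (index v) r)          ≡⟨ cong to (finToFun-funToFin _ r) ⟩
        to (from (v r))                    ≡⟨ strictlyInverseˡ (v r) ⟩
        v r                                ∎
        where
        open ≡-Reasoning
        fromℕ<-cong′ : (lt : rank w T < 2 ^ t) → fromℕ< lt ≡ fromℕ< (toℕ<n (index v))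
        fromℕ<-cong′ lt rewrite eq = refl

    code : ConstantWeightCode t L w
    code = record
      { decode = decode′
      ; encode = λ v → let T , _ = codeword v in T
      ; weight = λ v → let _ , card , _ = codeword v in card
      ; decode-encode = λ v → let T , _ , eq = codeword v in decode-index v T eq
      }

  block-code : ∀ t ℓ → suc (t + ℓ) ≤ 2 ^ ℓ → ∃[ w ] ConstantWeightCode t (t + ℓ) w
  block-code t ℓ room = let w , large = large-binomial t ℓ room in w , code {t} {t + ℓ} {w} large

-- Rational estimates and the choice of constants

module Rate where

  open import Data.Nat.Base as ℕ using (ℕ; zero; suc; s≤s; z≤n)
  import Data.Nat.Properties as ℕ
  import Data.Nat.Coprimality as Coprime
  import Data.Integer.Base as ℤ
  open ℤ using (∣_∣)
  open import Data.Integer.GCD using (gcd)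
  import Data.Integer.Properties as ℤ
  open import Data.Product.Base using (∃-syntax; _×_; _,_; proj₁; proj₂)
  open import Data.Rational.Base hiding (∣_∣; Positive)
  open import Data.Rational.Properties hiding (_≟_)
  import Data.Rational.Unnormalised.Base as ℚᵘ
  import Data.Rational.Unnormalised.Properties as ℚᵘ
  open import Data.Sum.Base using (_⊎_; inj₁; inj₂)
  open import Function.Bundles using (mk⇔; Equivalence)
  open import Relation.Binary.PropositionalEquality
  open import Relation.Nullary using (yes; no; contradiction)
  open import Algebra.Bundles using (CommutativeRing)

  open import Algebra.Definitions.RawSemiring +-*-rawSemiring using (_^_)
    renaming (_×_ to _·_)
  open import Algebra.Properties.CommutativeSemiring.Exp
    (CommutativeRing.commutativeSemiring +-*-commutativeRing)
    using (^-homo-*; ^-assocʳ; ^-distrib-*)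

  module _ (n : ℕ) where

    -- All weights of one instance share the denominator `suc n`, so comparing and adding them
    -- reduces to natural numbers.
    frac : ℕ → ℚ
    frac k = ℤ.+ k / suc n

    toℚᵘ-frac : ∀ k → toℚᵘ (frac k) ℚᵘ.≃ ℚᵘ.mkℚᵘ (ℤ.+ k) n
    toℚᵘ-frac k = toℚᵘ-fromℚᵘ (ℚᵘ.mkℚᵘ (ℤ.+ k) n)

    frac-+ : ∀ a b → frac a + frac b ≡ frac (a ℕ.+ b)
    frac-+ a b = toℚᵘ-injective (begin
      toℚᵘ (frac a + frac b)                          ≈⟨ toℚᵘ-homo-+ (frac a) (frac b) ⟩
      toℚᵘ (frac a) ℚᵘ.+ toℚᵘ (frac b)                ≈⟨ ℚᵘ.+-cong (toℚᵘ-frac a) (toℚᵘ-frac b) ⟩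
      ℚᵘ.mkℚᵘ (ℤ.+ a) n ℚᵘ.+ ℚᵘ.mkℚᵘ (ℤ.+ b) n        ≈⟨ ℚᵘ.*≡* common ⟩
      ℚᵘ.mkℚᵘ (ℤ.+ (a ℕ.+ b)) n                       ≈⟨ toℚᵘ-frac (a ℕ.+ b) ⟨
      toℚᵘ (frac (a ℕ.+ b))                           ∎)
      where
      open import Relation.Binary.Reasoning.Setoid ℚᵘ.≃-setoid
      N = ℤ.+ suc n
      common : (ℤ.+ a ℤ.* N ℤ.+ ℤ.+ b ℤ.* N) ℤ.* N ≡ ℤ.+ (a ℕ.+ b) ℤ.* (N ℤ.* N)
      common = trans (cong (ℤ._* N) (sym (ℤ.*-distribʳ-+ N (ℤ.+ a) (ℤ.+ b)))) (ℤ.*-assoc (ℤ.+ (a ℕ.+ b)) N N)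

    frac-mono : ∀ {a b} → a ℕ.≤ b → frac a ≤ frac b
    frac-mono {a} {b} a≤b = toℚᵘ-cancel-≤ (begin
      toℚᵘ (frac a)       ≃⟨ toℚᵘ-frac a ⟩
      ℚᵘ.mkℚᵘ (ℤ.+ a) n   ≤⟨ ℚᵘ.*≤* (ℤ.*-monoʳ-≤-nonNeg (ℤ.+ suc n) (ℤ.+≤+ a≤b)) ⟩
      ℚᵘ.mkℚᵘ (ℤ.+ b) n   ≃⟨ toℚᵘ-frac b ⟨
      toℚᵘ (frac b)       ∎)
      where open ℚᵘ.≤-Reasoning

    frac-cancel : ∀ {a b} → frac a ≤ frac b → a ℕ.≤ b
    frac-cancel {a} {b} le = ℤ.drop‿+≤+ (ℤ.*-cancelʳ-≤-pos (ℤ.+ a) (ℤ.+ b) (ℤ.+ suc n) (ℚᵘ.drop-*≤* (begin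
      ℚᵘ.mkℚᵘ (ℤ.+ a) n   ≃⟨ toℚᵘ-frac a ⟨
      toℚᵘ (frac a)       ≤⟨ toℚᵘ-mono-≤ le ⟩
      toℚᵘ (frac b)       ≃⟨ toℚᵘ-frac b ⟩
      ℚᵘ.mkℚᵘ (ℤ.+ b) n   ∎)))
      where open ℚᵘ.≤-Reasoning

    frac-0 : frac 0 ≡ 0ℚ
    frac-0 = toℚᵘ-injective (ℚᵘ.≃-trans (toℚᵘ-frac 0) (ℚᵘ.*≡* refl))

    frac-1 : frac (suc n) ≡ 1ℚ
    frac-1 = toℚᵘ-injective (ℚᵘ.≃-trans (toℚᵘ-frac (suc n)) (ℚᵘ.*≡* (ℤ.*-comm (ℤ.+ suc n) ℤ.1ℤ)))

    frac-· : ∀ k a → k · frac a ≡ frac (k ℕ.* a)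
    frac-· zero    a = sym frac-0
    frac-· (suc k) a = trans (cong (frac a +_) (frac-· k a)) (frac-+ a (k ℕ.* a))

    -- The common factor `suc g` is the gcd, which is positive because it divides `suc n`. Encodings
    -- and exponents see lowest terms, whereas scores are counted over the fixed denominator.
    frac-parts : ∀ k → ∃[ g ] ∣ ↥ frac k ∣ ℕ.* suc g ≡ k × ↧ₙ (frac k) ℕ.* suc g ≡ suc n
    frac-parts k = parts (↥ frac k) (↧ₙ (frac k)) (gcd (ℤ.+ k) (ℤ.+ suc n)) (↥-/ (ℤ.+ k) (suc n)) (↧-/ (ℤ.+ k) (suc n))
      where
      parts : ∀ i d h → i ℤ.* h ≡ ℤ.+ k → ℤ.+ d ℤ.* h ≡ ℤ.+ suc n →
              ∃[ g ] ∣ i ∣ ℕ.* suc g ≡ k × d ℕ.* suc g ≡ suc n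
      parts i d h eqᵢ eqₙ with ∣ h ∣ | trans (sym (ℤ.abs-* i h)) (cong ∣_∣ eqᵢ) | trans (sym (ℤ.abs-* (ℤ.+ d) h)) (cong ∣_∣ eqₙ)
      ... | zero  | _  | e′ = contradiction (trans (sym e′) (ℕ.*-zeroʳ d)) λ ()
      ... | suc g | e  | e′ = g , e , e′

    frac-upper : ∀ k c → k ℕ.≤ suc n ℕ.* c → ∣ ↥ frac k ∣ ℕ.≤ ↧ₙ (frac k) ℕ.* c
    frac-upper k c k≤ = upper ∣ ↥ frac k ∣ (↧ₙ (frac k)) (frac-parts k)
      where
      open ℕ.≤-Reasoning
      upper : ∀ a b → ∃[ g ] a ℕ.* suc g ≡ k × b ℕ.* suc g ≡ suc n → a ℕ.≤ b ℕ.* c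
      upper a b (g , num , den) = ℕ.*-cancelʳ-≤ a (b ℕ.* c) (suc g) (begin
        a ℕ.* suc g              ≡⟨ num ⟩
        k                        ≤⟨ k≤ ⟩
        suc n ℕ.* c              ≡⟨ cong (ℕ._* c) den ⟨
        b ℕ.* suc g ℕ.* c        ≡⟨ ℕ.*-assoc b (suc g) c ⟩
        b ℕ.* (suc g ℕ.* c)      ≡⟨ cong (b ℕ.*_) (ℕ.*-comm (suc g) c) ⟩
        b ℕ.* (c ℕ.* suc g)      ≡⟨ ℕ.*-assoc b c (suc g) ⟨
        b ℕ.* c ℕ.* suc g        ∎)

  fromℕ-1 : fromℕ 1 ≡ 1ℚ
  fromℕ-1 = frac-1 0

  fromℕ-* : ∀ m n → fromℕ m * fromℕ n ≡ fromℕ (m ℕ.* n)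
  fromℕ-* zero    n = *-zeroˡ (fromℕ n)
  fromℕ-* (suc m) n = begin
    fromℕ (suc m) * fromℕ n                  ≡⟨ cong (_* fromℕ n) (trans (sym (frac-+ 0 1 m)) (cong (_+ fromℕ m) fromℕ-1)) ⟩
    (1ℚ + fromℕ m) * fromℕ n                 ≡⟨ *-distribʳ-+ (fromℕ n) 1ℚ (fromℕ m) ⟩
    1ℚ * fromℕ n + fromℕ m * fromℕ n         ≡⟨ cong₂ _+_ (*-identityˡ (fromℕ n)) (fromℕ-* m n) ⟩
    fromℕ n + fromℕ (m ℕ.* n)                ≡⟨ frac-+ 0 n (m ℕ.* n) ⟩
    fromℕ (suc m ℕ.* n)                      ∎
    where open ≡-Reasoning

  fromℕ-^ : ∀ m n → fromℕ m ^ n ≡ fromℕ (m ℕ.^ n)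
  fromℕ-^ m zero    = sym fromℕ-1
  fromℕ-^ m (suc n) = trans (cong (fromℕ m *_) (fromℕ-^ m n)) (fromℕ-* m (m ℕ.^ n))

  fromℕ-mkℚ : ∀ n → fromℕ n ≡ mkℚ (ℤ.+ n) 0 (Coprime.sym (Coprime.1-coprimeTo n))
  fromℕ-mkℚ n = normalize-coprime (Coprime.sym (Coprime.1-coprimeTo n))

  0≤fromℕ : ∀ n → 0ℚ ≤ fromℕ n
  0≤fromℕ n = subst (_≤ fromℕ n) (frac-0 0) (frac-mono 0 {0} {n} z≤n)

  *-mono : ∀ {a b c d} → 0ℚ ≤ a → a ≤ b → 0ℚ ≤ c → c ≤ d → a * c ≤ b * d
  *-mono {a} {b} {c} {d} 0≤a a≤b 0≤c c≤d = ≤-trans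
    (*-monoʳ-≤-nonNeg c ⦃ nonNegative 0≤c ⦄ a≤b)
    (*-monoˡ-≤-nonNeg b ⦃ nonNegative (≤-trans 0≤a a≤b) ⦄ c≤d)

  0≤* : ∀ {a b} → 0ℚ ≤ a → 0ℚ ≤ b → 0ℚ ≤ a * b
  0≤* {a} {b} 0≤a 0≤b = subst (_≤ a * b) (*-zeroˡ 0ℚ) (*-mono ≤-refl 0≤a ≤-refl 0≤b)

  0≤1 : 0ℚ ≤ 1ℚ
  0≤1 = *≤* (ℤ.+≤+ z≤n)

  0≤^ : ∀ {a} n → 0ℚ ≤ a → 0ℚ ≤ a ^ n
  0≤^ zero    0≤a = 0≤1
  0≤^ (suc n) 0≤a = 0≤* 0≤a (0≤^ n 0≤a)

  ^-mono : ∀ {a b} n → 0ℚ ≤ a → a ≤ b → a ^ n ≤ b ^ n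
  ^-mono zero    0≤a a≤b = ≤-refl
  ^-mono (suc n) 0≤a a≤b = *-mono 0≤a a≤b (0≤^ n 0≤a) (^-mono n 0≤a a≤b)

  1^ : ∀ n → 1ℚ ^ n ≡ 1ℚ
  1^ zero    = refl
  1^ (suc n) = trans (*-identityˡ _) (1^ n)

  1≤^ : ∀ {a} n → 1ℚ ≤ a → 1ℚ ≤ a ^ n
  1≤^ {a} n 1≤a = subst (_≤ a ^ n) (1^ n) (^-mono n 0≤1 1≤a)

  ^-monoʳ : ∀ {a m n} → 1ℚ ≤ a → m ℕ.≤ n → a ^ m ≤ a ^ n
  ^-monoʳ {n = n} 1≤a z≤n       = 1≤^ n 1≤a
  ^-monoʳ {m = suc m} 1≤a (s≤s m≤n) = *-mono (≤-trans 0≤1 1≤a) ≤-refl (≤-trans 0≤1 (1≤^ m 1≤a)) (^-monoʳ 1≤a m≤n)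

  ^-mono-< : ∀ {a b} n → 0ℚ ≤ a → a < b → a ^ suc n < b ^ suc n
  ^-mono-< {a} {b} zero    0≤a a<b = subst₂ _<_ (sym (*-identityʳ a)) (sym (*-identityʳ b)) a<b
  ^-mono-< {a} {b} (suc n) 0≤a a<b = ≤-<-trans
    (*-monoʳ-≤-nonNeg (a ^ suc n) ⦃ nonNegative (0≤^ (suc n) 0≤a) ⦄ (<⇒≤ a<b))
    (*-monoʳ-<-pos b ⦃ positive (≤-<-trans 0≤a a<b) ⦄ (^-mono-< n 0≤a a<b))

  ^-cancel : ∀ {a b} n → 0ℚ ≤ b → a ^ suc n ≤ b ^ suc n → a ≤ b
  ^-cancel {a} {b} n 0≤b le with a ≤? b
  ... | yes a≤b = a≤b
  ... | no  a≰b = contradiction (<-≤-trans (^-mono-< n 0≤b (≰⇒> a≰b)) le) (<-irrefl refl)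

  bernoulli : ∀ {η} n → 0ℚ ≤ η → 1ℚ + n · η ≤ (1ℚ + η) ^ n
  bernoulli {η} zero    0≤η = ≤-refl
  bernoulli {η} (suc n) 0≤η = begin
    1ℚ + (η + n · η)                       ≡⟨ cong (1ℚ +_) (+-comm η (n · η)) ⟩
    1ℚ + (n · η + η)                       ≡⟨ +-assoc 1ℚ (n · η) η ⟨
    (1ℚ + n · η) + η                       ≤⟨ +-mono-≤ (bernoulli n 0≤η)
        (subst (_≤ η * X) (*-identityʳ η) (*-monoˡ-≤-nonNeg η ⦃ nonNegative 0≤η ⦄ (1≤^ n 1≤1+η))) ⟩
    X + η * X                              ≡⟨ cong (_+ η * X) (*-identityˡ X) ⟨
    1ℚ * X + η * X                         ≡⟨ *-distribʳ-+ X 1ℚ η ⟨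
    (1ℚ + η) ^ suc n                       ∎
    where
    open ≤-Reasoning
    X = (1ℚ + η) ^ n
    1≤1+η : 1ℚ ≤ 1ℚ + η
    1≤1+η = subst (_≤ 1ℚ + η) (+-identityʳ 1ℚ) (+-monoʳ-≤ 1ℚ 0≤η)

  -- Multiplying by the denominator leaves the numerator, a positive integer.
  archimedean : ∀ {η} → 0ℚ < η → 1ℚ ≤ ↧ₙ η · η
  archimedean {mkℚ (ℤ.+ zero) d c}    (*<* (ℤ.+<+ ()))
  archimedean {mkℚ (ℤ.-[1+ _ ]) d c}  (*<* ())
  archimedean {η@(mkℚ (ℤ.+ suc a) d c)} _ = subst₂ _≤_ (frac-1 d)
    (trans (sym (frac-· d (suc d) (suc a))) (cong (suc d ·_) (normalize-coprime c)))
    (frac-mono d {suc d} {suc d ℕ.* suc a} (ℕ.m≤m*n (suc d) (suc a)))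

  2u≤2^u : ∀ u → 2 ℕ.* suc u ℕ.≤ 2 ℕ.^ suc u
  2u≤2^u zero    = ℕ.≤-refl
  2u≤2^u (suc u) = begin
    2 ℕ.* suc (suc u)           ≡⟨ ℕ.*-suc 2 (suc u) ⟩
    2 ℕ.+ 2 ℕ.* suc u           ≤⟨ ℕ.+-mono-≤ (ℕ.*-monoʳ-≤ 2 (s≤s z≤n)) (ℕ.≤-refl {2 ℕ.* suc u}) ⟩
    2 ℕ.* suc u ℕ.+ 2 ℕ.* suc u ≤⟨ ℕ.+-mono-≤ (2u≤2^u u) (2u≤2^u u) ⟩
    2 ℕ.^ suc u ℕ.+ 2 ℕ.^ suc u ≡⟨ cong (2 ℕ.^ suc u ℕ.+_) (ℕ.+-identityʳ _) ⟨
    2 ℕ.^ suc (suc u)           ∎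
    where open ℕ.≤-Reasoning

  -- t = suc s * suc ℓ variables are coded by t + suc ℓ vertices.
  block-size : ∀ s → ∃[ ℓ ] suc (suc s ℕ.* suc ℓ ℕ.+ suc ℓ) ℕ.≤ 2 ℕ.^ suc ℓ
  block-size s = ℓ , (begin
    suc (suc s ℕ.* suc ℓ ℕ.+ suc ℓ)         ≡⟨ cong suc (ℕ.+-comm (suc s ℕ.* suc ℓ) (suc ℓ)) ⟩
    suc (u ℕ.* suc ℓ)                       ≡⟨ cong (λ k → suc (u ℕ.* k)) suc-ℓ ⟩
    suc (u ℕ.* (u ℕ.+ u))                   ≤⟨ ℕ.+-monoˡ-≤ (u ℕ.* (u ℕ.+ u)) {1} {u ℕ.* (u ℕ.+ u)} (s≤s z≤n) ⟩
    u ℕ.* (u ℕ.+ u) ℕ.+ u ℕ.* (u ℕ.+ u)     ≡⟨ ℕ.*-distribʳ-+ (u ℕ.+ u) u u ⟨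
    (u ℕ.+ u) ℕ.* (u ℕ.+ u)                 ≤⟨ ℕ.*-mono-≤ u+u≤ u+u≤ ⟩
    2 ℕ.^ u ℕ.* 2 ℕ.^ u                     ≡⟨ ℕ.^-distribˡ-+-* 2 u u ⟨
    2 ℕ.^ (u ℕ.+ u)                         ≡⟨ cong (2 ℕ.^_) suc-ℓ ⟨
    2 ℕ.^ suc ℓ                             ∎)
    where
    open ℕ.≤-Reasoning
    u = suc (suc s)
    ℓ = suc s ℕ.+ u
    suc-ℓ : suc ℓ ≡ u ℕ.+ u
    suc-ℓ = refl
    u+u≤ : u ℕ.+ u ℕ.≤ 2 ℕ.^ u
    u+u≤ = ℕ.≤-trans (ℕ.≤-reflexive (cong (u ℕ.+_) (sym (ℕ.+-identityʳ u)))) (2u≤2^u (suc s))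

  rational-cut : ℚ → ℝ
  rational-cut δ = record
    { L = _< δ ; U = δ <_
    ; L-inhabited = δ - 1ℚ , subst (δ - 1ℚ <_) (+-identityʳ δ) (+-monoʳ-< δ (*<* ℤ.-<+))
    ; U-inhabited = δ + 1ℚ , subst (_< δ + 1ℚ) (+-identityʳ δ) (+-monoʳ-< δ (*<* (ℤ.+<+ (s≤s z≤n))))
    ; L-rounded = λ q → mk⇔ <-dense λ (r , q<r , r<δ) → <-trans q<r r<δ
    ; U-rounded = λ q → mk⇔ (λ δ<q → let r , δ<r , r<q = <-dense δ<q in r , r<q , δ<r)
                            λ (r , r<q , δ<r) → <-trans δ<r r<q
    ; disjoint = λ q (q<δ , δ<q) → <-asym q<δ δ<q
    ; located = located
    }
    where
    located : ∀ {q r} → q < r → q < δ ⊎ δ < r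
    located {q} {r} q<r with q <? δ
    ... | yes q<δ = inj₁ q<δ
    ... | no  q≮δ = inj₂ (≤-<-trans (≮⇒≥ q≮δ) q<r)

  L-down : ∀ ε {q r} → q < r → ℝ.L ε r → ℝ.L ε q
  L-down ε {q} {r} q<r Lr = Equivalence.from (ℝ.L-rounded ε q) (r , q<r , Lr)

  -- A time bound for ε holds at each rational below ε, so it may be used at a single one. Capping
  -- it at 1 keeps the base 2 - r at least 1, and powers monotone in the exponent.
  small-rational : ∀ ε → Positive ε → ∃[ r ] (0ℚ < r × r ≤ 1ℚ × ℝ.L ε r)
  small-rational ε pos with Equivalence.to (ℝ.L-rounded ε 0ℚ) pos
  ... | r , 0<r , Lr with 1ℚ <? r
  ... | yes 1<r = 1ℚ , *<* (ℤ.+<+ (s≤s z≤n)) , ≤-refl , L-down ε 1<r Lr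
  ... | no  1≮r = r , 0<r , ≮⇒≥ 1≮r , Lr

  module Growth {B D η : ℚ} (1≤B : 1ℚ ≤ B) (B≤2 : B ≤ fromℕ 2) (1≤D : 1ℚ ≤ D)
                (0<η : 0ℚ < η) (gap : B * (1ℚ + η) ≤ D) where

    0≤B : 0ℚ ≤ B
    0≤B = ≤-trans 0≤1 1≤B

    0≤D : 0ℚ ≤ D
    0≤D = ≤-trans 0≤1 1≤D

    0≤1+η : 0ℚ ≤ 1ℚ + η
    0≤1+η = ≤-trans (<⇒≤ 0<η) (subst (_≤ 1ℚ + η) (+-identityˡ η) (+-monoˡ-≤ η 0≤1))

    -- `s` is the denominator of η, so s η ≥ 1 and Bernoulli gives (1 + η)^s ≥ 2. `block-size`
    -- returns ℓ = 2 (s + 1), hence L = (s + 1) ℓ = 2 (s + 1)^2, and L + 1 ≤ (2 (s + 1))^2 ≤ 2^ℓ.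
    s₀ s ℓ L : ℕ
    s₀ = ℚ.denominator-1 η
    s  = suc s₀
    ℓ  = suc (proj₁ (block-size s₀))
    L  = s ℕ.* ℓ ℕ.+ ℓ

    2≤[1+η]^s : fromℕ 2 ≤ (1ℚ + η) ^ s
    2≤[1+η]^s = ≤-trans (+-monoʳ-≤ 1ℚ (archimedean 0<η)) (bernoulli s (<⇒≤ 0<η))

    -- The ℓ surplus factors B ≤ 2 ≤ (1 + η)^s are spread over the s ℓ others, giving each one
    -- factor 1 + η.
    B^L≤D^t : B ^ L ≤ D ^ (s ℕ.* ℓ)
    B^L≤D^t = begin
      B ^ L                                     ≡⟨ ^-homo-* B (s ℕ.* ℓ) ℓ ⟩
      B ^ (s ℕ.* ℓ) * B ^ ℓ                     ≤⟨ *-monoˡ-≤-nonNeg (B ^ (s ℕ.* ℓ)) ⦃ nonNegative (0≤^ (s ℕ.* ℓ) 0≤B) ⦄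
          (^-mono ℓ 0≤B (≤-trans B≤2 2≤[1+η]^s)) ⟩
      B ^ (s ℕ.* ℓ) * ((1ℚ + η) ^ s) ^ ℓ         ≡⟨ cong (B ^ (s ℕ.* ℓ) *_) (^-assocʳ (1ℚ + η) s ℓ) ⟩
      B ^ (s ℕ.* ℓ) * (1ℚ + η) ^ (s ℕ.* ℓ)       ≡⟨ ^-distrib-* B (1ℚ + η) (s ℕ.* ℓ) ⟨
      (B * (1ℚ + η)) ^ (s ℕ.* ℓ)                ≤⟨ ^-mono (s ℕ.* ℓ) (0≤* 0≤B 0≤1+η) gap ⟩
      D ^ (s ℕ.* ℓ)                             ∎
      where open ≤-Reasoning

    -- Rounding the fractional exponent up to the integer `e` turns the right-hand side into a
    -- perfect power of order `↧ₙ x`, whose root is rational.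
    root : ∀ {t P} x e → fromℕ t ^ ↧ₙ x ≤ fromℕ P ^ ↧ₙ x * B ^ ∣ ↥ x ∣ → ∣ ↥ x ∣ ℕ.≤ ↧ₙ x ℕ.* e → fromℕ t ≤ fromℕ P * B ^ e
    root {t} {P} x e bounded small = ^-cancel (ℚ.denominator-1 x) (0≤* (0≤fromℕ P) (0≤^ e 0≤B)) (begin
      fromℕ t ^ b                                     ≤⟨ bounded ⟩
      fromℕ P ^ b * B ^ ∣ ↥ x ∣                       ≤⟨ *-monoˡ-≤-nonNeg (fromℕ P ^ b) ⦃ nonNegative (0≤^ b (0≤fromℕ P)) ⦄
          (^-monoʳ 1≤B (ℕ.≤-trans small (ℕ.≤-reflexive (ℕ.*-comm b e)))) ⟩
      fromℕ P ^ b * B ^ (e ℕ.* b)                     ≡⟨ cong (fromℕ P ^ b *_) (^-assocʳ B e b) ⟨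
      fromℕ P ^ b * (B ^ e) ^ b                       ≡⟨ ^-distrib-* (fromℕ P) (B ^ e) b ⟨
      (fromℕ P * B ^ e) ^ b                           ∎)
      where
      open ≤-Reasoning
      b = ↧ₙ x

    -- Only `q` blocks are charged to variables. The last block, possibly incomplete, and the extra
    -- unit of the vertex cover weight cost a factor B^(L + 1), at most the constant 2^(L + 1).
    vertices : ∀ {q n} → q ℕ.* (s ℕ.* ℓ) ℕ.≤ n → B ^ suc (suc q ℕ.* L) ≤ fromℕ (2 ℕ.^ suc L) * D ^ n
    vertices {q} {n} qt≤n = begin
      B ^ (suc L ℕ.+ q ℕ.* L)                ≡⟨ ^-homo-* B (suc L) (q ℕ.* L) ⟩
      B ^ suc L * B ^ (q ℕ.* L)              ≤⟨ *-mono (0≤^ (suc L) 0≤B) (^-mono (suc L) 0≤B B≤2) (0≤^ (q ℕ.* L) 0≤B) blocks ⟩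
      fromℕ 2 ^ suc L * D ^ n                ≡⟨ cong (_* D ^ n) (fromℕ-^ 2 (suc L)) ⟩
      fromℕ (2 ℕ.^ suc L) * D ^ n            ∎
      where
      open ≤-Reasoning
      blocks : B ^ (q ℕ.* L) ≤ D ^ n
      blocks = begin
        B ^ (q ℕ.* L)            ≡⟨ cong (B ^_) (ℕ.*-comm q L) ⟩
        B ^ (L ℕ.* q)            ≡⟨ ^-assocʳ B L q ⟨
        (B ^ L) ^ q              ≤⟨ ^-mono q (0≤^ L 0≤B) B^L≤D^t ⟩
        (D ^ (s ℕ.* ℓ)) ^ q      ≡⟨ ^-assocʳ D (s ℕ.* ℓ) q ⟩
        D ^ (s ℕ.* ℓ ℕ.* q)      ≤⟨ ^-monoʳ 1≤D (ℕ.≤-trans (ℕ.≤-reflexive (ℕ.*-comm (s ℕ.* ℓ) q)) qt≤n) ⟩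
        D ^ n                    ∎

    -- Here `c` is the time spent outside the solver; as D^n is at least 1, it moves into the
    -- polynomial factor.
    transfer : ∀ {t P q n} c x → fromℕ t ^ ↧ₙ x ≤ fromℕ P ^ ↧ₙ x * B ^ ∣ ↥ x ∣ →
               ∣ ↥ x ∣ ℕ.≤ ↧ₙ x ℕ.* suc (suc q ℕ.* L) → q ℕ.* (s ℕ.* ℓ) ℕ.≤ n →
               fromℕ (c ℕ.+ t) ≤ fromℕ (c ℕ.+ P ℕ.* 2 ℕ.^ suc L) * D ^ n
    transfer {t} {P} {q} {n} c x bounded small qt≤n = begin
      fromℕ (c ℕ.+ t)                                     ≡⟨ frac-+ 0 c t ⟨
      fromℕ c + fromℕ t                                   ≤⟨ +-mono-≤
          (subst (_≤ fromℕ c * D ^ n) (*-identityʳ (fromℕ c)) (*-monoˡ-≤-nonNeg (fromℕ c) ⦃ nonNegative (0≤fromℕ c) ⦄ (1≤^ n 1≤D)))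
          (≤-trans (root {t} {P} x (suc (suc q ℕ.* L)) bounded small)
                   (*-monoˡ-≤-nonNeg (fromℕ P) ⦃ nonNegative (0≤fromℕ P) ⦄ (vertices {q} {n} qt≤n))) ⟩
      fromℕ c * D ^ n + fromℕ P * (fromℕ K * D ^ n)       ≡⟨ cong (fromℕ c * D ^ n +_)
          (trans (sym (*-assoc (fromℕ P) (fromℕ K) (D ^ n))) (cong (_* D ^ n) (fromℕ-* P K))) ⟩
      fromℕ c * D ^ n + fromℕ (P ℕ.* K) * D ^ n           ≡⟨ *-distribʳ-+ (D ^ n) (fromℕ c) (fromℕ (P ℕ.* K)) ⟨
      (fromℕ c + fromℕ (P ℕ.* K)) * D ^ n                 ≡⟨ cong (_* D ^ n) (frac-+ 0 c (P ℕ.* K)) ⟩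
      fromℕ (c ℕ.+ P ℕ.* K) * D ^ n                       ∎
      where
      open ≤-Reasoning
      K = 2 ℕ.^ suc L

  record Parameters (ε : ℝ) : Set₁ where
    field
      t₀ ℓ       : ℕ
      room       : suc (suc t₀ ℕ.+ ℓ) ℕ.≤ 2 ℕ.^ ℓ
      δ          : ℝ
      δ-positive : Positive δ
      transfer   : ∀ {t P q n} c x → t ≤ P ·[2- ε ]^ x →
                   ∣ ↥ x ∣ ℕ.≤ ↧ₙ x ℕ.* suc (suc q ℕ.* (suc t₀ ℕ.+ ℓ)) → q ℕ.* suc t₀ ℕ.≤ n →
                   c ℕ.+ t ≤ c ℕ.+ P ℕ.* 2 ℕ.^ suc (suc t₀ ℕ.+ ℓ) ·[2- δ ]^ fromℕ n

  rate : ∀ ε → Positive ε → Parameters ε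
  rate ε pos = record
    -- Both factors are successors, so `suc t₀` computes to `s * ℓ`.
    { t₀ = ℕ.pred (s ℕ.* ℓ) ; ℓ = ℓ ; room = proj₂ (block-size s₀)
    ; δ = rational-cut (r * ½) ; δ-positive = 0<r/2
    ; transfer = λ {t} {P} {q} {n} c x bounded small qt≤n r′ r′<δ →
        subst (λ y → fromℕ (c ℕ.+ t) ^ ↧ₙ y ≤ fromℕ (c ℕ.+ P ℕ.* 2 ℕ.^ suc L) ^ ↧ₙ y * ((fromℕ 2 - r′) ⊔ 0ℚ) ^ ∣ ↥ y ∣)
          (sym (fromℕ-mkℚ n))
          (subst₂ (λ u v → u ≤ v * ((fromℕ 2 - r′) ⊔ 0ℚ) ^ n)
            (sym (*-identityʳ (fromℕ (c ℕ.+ t)))) (sym (*-identityʳ (fromℕ (c ℕ.+ P ℕ.* 2 ℕ.^ suc L))))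
            (≤-trans (transfer {t} {P} {q} {n} c x (at-r {t} {P} x bounded) small qt≤n)
              (*-monoˡ-≤-nonNeg (fromℕ (c ℕ.+ P ℕ.* 2 ℕ.^ suc L)) ⦃ nonNegative (0≤fromℕ (c ℕ.+ P ℕ.* 2 ℕ.^ suc L)) ⦄
                (^-mono n 0≤D (≤-trans (+-monoʳ-≤ (fromℕ 2) (neg-antimono-≤ (<⇒≤ r′<δ)))
                                       (p≤p⊔q (fromℕ 2 - r′) 0ℚ))))))
    }
    where
    r    = proj₁ (small-rational ε pos)
    0<r  = proj₁ (proj₂ (small-rational ε pos))
    r≤1  = proj₁ (proj₂ (proj₂ (small-rational ε pos)))
    r∈ε  = proj₂ (proj₂ (proj₂ (small-rational ε pos)))

    -- With η = r/4 the loss in `gap` is B η ≤ 2 η = r/2, exactly the distance from B = 2 - r to D =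
    -- 2 - r/2. So δ = r/2 is the halfway point.
    B D η : ℚ
    B = fromℕ 2 - r
    D = fromℕ 2 - r * ½
    η = r * ½ * ½

    0<*½ : ∀ {q} → 0ℚ < q → 0ℚ < q * ½
    0<*½ {q} 0<q = subst (_< q * ½) (*-zeroˡ ½) (*-monoˡ-<-pos ½ 0<q)

    halves : ∀ q → q * ½ + q * ½ ≡ q
    halves q = trans (sym (*-distribˡ-+ q ½ ½)) (*-identityʳ q)

    0<r/2 : 0ℚ < r * ½
    0<r/2 = 0<*½ 0<r

    0<η : 0ℚ < η
    0<η = 0<*½ 0<r/2

    -‿+ : ∀ a b → (a - b) + b ≡ a
    -‿+ a b = trans (+-assoc a (- b) b) (trans (cong (a +_) (+-inverseˡ b)) (+-identityʳ a))

    sub-≤ : ∀ {a b} → 0ℚ ≤ b → a - b ≤ a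
    sub-≤ {a} {b} 0≤b = subst (a - b ≤_) (+-identityʳ a) (+-monoʳ-≤ a (neg-antimono-≤ 0≤b))

    1≤B : 1ℚ ≤ B
    1≤B = +-monoʳ-≤ (fromℕ 2) (neg-antimono-≤ r≤1)

    B≤2 : B ≤ fromℕ 2
    B≤2 = sub-≤ (<⇒≤ 0<r)

    B+r/2≡D : B + r * ½ ≡ D
    B+r/2≡D = begin
      (fromℕ 2 - r) + r * ½                    ≡⟨ cong (λ q → (fromℕ 2 - q) + r * ½) (halves r) ⟨
      (fromℕ 2 - (r * ½ + r * ½)) + r * ½      ≡⟨ cong (λ q → (fromℕ 2 + q) + r * ½) (neg-distrib-+ (r * ½) (r * ½)) ⟩
      (fromℕ 2 + (- (r * ½) - r * ½)) + r * ½  ≡⟨ cong (_+ r * ½) (+-assoc (fromℕ 2) (- (r * ½)) (- (r * ½))) ⟨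
      (D - r * ½) + r * ½                      ≡⟨ -‿+ D (r * ½) ⟩
      D                                        ∎
      where open ≡-Reasoning

    B≤D : B ≤ D
    B≤D = subst (B ≤_) B+r/2≡D (subst (_≤ B + r * ½) (+-identityʳ B) (+-monoʳ-≤ B (<⇒≤ 0<r/2)))

    1≤D : 1ℚ ≤ D
    1≤D = ≤-trans 1≤B B≤D

    0≤B : 0ℚ ≤ B
    0≤B = ≤-trans 0≤1 1≤B

    gap : B * (1ℚ + η) ≤ D
    gap = begin
      B * (1ℚ + η)         ≡⟨ *-distribˡ-+ B 1ℚ η ⟩
      B * 1ℚ + B * η       ≤⟨ +-mono-≤ (≤-reflexive (*-identityʳ B)) (*-monoʳ-≤-nonNeg η ⦃ nonNegative (<⇒≤ 0<η) ⦄ B≤2) ⟩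
      B + (1ℚ + 1ℚ) * η    ≡⟨ cong (B +_) (trans (*-distribʳ-+ η 1ℚ 1ℚ) (cong₂ _+_ (*-identityˡ η) (*-identityˡ η))) ⟩
      B + (η + η)          ≡⟨ cong (B +_) (halves (r * ½)) ⟩
      B + r * ½            ≡⟨ B+r/2≡D ⟩
      D                    ∎
      where open ≤-Reasoning

    at-r : ∀ {t P} x → t ≤ P ·[2- ε ]^ x → fromℕ t ^ ↧ₙ x ≤ fromℕ P ^ ↧ₙ x * B ^ ∣ ↥ x ∣
    at-r {t} {P} x bounded = subst (λ β → fromℕ t ^ ↧ₙ x ≤ fromℕ P ^ ↧ₙ x * β ^ ∣ ↥ x ∣) (p≥q⇒p⊔q≡p 0≤B) (bounded r r∈ε)

    open Growth 1≤B B≤2 1≤D 0<η gap hiding (0≤B)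

  bound-mono : ∀ {δ t P P′} x → P ℕ.≤ P′ → t ≤ P ·[2- δ ]^ x → t ≤ P′ ·[2- δ ]^ x
  bound-mono {P = P} {P′} x P≤P′ bounded r r∈δ = ≤-trans (bounded r r∈δ)
    (*-monoʳ-≤-nonNeg (β ^ ∣ ↥ x ∣) ⦃ nonNegative (0≤^ ∣ ↥ x ∣ (p≤q⊔p (fromℕ 2 - r) 0ℚ)) ⦄
      (^-mono (↧ₙ x) (0≤fromℕ P) (frac-mono 0 {P} {P′} P≤P′)))
    where β = (fromℕ 2 - r) ⊔ 0ℚ

-- Minimal vertex covers of the incidence graph

module Cover where

  open Rate using (frac; frac-+; frac-mono; frac-cancel; frac-0; frac-1; frac-upper)
  open import Data.Bool.Base using (Bool; true; false; not; _∧_; _∨_; if_then_else_)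
  open import Data.Fin.Base using (Fin; zero; suc; splitAt; _↑ˡ_; _↑ʳ_)
  open import Data.Fin.Properties using (splitAt-↑ˡ; splitAt-↑ʳ; splitAt⁻¹-↑ˡ; splitAt⁻¹-↑ʳ; _≟_)
  open import Data.Fin.Subset using (Subset; _∈_; _⊂_; ∣_∣)
  import Data.Integer.Base as ℤ
  open import Data.List.Base as List using (List; []; _∷_; length)
  open import Data.Nat.Base as ℕ using (ℕ; zero; suc; _+_; _*_; _≤_; z≤n; s≤s)
  import Data.Nat.Properties as ℕ
  open import Data.Product.Base using (∃-syntax; _×_; _,_)
  open import Data.Rational.Base as ℚ using (ℚ; 0ℚ; 1ℚ; ↥_; ↧ₙ_; +-*-rawSemiring)
  import Data.Rational.Properties as ℚ
  open import Data.Sum.Base using (_⊎_; inj₁; inj₂; [_,_]′)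
  open import Data.Vec.Base as Vec using (Vec; []; _∷_; lookup; _++_; tabulate; replicate; _[_]≔_)
  open import Data.Vec.Properties
  open import Function.Base using (_∘_; const)
  open import Relation.Binary.PropositionalEquality
  open import Relation.Nullary using (¬_; yes; no; contradiction)
  open import Algebra.Definitions.RawSemiring +-*-rawSemiring using (sum)

  sub : ∀ {n} → Vec Bool n → Vec Bool n → Bool
  sub []       []       = true
  sub (x ∷ xs) (s ∷ ss) = (not x ∨ s) ∧ sub xs ss

  sub-true : ∀ {n} (x s : Vec Bool n) a → sub x s ≡ true → lookup x a ≡ true → lookup s a ≡ true
  sub-true (true ∷ x) (true ∷ s) zero    eq refl = refl
  sub-true (false ∷ x) (_ ∷ s)   (suc a) eq xa   = sub-true x s a eq xa
  sub-true (true ∷ x) (true ∷ s) (suc a) eq xa   = sub-true x s a eq xa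

  sub-false : ∀ {n} (x s : Vec Bool n) → sub x s ≡ false → ∃[ a ] lookup x a ≡ true × lookup s a ≡ false
  sub-false []          []          ()
  sub-false (true ∷ x)  (false ∷ s) eq = zero , refl , refl
  sub-false (true ∷ x)  (true ∷ s)  eq = let a , p = sub-false x s eq in suc a , p
  sub-false (false ∷ x) (_ ∷ s)     eq = let a , p = sub-false x s eq in suc a , p

  -- The rows counted are those that a minimal vertex cover with column part `s` must contain.
  misses : ∀ {n} → Vec Bool n → List (Vec Bool n) → ℕ
  misses s []       = 0
  misses s (x ∷ xs) = (if sub x s then 0 else 1) + misses s xs

  true≢false : ∀ {b} → b ≡ true → b ≢ false
  true≢false refl ()

  ∣p∣≤n : ∀ {n} (p : Vec Bool n) → ∣ p ∣ ≤ n
  ∣p∣≤n []          = z≤n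
  ∣p∣≤n (true ∷ p)  = s≤s (∣p∣≤n p)
  ∣p∣≤n (false ∷ p) = ℕ.m≤n⇒m≤1+n (∣p∣≤n p)

  weighted : ∀ {k} → Vec Bool k → (Fin k → ℕ) → ℕ
  weighted []      κ = 0
  weighted (b ∷ S) κ = (if b then κ zero else 0) + weighted S (κ ∘ suc)

  sum-frac : ∀ n {k} (S : Vec Bool k) κ →
             sum (λ v → if lookup S v then frac n (κ v) else 0ℚ) ≡ frac n (weighted S κ)
  sum-frac n []          κ = sym (frac-0 n)
  sum-frac n (true ∷ S)  κ = trans (cong (frac n (κ zero) ℚ.+_) (sum-frac n S (κ ∘ suc))) (frac-+ n (κ zero) (weighted S (κ ∘ suc)))
  sum-frac n (false ∷ S) κ = trans (ℚ.+-identityˡ _) (sum-frac n S (κ ∘ suc))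

  weighted-const : ∀ {k} (b : Vec Bool k) κ {d} → (∀ r → κ r ≡ d) → weighted b κ ≡ d * ∣ b ∣
  weighted-const []          κ {d} eq = sym (ℕ.*-zeroʳ d)
  weighted-const (true ∷ b)  κ {d} eq = trans (cong₂ _+_ (eq zero) (weighted-const b (κ ∘ suc) (eq ∘ suc))) (sym (ℕ.*-suc d ∣ b ∣))
  weighted-const (false ∷ b) κ     eq = weighted-const b (κ ∘ suc) (eq ∘ suc)

  weighted-++ : ∀ {k l} (s : Vec Bool k) (b : Vec Bool l) κ {c d} →
                (∀ a → κ (a ↑ˡ l) ≡ c) → (∀ r → κ (k ↑ʳ r) ≡ d) →
                weighted (s ++ b) κ ≡ c * ∣ s ∣ + d * ∣ b ∣
  weighted-++ []          b κ {c} {d} eqˡ eqʳ = trans (weighted-const b κ eqʳ) (cong (_+ d * ∣ b ∣) (sym (ℕ.*-zeroʳ c)))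
  weighted-++ (true ∷ s)  b κ {c} {d} eqˡ eqʳ = trans
    (cong₂ _+_ (eqˡ zero) (weighted-++ s b (κ ∘ suc) (eqˡ ∘ suc) eqʳ))
    (trans (sym (ℕ.+-assoc c (c * ∣ s ∣) (d * ∣ b ∣))) (cong (_+ d * ∣ b ∣) (sym (ℕ.*-suc c ∣ s ∣))))
  weighted-++ (false ∷ s) b κ         eqˡ eqʳ = weighted-++ s b (κ ∘ suc) (eqˡ ∘ suc) eqʳ

  -- The bipartite graph with incidence matrix Xs: α columns of weight 1 + 1/N and
  -- one vertex of weight 1 for each row.
  module _ {α₀ : ℕ} (Xs : List (Vec Bool (suc α₀))) where

    private
      α R n N : ℕ
      α = suc α₀
      R = length Xs
      n = α₀ + R
      N = suc n

      row : Fin R → Vec Bool α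
      row = List.lookup Xs

      vertex : ∀ v → (∃[ a ] a ↑ˡ R ≡ v) ⊎ (∃[ r ] α ↑ʳ r ≡ v)
      vertex v with splitAt α v in eq
      ... | inj₁ a = inj₁ (a , splitAt⁻¹-↑ˡ eq)
      ... | inj₂ r = inj₂ (r , splitAt⁻¹-↑ʳ eq)

    adj′ : Fin α ⊎ Fin R → Fin α ⊎ Fin R → Bool
    adj′ (inj₁ _) (inj₁ _) = false
    adj′ (inj₁ a) (inj₂ r) = lookup (row r) a
    adj′ (inj₂ r) (inj₁ a) = lookup (row r) a
    adj′ (inj₂ _) (inj₂ _) = false

    side′ : Fin α ⊎ Fin R → Bool
    side′ = [ const true , const false ]′

    -- Weights in units of 1/N: `suc N` is 1 + 1/N and `N` is 1.
    κ′ : Fin α ⊎ Fin R → ℕ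
    κ′ = [ const (suc N) , const N ]′

    κ : Fin N → ℕ
    κ v = κ′ (splitAt α v)

    coverGraph : Graph
    coverGraph = record
      { ∣V∣    = N
      ; adj    = λ u v → adj′ (splitAt α u) (splitAt α v)
      ; symm   = λ u v → symm′ (splitAt α u) (splitAt α v)
      ; irrefl = λ v → irrefl′ (splitAt α v)
      }
      where
      symm′ : ∀ u v → adj′ u v ≡ adj′ v u
      symm′ (inj₁ _) (inj₁ _) = refl
      symm′ (inj₁ _) (inj₂ _) = refl
      symm′ (inj₂ _) (inj₁ _) = refl
      symm′ (inj₂ _) (inj₂ _) = refl

      irrefl′ : ∀ v → adj′ v v ≡ false
      irrefl′ (inj₁ _) = refl
      irrefl′ (inj₂ _) = refl

    coverInstance : RestrictedInstance
    coverInstance = record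
      { weightedGraph = record
        { graph = coverGraph
        ; w     = λ v → frac n (κ v)
        ; 1≤w   = λ v → subst (ℚ._≤ frac n (κ v)) (frac-1 n) (frac-mono n (N≤κ′ (splitAt α v)))
        }
      ; bipartite = (λ v → side′ (splitAt α v)) , λ u v → bipartite′ (splitAt α u) (splitAt α v)
      ; weights   = λ v → weights′ (splitAt α v)
      }
      where
      N≤κ′ : ∀ v → N ≤ κ′ v
      N≤κ′ (inj₁ _) = ℕ.n≤1+n N
      N≤κ′ (inj₂ _) = ℕ.≤-refl

      bipartite′ : ∀ u v → adj′ u v ≡ true → side′ u ≢ side′ v
      bipartite′ (inj₁ _) (inj₂ _) _ ()
      bipartite′ (inj₂ _) (inj₁ _) _ ()

      weights′ : ∀ v → frac n (κ′ v) ≡ 1ℚ ⊎ frac n (κ′ v) ≡ 1ℚ ℚ.+ frac n 1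
      weights′ (inj₁ _) = inj₂ (trans (cong (frac n) (ℕ.+-comm 1 N)) (trans (sym (frac-+ n N 1)) (cong (ℚ._+ frac n 1) (frac-1 n))))
      weights′ (inj₂ _) = inj₁ (frac-1 n)

    open RestrictedInstance coverInstance

    weight-++ : ∀ (s : Vec Bool α) (b : Vec Bool R) → weight (s ++ b) ≡ frac n (suc N * ∣ s ∣ + N * ∣ b ∣)
    weight-++ s b = trans (sum-frac n (s ++ b) κ) (cong (frac n) (weighted-++ s b κ
      (λ a → cong κ′ (splitAt-↑ˡ α a R)) (λ r → cong κ′ (splitAt-↑ʳ α R r))))

    Covers : Vec Bool α → Vec Bool R → Set
    Covers s b = ∀ a r → lookup (row r) a ≡ true → lookup s a ≡ true ⊎ lookup b r ≡ true

    module _ {s : Vec Bool α} {b : Vec Bool R} where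

      ∈ˡ : ∀ {a} → lookup s a ≡ true → a ↑ˡ R ∈ s ++ b
      ∈ˡ {a} eq = lookup⇒[]= (a ↑ˡ R) (s ++ b) (trans (lookup-++ˡ s b a) eq)

      ∈ʳ : ∀ {r} → lookup b r ≡ true → α ↑ʳ r ∈ s ++ b
      ∈ʳ {r} eq = lookup⇒[]= (α ↑ʳ r) (s ++ b) (trans (lookup-++ʳ s b r) eq)

      ∈ˡ⁻¹ : ∀ {a} → a ↑ˡ R ∈ s ++ b → lookup s a ≡ true
      ∈ˡ⁻¹ {a} p = trans (sym (lookup-++ˡ s b a)) ([]=⇒lookup p)

      ∈ʳ⁻¹ : ∀ {r} → α ↑ʳ r ∈ s ++ b → lookup b r ≡ true
      ∈ʳ⁻¹ {r} p = trans (sym (lookup-++ʳ s b r)) ([]=⇒lookup p)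

      covers⇒cover : Covers s b → VertexCover (s ++ b)
      covers⇒cover cov u v e with splitAt α u in equ | splitAt α v in eqv
      ... | inj₁ a | inj₂ r with cov a r e
      ... | inj₁ p = inj₁ (subst (_∈ s ++ b) (splitAt⁻¹-↑ˡ equ) (∈ˡ p))
      ... | inj₂ p = inj₂ (subst (_∈ s ++ b) (splitAt⁻¹-↑ʳ eqv) (∈ʳ p))
      covers⇒cover cov u v e | inj₂ r | inj₁ a with cov a r e
      ... | inj₁ p = inj₂ (subst (_∈ s ++ b) (splitAt⁻¹-↑ˡ eqv) (∈ˡ p))
      ... | inj₂ p = inj₁ (subst (_∈ s ++ b) (splitAt⁻¹-↑ʳ equ) (∈ʳ p))

      cover⇒covers : VertexCover (s ++ b) → Covers s b
      cover⇒covers vc a r e with vc (a ↑ˡ R) (α ↑ʳ r) (trans (cong₂ adj′ (splitAt-↑ˡ α a R) (splitAt-↑ʳ α R r)) e)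
      ... | inj₁ p = inj₁ (∈ˡ⁻¹ p)
      ... | inj₂ p = inj₂ (∈ʳ⁻¹ p)

    -- A row with a column outside `s` must cover that edge itself; a row with all its columns in
    -- `s` could be dropped, against minimality.
    minimal⇒row : ∀ s b → MinimalVertexCover (s ++ b) → ∀ r → lookup b r ≡ not (sub (row r) s)
    minimal⇒row s b (vc , minimal) r with sub (row r) s in eq | lookup b r in eqb
    ... | true  | false = refl
    ... | false | true  = refl
    ... | false | false =
      let a , xa , sa = sub-false (row r) s eq
      in [ (λ p → contradiction sa (true≢false p)) , (λ p → contradiction eqb (true≢false p)) ]′ (cover⇒covers {s} {b} vc a r xa)
    -- `b′` drops row r, all of whose edges are covered by `s`.
    ... | true  | true  = contradiction (covers⇒cover {s} {b′} cov′) (minimal (s ++ b′) strict)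
      where
      b′ = b [ r ]≔ false

      cov′ : Covers s b′
      cov′ a r′ e with r ≟ r′
      ... | yes refl = inj₁ (sub-true (row r) s a eq e)
      ... | no  r≢r′ with cover⇒covers {s} {b} vc a r′ e
      ... | inj₁ p = inj₁ p
      ... | inj₂ p = inj₂ (trans (lookup∘updateAt′ r′ r (r≢r′ ∘ sym) b) p)

      strict : s ++ b′ ⊂ s ++ b
      strict = (λ {v} → included v) , α ↑ʳ r , ∈ʳ {s} {b} eqb ,
               λ p → true≢false (∈ʳ⁻¹ {s} {b′} p) (lookup∘updateAt r b)
        where
        included : ∀ v → v ∈ s ++ b′ → v ∈ s ++ b
        included v p with vertex v
        ... | inj₁ (a , refl) = ∈ˡ {s} {b} (∈ˡ⁻¹ {s} {b′} p)
        ... | inj₂ (r′ , refl) with r ≟ r′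
        ... | yes refl = ∈ʳ {s} {b} eqb
        ... | no  r≢r′ = ∈ʳ {s} {b} (trans (sym (lookup∘updateAt′ r′ r (r≢r′ ∘ sym) b)) (∈ʳ⁻¹ {s} {b′} p))

    rows-missed : Vec Bool α → Vec Bool R
    rows-missed s = tabulate (λ r → not (sub (row r) s))

    -- Every chosen column has a row that is not chosen, so it cannot be dropped.
    PrivateRows : Vec Bool α → Set
    PrivateRows s = ∀ a → lookup s a ≡ true → ∃[ r ] lookup (row r) a ≡ true × sub (row r) s ≡ true

    -- Dropping a column uncovers its edge to the private row, and dropping a row uncovers its edge
    -- to a column outside `s`.
    row⇒minimal : ∀ s → PrivateRows s →
                  MinimalVertexCover (s ++ rows-missed s)
    row⇒minimal s private-row = covers⇒cover {s} {rows-missed s} cov , minimal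
      where
      b = rows-missed s

      b-row : ∀ r → lookup b r ≡ not (sub (row r) s)
      b-row r = lookup∘tabulate _ r

      cov : Covers s b
      cov a r xa with sub (row r) s in eq
      ... | true  = inj₁ (sub-true (row r) s a eq xa)
      ... | false = inj₂ (trans (b-row r) (cong not eq))

      minimal : ∀ S′ → S′ ⊂ s ++ b → ¬ VertexCover S′
      minimal S′ (S′⊆S , v , v∈S , v∉S′) vc with Vec.splitAt α S′
      ... | s′ , b′ , refl with vertex v
      ... | inj₁ (a , refl) =
        let r , xa , sub≡ = private-row a (∈ˡ⁻¹ {s} {b} v∈S) in
        [ (λ p → v∉S′ (∈ˡ {s′} {b′} p))
        , (λ p → true≢false (∈ʳ⁻¹ {s} {b} (S′⊆S (∈ʳ {s′} {b′} p))) (trans (b-row r) (cong not sub≡)))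
        ]′ (cover⇒covers {s′} {b′} vc a r xa)
      ... | inj₂ (r , refl) =
        let a , xa , sa = sub-false (row r) s (not-true (trans (sym (b-row r)) (∈ʳ⁻¹ {s} {b} v∈S))) in
        [ (λ p → true≢false (∈ˡ⁻¹ {s} {b} (S′⊆S (∈ˡ {s′} {b′} p))) sa)
        , (λ p → v∉S′ (∈ʳ {s′} {b′} p))
        ]′ (cover⇒covers {s′} {b′} vc a r xa)
        where
        not-true : ∀ {x} → not x ≡ true → x ≡ false
        not-true {false} _ = refl

    private
      count-misses : ∀ s (Ys : List (Vec Bool α)) (b : Vec Bool (length Ys)) →
                     (∀ r → lookup b r ≡ not (sub (List.lookup Ys r) s)) → ∣ b ∣ ≡ misses s Ys
      count-misses s []       []      eq = refl
      count-misses s (y ∷ Ys) (β ∷ b) eq with sub y s | β | eq zero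
      ... | true  | false | refl = count-misses s Ys b (eq ∘ suc)
      ... | false | true  | refl = cong suc (count-misses s Ys b (eq ∘ suc))

    -- N times the weight of the minimal cover that contains the columns s.
    score : Vec Bool α → ℕ
    score s = suc N * ∣ s ∣ + N * misses s Xs

    weight-minimal : ∀ s b → MinimalVertexCover (s ++ b) → weight (s ++ b) ≡ frac n (score s)
    weight-minimal s b min = trans (weight-++ s b)
      (cong (λ c → frac n (suc N * ∣ s ∣ + N * c)) (count-misses s Xs b (minimal⇒row s b min)))

    -- The column part determines a minimal cover, and conversely any column set with private rows
    -- extends to one. So the optimum over covers becomes an optimum of `score` over column sets.
    max-score : ∀ {x} → IsWMMVC x →
      (∃[ s ] x ≡ frac n (score s)) ×
      (∀ s {k} → x ≡ frac n k →
        PrivateRows s → score s ≤ k)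
    max-score {x} ((S , min , eq) , greatest) = attained , bound
      where
      attained : ∃[ s ] x ≡ frac n (score s)
      attained = let s , b , S≡ = Vec.splitAt α S in
        s , trans (sym eq) (trans (cong weight S≡) (weight-minimal s b (subst MinimalVertexCover S≡ min)))

      bound : ∀ s {k} → x ≡ frac n k → PrivateRows s → score s ≤ k
      bound s x≡ private-row = frac-cancel n
        (subst₂ ℚ._≤_ (weight-minimal s (rows-missed s) minS) x≡ (greatest (s ++ rows-missed s) minS))
        where minS = row⇒minimal s private-row

    -- The cover by all columns weighs α (1 + 1/N), which is at most α + 1 because α ≤ N. The bound
    -- is cleared of the reduced denominator, as exponents of the time bound are.
    vc-small : ∀ {x} → IsVCw x → ℤ.∣ ↥ x ∣ ≤ ↧ₙ x * suc α
    vc-small {x} ((S , _ , eq) , least) =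
      subst (λ y → ℤ.∣ ↥ y ∣ ≤ ↧ₙ y * suc α) (sym x≡) (frac-upper n (weighted S κ) (suc α) (begin
      weighted S κ                     ≤⟨ frac-cancel n (subst₂ ℚ._≤_ x≡ (weight-++ s b) (least (s ++ b) (covers⇒cover {s} {b} cov))) ⟩
      suc N * ∣ s ∣ + N * ∣ b ∣          ≤⟨ ℕ.+-mono-≤ (ℕ.*-monoʳ-≤ (suc N) (∣p∣≤n s)) (ℕ.≤-reflexive (trans (cong (N *_) (∣b∣ R)) (ℕ.*-zeroʳ N))) ⟩
      suc N * α + 0                    ≡⟨ ℕ.+-identityʳ _ ⟩
      α + N * α                        ≤⟨ ℕ.+-monoˡ-≤ (N * α) (s≤s (ℕ.m≤m+n α₀ R)) ⟩
      N + N * α                        ≡⟨ ℕ.*-suc N α ⟨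
      N * suc α                        ∎))
      where
      open ℕ.≤-Reasoning
      s = replicate α true
      b = replicate R false

      x≡ : x ≡ frac n (weighted S κ)
      x≡ = trans (sym eq) (sum-frac n S κ)

      cov : Covers s b
      cov a r _ = inj₁ (lookup-replicate a true)

      ∣b∣ : ∀ k → ∣ replicate k false ∣ ≡ 0
      ∣b∣ zero    = refl
      ∣b∣ (suc k) = ∣b∣ k

-- Encoding a formula by rows

module Sat where

  open Cover using (score; PrivateRows; sub; sub-true; sub-false; misses; true≢false; ∣p∣≤n)
  open Code using (ConstantWeightCode)
  open import Data.Bool.Base using (Bool; true; false; T; not; _∧_; _∨_; if_then_else_)
  import Data.Bool.Properties as Bool
  open import Data.Fin.Base using (Fin; zero; suc; toℕ; fromℕ<)
  open import Data.Fin.Properties using (toℕ<n; toℕ-fromℕ<; toℕ-injective)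
  open import Data.Fin.Subset using (∣_∣)
  open import Data.List.Base as List using (List; []; _∷_; _++_; length; map; concatMap; downFrom; filter)
  open import Data.List.Membership.Propositional using (_∈_; lose; find)
  open import Data.List.Membership.Propositional.Properties
  open import Data.List.Properties using (length-++; length-tabulate)
  open import Data.List.Relation.Unary.All as All using (All; []; _∷_)
  import Data.List.Relation.Unary.All.Properties as All
  open import Data.List.Relation.Unary.Any as Any using (Any; here; any?)
  import Data.List.Relation.Unary.Any.Properties as Any
  open import Data.Nat.Base
  open import Data.Nat.Properties
  open import Data.Product.Base using (∃-syntax; _×_; _,_; proj₁; proj₂)
  open import Data.Vec.Base as Vec using (Vec; []; _∷_; lookup; take; drop; replicate; zipWith; tabulate)
  open import Data.Vec.Properties using (lookup∘tabulate)
  open import Function.Base using (_∘_)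
  open import Relation.Binary.PropositionalEquality
  open import Relation.Nullary using (yes; no; contradiction)
  open import Relation.Nullary.Decidable using (_×-dec_)

  ∧-trueˡ : ∀ {a b} → a ∧ b ≡ true → a ≡ true
  ∧-trueˡ {true} _ = refl

  ∧-trueʳ : ∀ {a b} → a ∧ b ≡ true → b ≡ true
  ∧-trueʳ {true} eq = eq

  sub-++ : ∀ {k n} (x : Vec Bool k) (y : Vec Bool n) s →
           sub (x Vec.++ y) s ≡ sub x (take k s) ∧ sub y (drop k s)
  sub-++ []      y s       = refl
  sub-++ (x ∷ xs) y (s ∷ ss) = trans (cong ((not x ∨ s) ∧_) (sub-++ xs y ss)) (sym (Bool.∧-assoc (not x ∨ s) _ _))

  sub-∅ : ∀ {n} (s : Vec Bool n) → sub (replicate n false) s ≡ true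
  sub-∅ []      = refl
  sub-∅ (_ ∷ s) = sub-∅ s

  sub-∪ : ∀ {n} (x y s : Vec Bool n) → sub (zipWith _∨_ x y) s ≡ sub x s ∧ sub y s
  sub-∪ []          []          []      = refl
  sub-∪ (true ∷ x)  (true ∷ y)  (true ∷ s)  = sub-∪ x y s
  sub-∪ (true ∷ x)  (true ∷ y)  (false ∷ s) = refl
  sub-∪ (true ∷ x)  (false ∷ y) (true ∷ s)  = sub-∪ x y s
  sub-∪ (true ∷ x)  (false ∷ y) (false ∷ s) = refl
  sub-∪ (false ∷ x) (true ∷ y)  (true ∷ s)  = sub-∪ x y s
  sub-∪ (false ∷ x) (true ∷ y)  (false ∷ s) = sym (Bool.∧-zeroʳ (sub x s))
  sub-∪ (false ∷ x) (false ∷ y) (s ∷ ss)    = sub-∪ x y ss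

  sub-refl : ∀ {n} (s : Vec Bool n) → sub s s ≡ true
  sub-refl []          = refl
  sub-refl (true ∷ s)  = sub-refl s
  sub-refl (false ∷ s) = sub-refl s

  sub⇒∣∣≤ : ∀ {n} (x s : Vec Bool n) → sub x s ≡ true → ∣ x ∣ ≤ ∣ s ∣
  sub⇒∣∣≤ []          []          eq = z≤n
  sub⇒∣∣≤ (true ∷ x)  (true ∷ s)  eq = s≤s (sub⇒∣∣≤ x s eq)
  sub⇒∣∣≤ (false ∷ x) (true ∷ s)  eq = m≤n⇒m≤1+n (sub⇒∣∣≤ x s eq)
  sub⇒∣∣≤ (false ∷ x) (false ∷ s) eq = sub⇒∣∣≤ x s eq

  -- This is what the constant weight buys: a row, which only tests inclusion, can recognise the
  -- exact content of a full block.
  sub-∣∣⇒≡ : ∀ {n} (x s : Vec Bool n) → sub x s ≡ true → ∣ x ∣ ≡ ∣ s ∣ → x ≡ s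
  sub-∣∣⇒≡ []          []          eq c = refl
  sub-∣∣⇒≡ (true ∷ x)  (true ∷ s)  eq c = cong (true ∷_) (sub-∣∣⇒≡ x s eq (suc-injective c))
  sub-∣∣⇒≡ (false ∷ x) (true ∷ s)  eq c = contradiction (≤-trans (≤-reflexive (sym c)) (sub⇒∣∣≤ x s eq)) (<-irrefl refl)
  sub-∣∣⇒≡ (false ∷ x) (false ∷ s) eq c = cong (false ∷_) (sub-∣∣⇒≡ x s eq c)

  ∣∣-take-drop : ∀ k {n} (s : Vec Bool (k + n)) → ∣ s ∣ ≡ ∣ take k s ∣ + ∣ drop k s ∣
  ∣∣-take-drop zero    s           = refl
  ∣∣-take-drop (suc k) (true ∷ s)  = cong suc (∣∣-take-drop k s)
  ∣∣-take-drop (suc k) (false ∷ s) = ∣∣-take-drop k s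

  Missed : ∀ {n} → Vec Bool n → List (Vec Bool n) → Set
  Missed s = All (λ x → sub x s ≡ false)

  misses-++ : ∀ {n} (s : Vec Bool n) xs ys → misses s (xs ++ ys) ≡ misses s xs + misses s ys
  misses-++ s []       ys = refl
  misses-++ s (x ∷ xs) ys = trans (cong (_ +_) (misses-++ s xs ys)) (sym (+-assoc (if sub x s then 0 else 1) _ _))

  misses≤length : ∀ {n} (s : Vec Bool n) xs → misses s xs ≤ length xs
  misses≤length s []       = z≤n
  misses≤length s (x ∷ xs) with sub x s
  ... | true  = m≤n⇒m≤1+n (misses≤length s xs)
  ... | false = s≤s (misses≤length s xs)

  missed⇒length : ∀ {n} (s : Vec Bool n) {xs} → Missed s xs → misses s xs ≡ length xs
  missed⇒length s []                     = refl
  missed⇒length s {x ∷ xs} (eq ∷ missed) rewrite eq = cong suc (missed⇒length s missed)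

  length⇒missed : ∀ {n} (s : Vec Bool n) xs → misses s xs ≡ length xs → Missed s xs
  length⇒missed s []       eq = []
  length⇒missed s (x ∷ xs) eq with sub x s in sub≡
  ... | true  = contradiction (≤-trans (≤-reflexive (sym eq)) (misses≤length s xs)) (<-irrefl refl)
  ... | false = sub≡ ∷ length⇒missed s xs (suc-injective eq)

  -- The row of the private neighbour of `a`, written with `≡ᵇ` on positions because that is what
  -- the program tabulates.
  unit : ∀ {n} → Fin n → Vec Bool n
  unit a = tabulate (λ i → toℕ i ≡ᵇ toℕ a)

  unit-self : ∀ {n} (a : Fin n) → lookup (unit a) a ≡ true
  unit-self a = trans (lookup∘tabulate _ a) (n≡ᵇn (toℕ a))
    where
    n≡ᵇn : ∀ n → (n ≡ᵇ n) ≡ true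
    n≡ᵇn zero    = refl
    n≡ᵇn (suc n) = n≡ᵇn n

  sub-unit : ∀ {n} (a : Fin n) s → sub (unit a) s ≡ lookup s a
  sub-unit a s with sub (unit a) s in eq | lookup s a in eqs
  ... | true  | true  = refl
  ... | false | false = refl
  ... | true  | false = contradiction eqs (true≢false (sub-true (unit a) s a eq (unit-self a)))
  ... | false | true  = let i , ui , si = sub-false (unit a) s eq in
    contradiction (subst (λ j → lookup s j ≡ false) (unit-support i ui) si) (true≢false eqs)
    where
    unit-support : ∀ i → lookup (unit a) i ≡ true → i ≡ a
    unit-support i ui = toℕ-injective (≡ᵇ⇒≡ (toℕ i) (toℕ a) (subst T (trans (sym ui) (lookup∘tabulate _ i)) _))

  misses-tabulate : ∀ {n k} (s : Vec Bool n) (b : Vec Bool k) (g : Fin k → Vec Bool n) →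
                    (∀ i → sub (g i) s ≡ lookup b i) → misses s (List.tabulate g) + ∣ b ∣ ≡ k
  misses-tabulate s []          g eq = refl
  misses-tabulate s (true ∷ b)  g eq rewrite eq zero =
    trans (+-suc _ ∣ b ∣) (cong suc (misses-tabulate s b (g ∘ suc) (eq ∘ suc)))
  misses-tabulate s (false ∷ b) g eq rewrite eq zero = cong suc (misses-tabulate s b (g ∘ suc) (eq ∘ suc))

  -- A unit row lies inside `s` exactly when its column does, so every column in `s` is exchanged
  -- for its private neighbour.
  misses-units : ∀ {n} (s : Vec Bool n) → misses s (List.tabulate unit) + ∣ s ∣ ≡ n
  misses-units s = misses-tabulate s s unit (λ a → sub-unit a s)

  module _ {L : ℕ} where

    mask : ∀ m → ℕ → Vec Bool L → Vec Bool (m * L)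
    mask zero    j       T = []
    mask (suc m) zero    T = T Vec.++ replicate (m * L) false
    mask (suc m) (suc j) T = replicate L false Vec.++ mask m j T

    block : ∀ m → ℕ → Vec Bool (m * L) → Vec Bool L
    block zero    j       s = replicate L false
    block (suc m) zero    s = take L s
    block (suc m) (suc j) s = block m j (drop L s)

    assemble : ∀ m → (ℕ → Vec Bool L) → Vec Bool (m * L)
    assemble zero    T = []
    assemble (suc m) T = T 0 Vec.++ assemble m (T ∘ suc)

    -- A mask is empty outside block j and hence imposes nothing on the other blocks.
    sub-mask : ∀ {m j} T s → j < m → sub (mask m j T) s ≡ sub T (block m j s)
    sub-mask {suc m} {zero}  T s (s≤s _)   = trans (sub-++ T (replicate (m * L) false) s)
      (trans (cong (sub T (take L s) ∧_) (sub-∅ (drop L s))) (Bool.∧-identityʳ _))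
    sub-mask {suc m} {suc j} T s (s≤s j<m) = trans (sub-++ (replicate L false) (mask m j T) s)
      (trans (cong (_∧ sub (mask m j T) (drop L s)) (sub-∅ (take L s))) (sub-mask T (drop L s) j<m))

    block-assemble : ∀ {m j} T → j < m → block m j (assemble m T) ≡ T j
    block-assemble {suc m} {zero}  T (s≤s _)   = take-++ (T 0) _
      where
      take-++ : ∀ {k n} (x : Vec Bool k) (y : Vec Bool n) → take k (x Vec.++ y) ≡ x
      take-++ []       y = refl
      take-++ (x ∷ xs) y = cong (x ∷_) (take-++ xs y)
    block-assemble {suc m} {suc j} T (s≤s j<m) =
      trans (cong (block m j) (drop-++ (T 0) _)) (block-assemble (T ∘ suc) j<m)
      where
      drop-++ : ∀ {k n} (x : Vec Bool k) (y : Vec Bool n) → drop k (x Vec.++ y) ≡ y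
      drop-++ []       y = refl
      drop-++ (x ∷ xs) y = drop-++ xs y

    blocks-≤ : ∀ {w} m s → (∀ {j} → j < m → ∣ block m j s ∣ ≤ w) → ∣ s ∣ ≤ m * w
    blocks-≤ zero    s le = ∣p∣≤n s
    blocks-≤ (suc m) s le = ≤-trans (≤-reflexive (∣∣-take-drop L s))
      (+-mono-≤ (le (s≤s z≤n)) (blocks-≤ m (drop L s) (le ∘ s≤s)))

    blocks-≡ : ∀ {w} m s → (∀ {j} → j < m → ∣ block m j s ∣ ≡ w) → ∣ s ∣ ≡ m * w
    blocks-≡ zero    [] eq = refl
    blocks-≡ (suc m) s  eq = trans (∣∣-take-drop L s)
      (cong₂ _+_ (eq (s≤s z≤n)) (blocks-≡ m (drop L s) (eq ∘ s≤s)))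

    -- A deficit in one block cannot be made up elsewhere, as every other block is capped at `w`
    -- too.
    blocks-full : ∀ {w} m s → (∀ {j} → j < m → ∣ block m j s ∣ ≤ w) → ∣ s ∣ ≡ m * w →
                  ∀ {j} → j < m → ∣ block m j s ∣ ≡ w
    blocks-full {w} (suc m) s le eq = full
      where
      split : ∣ take L s ∣ + ∣ drop L s ∣ ≡ w + m * w
      split = trans (sym (∣∣-take-drop L s)) eq

      rest : ∣ drop L s ∣ ≤ m * w
      rest = blocks-≤ m (drop L s) (le ∘ s≤s)

      first≡ : ∣ take L s ∣ ≡ w
      first≡ = ≤-antisym (le (s≤s z≤n))
        (+-cancelʳ-≤ (m * w) w _ (≤-trans (≤-reflexive (sym split)) (+-monoʳ-≤ ∣ take L s ∣ rest)))

      full : ∀ {j} → j < suc m → ∣ block (suc m) j s ∣ ≡ w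
      full {zero}  _         = first≡
      full {suc j} (s≤s j<m) = blocks-full m (drop L s) (le ∘ s≤s)
        (+-cancelˡ-≡ w _ _ (trans (cong (_+ ∣ drop L s ∣) (sym first≡)) split)) j<m

  allVecs : ∀ n → List (Vec Bool n)
  allVecs zero    = [] ∷ []
  allVecs (suc n) = map (true ∷_) (allVecs n) ++ map (false ∷_) (allVecs n)

  ∈-allVecs : ∀ {n} (v : Vec Bool n) → v ∈ allVecs n
  ∈-allVecs []          = here refl
  ∈-allVecs (true ∷ v)  = ∈-++⁺ˡ (∈-map⁺ (true ∷_) (∈-allVecs v))
  ∈-allVecs (false ∷ v) = ∈-++⁺ʳ _ (∈-map⁺ (false ∷_) (∈-allVecs v))

  -- Division by suc t₀: position i is the pair of i / suc t₀ and i mod suc t₀.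

  module _ (t₀ : ℕ) where

    advance : ℕ × Fin (suc t₀) → ℕ × Fin (suc t₀)
    advance (j , r) with suc (toℕ r) <? suc t₀
    ... | yes lt = j , fromℕ< lt
    ... | no  _  = suc j , zero

    position : ℕ → ℕ × Fin (suc t₀)
    position zero    = 0 , zero
    position (suc i) = advance (position i)

    advance-value : ∀ p → let j , r = advance p in
                    j * suc t₀ + toℕ r ≡ suc (proj₁ p * suc t₀ + toℕ (proj₂ p))
    advance-value (j , r) with suc (toℕ r) <? suc t₀
    ... | yes lt = trans (cong (j * suc t₀ +_) (toℕ-fromℕ< lt)) (+-suc (j * suc t₀) (toℕ r))
    ... | no  ≮  = begin
      suc t₀ + j * suc t₀ + 0            ≡⟨ +-identityʳ _ ⟩
      suc t₀ + j * suc t₀                ≡⟨ +-comm (suc t₀) (j * suc t₀) ⟩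
      j * suc t₀ + suc t₀                ≡⟨ cong (j * suc t₀ +_) (≤-antisym (≮⇒≥ ≮) (toℕ<n r)) ⟩
      j * suc t₀ + suc (toℕ r)           ≡⟨ +-suc (j * suc t₀) (toℕ r) ⟩
      suc (j * suc t₀ + toℕ r)           ∎
      where open ≡-Reasoning

    position-value : ∀ i → let j , r = position i in j * suc t₀ + toℕ r ≡ i
    position-value zero    = refl
    position-value (suc i) = trans (advance-value (position i)) (cong suc (position-value i))

    -- With quotients j of i and q of n, and t = `suc t₀`: j t ≤ i ≤ n < (q + 1) t. It places all
    -- variables of the formula in `suc q` blocks.
    quotient-mono : ∀ {i n} → i ≤ n → proj₁ (position i) < suc (proj₁ (position n))
    quotient-mono {i} {n} i≤n = *-cancelʳ-< (suc t₀) (proj₁ (position i)) (suc (proj₁ (position n))) (begin-strict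
      proj₁ (position i) * suc t₀                                  ≤⟨ m≤m+n _ _ ⟩
      proj₁ (position i) * suc t₀ + toℕ (proj₂ (position i))         ≡⟨ position-value i ⟩
      i                                                            ≤⟨ i≤n ⟩
      n                                                            ≡⟨ position-value n ⟨
      proj₁ (position n) * suc t₀ + toℕ (proj₂ (position n))         <⟨ +-monoʳ-< _ (toℕ<n (proj₂ (position n))) ⟩
      proj₁ (position n) * suc t₀ + suc t₀                         ≡⟨ +-comm _ (suc t₀) ⟩
      suc (proj₁ (position n)) * suc t₀                            ∎)
      where open ≤-Reasoning

  -- The components are ordered as in encLiteral.
  Lit : Set
  Lit = Bool × ℕ

  Satisfies : (ℕ → Bool) → List (List Lit) → Set
  Satisfies a = All (Any (λ (b , i) → a i ≡ b))

  module Masks {t₀ L₀ w : ℕ} (code : ConstantWeightCode (suc t₀) (suc L₀) w) where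

    open ConstantWeightCode code

    L : ℕ
    L = suc L₀

    oversized : List (Vec Bool L)
    oversized = filter (λ T → w <? ∣ T ∣) (allVecs L)

    -- The list ranges over all `w`-sets, since those that are not codewords are decoded as well.
    falsifying : Fin (suc t₀) → Bool → List (Vec Bool L)
    falsifying r b = filter (λ T → (∣ T ∣ ≟ w) ×-dec (decode T r Bool.≟ not b)) (allVecs L)

    module _ (m : ℕ) where

      literalMasks : Lit → List (Vec Bool (m * L))
      literalMasks (b , i) = let j , r = position t₀ i in map (mask m j) (falsifying r b)

      -- Two different codewords may be chosen for literals in the same block.  Their
      -- union has more than w elements, so no cover with w elements per block
      -- contains it, and the row is harmless.
      clauseMasks : List Lit → List (Vec Bool (m * L))
      clauseMasks []      = replicate (m * L) false ∷ []
      clauseMasks (l ∷ c) = concatMap (λ T → map (zipWith _∨_ T) (clauseMasks c)) (literalMasks l)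

      oversizedMasks : List (Vec Bool (m * L))
      oversizedMasks = concatMap (λ j → map (mask m j) oversized) (downFrom m)

      constraints : List (List Lit) → List (Vec Bool (m * L))
      constraints cs = oversizedMasks ++ concatMap clauseMasks cs

      rows : List (List Lit) → List (Vec Bool (m * L))
      rows cs = List.tabulate unit ++ constraints cs

      valueAt : Vec Bool (m * L) → ℕ → Bool
      valueAt s i = let j , r = position t₀ i in decode (block m j s) r

      Hit : Vec Bool (m * L) → List (Vec Bool (m * L)) → Set
      Hit s = Any (λ x → sub x s ≡ true)

      hit-clause⁻ : ∀ s c → Hit s (clauseMasks c) → All (Hit s ∘ literalMasks) c
      hit-clause⁻ s []      hit = []
      hit-clause⁻ s (l ∷ c) hit with find (Any.concatMap⁻ (λ T → map (zipWith _∨_ T) (clauseMasks c)) hit)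
      ... | T , T∈ , hit′ with find (Any.map⁻ hit′)
      ... | y , y∈ , eq = let both = trans (sym (sub-∪ T y s)) eq in
        lose T∈ (∧-trueˡ both) ∷ hit-clause⁻ s c (lose y∈ (∧-trueʳ both))

      hit-clause⁺ : ∀ s c → All (Hit s ∘ literalMasks) c → Hit s (clauseMasks c)
      -- The empty clause gives the empty row, which lies inside every `s` and can never be missed,
      -- just as the clause can never be satisfied.
      hit-clause⁺ s []      []           = here (sub-∅ s)
      hit-clause⁺ s (l ∷ c) (hit ∷ hits) = Any.concatMap⁺ (λ T → map (zipWith _∨_ T) (clauseMasks c))
        (Any.map (λ {T} eq → Any.map⁺ (Any.map (λ {y} eq′ → trans (sub-∪ T y s) (cong₂ _∧_ eq eq′)) (hit-clause⁺ s c hits))) hit)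

      module _ (s : Vec Bool (m * L)) (full : ∀ {j} → j < m → ∣ block m j s ∣ ≡ w) where

        -- The set T of the hit row and the block both have `w` elements, so inclusion makes them
        -- equal and they decode alike.
        hit-literal⁻ : ∀ ((b , i) : Lit) → proj₁ (position t₀ i) < m → Hit s (literalMasks (b , i)) → valueAt s i ≡ not b
        hit-literal⁻ (b , i) j<m hit with find (Any.map⁻ hit)
        ... | T , T∈ , eq = let _ , card , dec = ∈-filter⁻ (λ T → (∣ T ∣ ≟ w) ×-dec (decode T _ Bool.≟ not b)) {xs = allVecs L} T∈ in
          trans (cong (λ U → decode U _) (sym (sub-∣∣⇒≡ T _ (trans (sym (sub-mask T s j<m)) eq) (trans card (sym (full j<m)))))) dec

        -- The block itself is one of the falsifying sets.
        hit-literal⁺ : ∀ ((b , i) : Lit) → proj₁ (position t₀ i) < m → valueAt s i ≡ not b → Hit s (literalMasks (b , i))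
        hit-literal⁺ (b , i) j<m eq = Any.map⁺ (lose
          (∈-filter⁺ (λ T → (∣ T ∣ ≟ w) ×-dec (decode T _ Bool.≟ not b)) (∈-allVecs B) (full j<m , eq))
          (trans (sub-mask B s j<m) (sub-refl B)))
          where B = block m (proj₁ (position t₀ i)) s

        -- If all literals of a clause were false, each would have a mask inside `s`, and the union
        -- of these masks would be a row of the clause inside `s`.
        missed⇒satisfies : ∀ cs → All (All (λ l → proj₁ (position t₀ (proj₂ l)) < m)) cs →
                           Missed s (concatMap clauseMasks cs) → Satisfies (valueAt s) cs
        missed⇒satisfies []       []            missed = []
        missed⇒satisfies (c ∷ cs) (small ∷ smalls) missed = satisfied ∷ missed⇒satisfies cs smalls (All.++⁻ʳ (clauseMasks c) missed)
          where
          satisfied : Any (λ (b , i) → valueAt s i ≡ b) c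
          satisfied with any? (λ (b , i) → valueAt s i Bool.≟ b) c
          ... | yes sat = sat
          ... | no ¬sat = contradiction
            (hit-clause⁺ s c (All.zipWith (λ {l} (j<m , ≢b) → hit-literal⁺ l j<m (Bool.¬-not ≢b)) (small , All.¬Any⇒All¬ c ¬sat)))
            (All.All¬⇒¬Any (All.map (λ ≡false ≡true → true≢false ≡true ≡false) (All.++⁻ˡ (clauseMasks c) missed)))

        -- A row inside `s` contains a falsifying mask for every literal of its clause, in
        -- particular for a true one.
        satisfies⇒missed : ∀ cs → All (All (λ l → proj₁ (position t₀ (proj₂ l)) < m)) cs →
                           Satisfies (valueAt s) cs → Missed s (concatMap clauseMasks cs)
        satisfies⇒missed []       []               []           = []
        satisfies⇒missed (c ∷ cs) (small ∷ smalls) (sat ∷ sats) = All.++⁺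
          (All.map Bool.¬-not (All.¬Any⇒All¬ (clauseMasks c) λ hit →
            let l , l∈ , eq = find sat in
            Bool.not-¬ eq (hit-literal⁻ l (All.lookup small l∈) (All.lookup (hit-clause⁻ s c hit) l∈))))
          (satisfies⇒missed cs smalls sats)

      -- An overfull block would itself be one of the oversized rows, and it lies inside `s`.
      missed⇒≤w : ∀ s → Missed s oversizedMasks → ∀ {j} → j < m → ∣ block m j s ∣ ≤ w
      missed⇒≤w s missed {j} j<m with ∣ block m j s ∣ ≤? w
      ... | yes le = le
      ... | no ≰   = contradiction
        (trans (sub-mask B s j<m) (sub-refl B))
        λ ≡true → true≢false ≡true (All.lookup missed (∈-concatMap⁺ (λ j → map (mask m j) oversized)
          (lose (∈-downFrom⁺ j<m) (∈-map⁺ (mask m j) (∈-filter⁺ (λ T → w <? ∣ T ∣) (∈-allVecs B) (≰⇒> ≰))))))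
        where B = block m j s

      ≤w⇒missed : ∀ s → (∀ {j} → j < m → ∣ block m j s ∣ ≤ w) → Missed s oversizedMasks
      ≤w⇒missed s le = All.tabulate λ {x} x∈ → Bool.¬-not λ eq →
        let j , j∈ , x∈′ = find (∈-concatMap⁻ (λ j → map (mask m j) oversized) {xs = downFrom m} x∈)
            T , T∈ , x≡ = ∈-map⁻ (mask m j) x∈′
            _ , w< = ∈-filter⁻ (λ T → w <? ∣ T ∣) {xs = allVecs L} T∈
            j<m = ∈-downFrom⁻ j∈
        in <⇒≱ w< (≤-trans (sub⇒∣∣≤ T _ (trans (sym (sub-mask T s j<m)) (subst (λ y → sub y s ≡ true) x≡ eq))) (le j<m))

      encodeAll : (ℕ → Bool) → Vec Bool (m * L)
      encodeAll a = assemble m λ j → encode λ r → a (j * suc t₀ + toℕ r)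

      encodeAll-full : ∀ a {j} → j < m → ∣ block m j (encodeAll a) ∣ ≡ w
      encodeAll-full a j<m = trans (cong ∣_∣ (block-assemble _ j<m)) (weight _)

      valueAt-encodeAll : ∀ a {i} → proj₁ (position t₀ i) < m → valueAt (encodeAll a) i ≡ a i
      valueAt-encodeAll a {i} j<m = let j , r = position t₀ i in
        trans (cong (λ T → decode T r) (block-assemble _ j<m)) (trans (decode-encode _ r) (cong a (position-value t₀ i)))

    module _ (q : ℕ) (cs : List (List Lit))
             (small : All (All (λ l → proj₁ (position t₀ (proj₂ l)) < suc q)) cs) where

      private
        m α N : ℕ
        m = suc q
        α = m * L
        N = α + length (rows m cs)

        cons : List (Vec Bool α)
        cons = constraints m cs

      target : ℕ
      target = m * w + (N * α + N * length cons)

      -- A column in `s` earns `suc N` and loses its private neighbour, worth `N`; the net gain is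
      -- 1.
      score-split : ∀ s → score (rows m cs) s ≡ ∣ s ∣ + (N * α + N * misses s cons)
      score-split s = begin
        ∣ s ∣ + N * ∣ s ∣ + N * misses s (rows m cs)                 ≡⟨ +-assoc ∣ s ∣ _ _ ⟩
        ∣ s ∣ + (N * ∣ s ∣ + N * misses s (rows m cs))               ≡⟨ cong (∣ s ∣ +_) (*-distribˡ-+ N ∣ s ∣ _) ⟨
        ∣ s ∣ + N * (∣ s ∣ + misses s (rows m cs))                   ≡⟨ cong (λ k → ∣ s ∣ + N * k) all-rows ⟩
        ∣ s ∣ + N * (α + misses s cons)                             ≡⟨ cong (∣ s ∣ +_) (*-distribˡ-+ N α _) ⟩
        ∣ s ∣ + (N * α + N * misses s cons)                         ∎
        where
        open ≡-Reasoning
        units = List.tabulate {n = α} unit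

        all-rows : ∣ s ∣ + misses s (rows m cs) ≡ α + misses s cons
        all-rows = begin
          ∣ s ∣ + misses s (rows m cs)              ≡⟨ cong (∣ s ∣ +_) (misses-++ s units cons) ⟩
          ∣ s ∣ + (misses s units + misses s cons)  ≡⟨ +-assoc ∣ s ∣ _ _ ⟨
          ∣ s ∣ + misses s units + misses s cons    ≡⟨ cong (_+ misses s cons) (trans (+-comm ∣ s ∣ _) (misses-units s)) ⟩
          α + misses s cons                        ∎

      -- The unit rows alone make N at least 2 α, and α is positive.
      α<N : α < N
      α<N = begin-strict
        α                                      ≡⟨ +-identityʳ α ⟨
        α + 0                                  <⟨ +-monoʳ-< α (s≤s z≤n) ⟩
        α + α                                  ≡⟨ cong (α +_) (length-tabulate {n = α} unit) ⟨
        α + length (List.tabulate {n = α} unit) ≤⟨ +-monoʳ-≤ α (≤-trans (m≤m+n _ _) (≤-reflexive (sym (length-++ (List.tabulate {n = α} unit))))) ⟩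
        N                                      ∎
        where open ≤-Reasoning

      -- A violated constraint costs N, which the fractional part of the weight cannot make up for.
      violated⇒score<target : ∀ s → misses s cons < length cons → score (rows m cs) s < target
      violated⇒score<target s lt = begin-strict
        score (rows m cs) s                       ≡⟨ score-split s ⟩
        ∣ s ∣ + (N * α + N * misses s cons)         <⟨ +-monoˡ-< _ (≤-<-trans (∣p∣≤n s) α<N) ⟩
        N + (N * α + N * misses s cons)           ≡⟨ +-assoc N _ _ ⟨
        N + N * α + N * misses s cons             ≡⟨ cong (_+ N * misses s cons) (+-comm N (N * α)) ⟩
        N * α + N + N * misses s cons             ≡⟨ +-assoc (N * α) N _ ⟩
        N * α + (N + N * misses s cons)           ≡⟨ cong (N * α +_) (*-suc N _) ⟨
        N * α + N * suc (misses s cons)           ≤⟨ +-monoʳ-≤ (N * α) (*-monoʳ-≤ N lt) ⟩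
        N * α + N * length cons                   ≤⟨ m≤n+m _ (m * w) ⟩
        target                                    ∎
        where open ≤-Reasoning

      missed⇒score : ∀ s → Missed s cons → score (rows m cs) s ≡ ∣ s ∣ + (N * α + N * length cons)
      missed⇒score s missed = trans (score-split s) (cong (λ k → ∣ s ∣ + (N * α + N * k)) (missed⇒length s missed))

      -- If no constraint is violated, only the size of `s` can vary, and the oversized rows cap it
      -- at `m * w`.
      score≤target : ∀ s → score (rows m cs) s ≤ target
      score≤target s with misses s cons <? length cons
      ... | yes lt = <⇒≤ (violated⇒score<target s lt)
      ... | no  ≮  = let missed = length⇒missed s cons (≤-antisym (misses≤length s cons) (≮⇒≥ ≮)) in
        ≤-trans (≤-reflexive (missed⇒score s missed))
          (+-monoˡ-≤ _ (blocks-≤ m s (missed⇒≤w m s (All.++⁻ˡ (oversizedMasks m) missed))))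

      -- Equality excludes a violated constraint and leaves `m * w` columns, so all blocks are full
      -- and the decoded values are those the clause rows test.
      target⇒satisfies : ∀ s → score (rows m cs) s ≡ target → Satisfies (valueAt m s) cs
      target⇒satisfies s eq with misses s cons <? length cons
      ... | yes lt = contradiction (violated⇒score<target s lt) (≤⇒≯ (≤-reflexive (sym eq)))
      ... | no  ≮  = missed⇒satisfies m s (blocks-full m s (missed⇒≤w m s (All.++⁻ˡ (oversizedMasks m) missed)) ∣s∣≡)
                       cs small (All.++⁻ʳ (oversizedMasks m) missed)
        where
        missed : Missed s cons
        missed = length⇒missed s cons (≤-antisym (misses≤length s cons) (≮⇒≥ ≮))

        ∣s∣≡ : ∣ s ∣ ≡ m * w
        ∣s∣≡ = +-cancelʳ-≡ _ ∣ s ∣ (m * w) (trans (sym (missed⇒score s missed)) eq)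

      -- The unit row of a column has no other neighbour.
      private-rows : ∀ s → PrivateRows (rows m cs) s
      private-rows s a sa = let r , r≡ = ∈-lookup⁻ (∈-++⁺ˡ (∈-tabulate⁺ {f = unit} a)) in
        r , trans (cong (λ x → lookup x a) r≡) (unit-self a)
          , trans (cong (λ x → sub x s) r≡) (trans (sub-unit a s) sa)
        where
        ∈-lookup⁻ : ∀ {A : Set} {x : A} {xs} → x ∈ xs → ∃[ r ] List.lookup xs r ≡ x
        ∈-lookup⁻ x∈ = Any.index x∈ , sym (Any.lookup-index x∈)

      satisfies⇒target : ∀ a → Satisfies a cs → score (rows m cs) (encodeAll m a) ≡ target
      satisfies⇒target a sat = trans
        (missed⇒score s (All.++⁺ (≤w⇒missed m s λ j<m → ≤-reflexive (full j<m))
                                 (satisfies⇒missed m s full cs small (agrees cs small sat))))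
        (cong (_+ (N * α + N * length cons)) (blocks-≡ m s full))
        where
        s = encodeAll m a

        full : ∀ {j} → j < m → ∣ block m j s ∣ ≡ w
        full = encodeAll-full m a

        agrees : ∀ cs → All (All (λ l → proj₁ (position t₀ (proj₂ l)) < m)) cs → Satisfies a cs → Satisfies (valueAt m s) cs
        agrees []       []       []           = []
        agrees (c ∷ cs) (p ∷ ps) (sat ∷ sats) =
          (let l , l∈ , eq = find sat in lose l∈ (trans (valueAt-encodeAll m a (All.lookup p l∈)) eq)) ∷ agrees cs ps sats

-- The same construction on plain lists

module Lists where

  open Combinators using (nth)
  open Rate using (frac; frac-1)
  open Cover using (coverInstance)
  open Code using (ConstantWeightCode)
  open Sat using (mask; position; advance; unit; Lit; module Masks)
  open import Data.Bool.Base using (Bool; true; false; _∨_; if_then_else_)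
  open import Data.Fin.Base using (Fin; zero; suc; toℕ; fromℕ<; _↑ˡ_; _↑ʳ_)
  open import Data.Fin.Properties using (splitAt-↑ˡ; splitAt-↑ʳ; toℕ-fromℕ<)
  open import Data.List.Base as List
    using (List; []; _∷_; _++_; length; map; foldr; concatMap; replicate; null; drop; downFrom; tabulate)
  open import Data.List.Membership.Propositional using (_∈_)
  open import Data.List.Membership.Propositional.Properties using (∈-downFrom⁻)
  open import Data.List.Properties hiding (sum-++)
  open import Data.List.Relation.Unary.Any using (here; there)
  import Data.Nat.Coprimality as Coprime
  open import Data.Nat.Base hiding (_/_)
  open import Data.Nat.GeneralisedArithmetic using (fold)
  open import Data.Nat.Properties
  open import Data.Product.Base using (_×_; _,_; proj₁; proj₂)
  open import Data.Rational.Properties using (normalize-coprime)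
  open import Data.Vec.Base as Vec using (Vec; []; _∷_; toList; lookup)
  open import Data.Vec.Properties using (toList-++; toList-replicate)
  open import Function.Base using (_∘_; const)
  open import Relation.Binary.PropositionalEquality
  open import Relation.Nullary using (yes; no)

  tabulate-+ : ∀ {A : Set} m {n} (f : Fin (m + n) → A) →
               tabulate f ≡ tabulate (f ∘ (_↑ˡ n)) ++ tabulate (f ∘ (m ↑ʳ_))
  tabulate-+ zero    f = refl
  tabulate-+ (suc m) f = cong (f zero ∷_) (tabulate-+ m (f ∘ suc))

  tabulate-const : ∀ {A : Set} n (a : A) → tabulate {n = n} (const a) ≡ replicate n a
  tabulate-const zero    a = refl
  tabulate-const (suc n) a = cong (a ∷_) (tabulate-const n a)

  nth-toList : ∀ {n} (v : Vec Bool n) a → nth (toList v) (toℕ a) ≡ lookup v a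
  nth-toList (b ∷ v) zero    = refl
  nth-toList (b ∷ v) (suc a) = nth-toList v a

  toList-tabulate-nth : ∀ {n} (v : Vec Bool n) → tabulate {n = n} (nth (toList v) ∘ toℕ) ≡ toList v
  toList-tabulate-nth []      = refl
  toList-tabulate-nth (b ∷ v) = cong (b ∷_) (toList-tabulate-nth v)

  toList-tabulate : ∀ {n} (f : Fin n → Bool) → toList (Vec.tabulate f) ≡ tabulate f
  toList-tabulate {zero}  f = refl
  toList-tabulate {suc n} f = cong (f zero ∷_) (toList-tabulate (f ∘ suc))

  concatMap-∈-cong : ∀ {A B : Set} {f g : A → List B} xs → (∀ {x} → x ∈ xs → f x ≡ g x) →
                     concatMap f xs ≡ concatMap g xs
  concatMap-∈-cong []       eq = refl
  concatMap-∈-cong (x ∷ xs) eq = cong₂ _++_ (eq (here refl)) (concatMap-∈-cong xs (eq ∘ there))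

  -- The superscript L marks the versions on lists that the programs compute.
  unionᴸ : ℕ → List Bool → List Bool → List Bool
  unionᴸ α x y = tabulate {n = α} (λ a → nth x (toℕ a) ∨ nth y (toℕ a))

  unionᴸ-toList : ∀ {α} (x y : Vec Bool α) → unionᴸ α (toList x) (toList y) ≡ toList (Vec.zipWith _∨_ x y)
  unionᴸ-toList []      []      = refl
  unionᴸ-toList (a ∷ x) (b ∷ y) = cong ((a ∨ b) ∷_) (unionᴸ-toList x y)

  -- The symmetric block matrix with zero diagonal blocks; its lower left block is the incidence
  -- matrix and its upper right block the transpose.
  matrixᴸ : ℕ → ℕ → List (List Bool) → List (List Bool)
  matrixᴸ α R rows = tabulate {n = α} (λ a → replicate α false ++ map (λ x → nth x (toℕ a)) rows)
                     ++ map (_++ replicate R false) rows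

  weightsᴸ : ℕ → ℕ → List (ℕ × ℕ)
  weightsᴸ α R = replicate α (suc (α + R) , α + R) ++ replicate R (1 , 1)

  module _ {α₀ : ℕ} (Xs : List (Vec Bool (suc α₀))) where

    private
      α R N : ℕ
      α = suc α₀
      R = length Xs
      N = α + R

      bits : List (List Bool)
      bits = map toList Xs

    open RestrictedInstance (coverInstance Xs)

    map-rows : ∀ {A : Set} (f : Vec Bool α → A) → map f Xs ≡ tabulate (f ∘ List.lookup Xs)
    map-rows f = trans (cong (map f) (sym (tabulate-lookup Xs))) (map-tabulate (List.lookup Xs) f)

    matrixᴸ-adj : matrixᴸ α R bits ≡ tabulate (λ u → tabulate (λ v → adj u v))
    matrixᴸ-adj = sym (trans (tabulate-+ α {R} (λ u → tabulate (λ v → adj u v))) (cong₂ _++_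
      (tabulate-cong λ a → trans (tabulate-+ α {R} (adj (a ↑ˡ R))) (cong₂ _++_
        (trans (tabulate-cong λ b → cong₂ adj″ (splitAt-↑ˡ α a R) (splitAt-↑ˡ α b R)) (tabulate-const α false))
        (trans (tabulate-cong λ r → trans (cong₂ adj″ (splitAt-↑ˡ α a R) (splitAt-↑ʳ α R r)) (sym (nth-toList (List.lookup Xs r) a)))
          (trans (sym (map-rows λ x → nth (toList x) (toℕ a))) (map-∘ {g = λ x → nth x (toℕ a)} {f = toList} Xs)))))
      (trans (tabulate-cong λ r → trans (tabulate-+ α {R} (adj (α ↑ʳ r))) (cong₂ _++_
        (trans (tabulate-cong λ a → trans (cong₂ adj″ (splitAt-↑ʳ α R r) (splitAt-↑ˡ α a R)) (sym (nth-toList (List.lookup Xs r) a)))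
          (toList-tabulate-nth (List.lookup Xs r)))
        (trans (tabulate-cong λ r′ → cong₂ adj″ (splitAt-↑ʳ α R r) (splitAt-↑ʳ α R r′)) (tabulate-const R false))))
        (trans (sym (map-rows λ x → toList x ++ replicate R false)) (map-∘ {g = _++ replicate R false} {f = toList} Xs)))))
      where adj″ = Cover.adj′ Xs

    encPair : ℕ × ℕ → Tree
    encPair (a , b) = node (encℕ a) (encℕ b)

    -- `encℚ` writes lowest terms: `suc N` and `N` are coprime, while N/N becomes 1/1.
    weightsᴸ-w : encList encPair (weightsᴸ α R) ≡ encList encℚ (tabulate w)
    weightsᴸ-w = sym (begin
      encList encℚ (tabulate w)                                   ≡⟨ cong (encList encℚ) (tabulate-+ α {R} w) ⟩
      encList encℚ (tabulate (w ∘ (_↑ˡ R)) ++ tabulate (w ∘ (α ↑ʳ_)))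
        ≡⟨ cong₂ (λ xs ys → encList encℚ (xs ++ ys))
            (trans (tabulate-cong λ a → cong (frac (α₀ + R) ∘ Cover.κ′ Xs) (splitAt-↑ˡ α a R))
              (tabulate-const α (frac (α₀ + R) (suc N))))
            (trans (tabulate-cong λ r → cong (frac (α₀ + R) ∘ Cover.κ′ Xs) (splitAt-↑ʳ α R r))
              (tabulate-const R (frac (α₀ + R) N))) ⟩
      encList encℚ (replicate α (frac (α₀ + R) (suc N)) ++ replicate R (frac (α₀ + R) N))
        ≡⟨ encList-++-cong {xs = replicate α (frac (α₀ + R) (suc N))} {xs′ = replicate α (suc N , N)}
            (encList-replicate {e = encℚ} {encPair} {a = frac (α₀ + R) (suc N)} α heavy)
            (encList-replicate {e = encℚ} {encPair} {a = frac (α₀ + R) N} R light) ⟩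
      encList encPair (weightsᴸ α R)                                    ∎)
      where
      open ≡-Reasoning

      heavy : encℚ (frac (α₀ + R) (suc N)) ≡ encPair (suc N , N)
      heavy = cong encℚ {x = frac (α₀ + R) (suc N)} (normalize-coprime {suc N} {α₀ + R}
        (subst (λ k → Coprime.Coprime k N) (+-comm N 1) (Coprime.coprime-+ (Coprime.1-coprimeTo N))))

      light : encℚ (frac (α₀ + R) N) ≡ encPair (1 , 1)
      light = cong encℚ {x = frac (α₀ + R) N} (frac-1 (α₀ + R))

      encList-replicate : ∀ {A B : Set} {e : A → Tree} {e′ : B → Tree} {a b} n → e a ≡ e′ b →
                          encList e (replicate n a) ≡ encList e′ (replicate n b)
      encList-replicate zero    eq = refl
      encList-replicate (suc n) eq = cong₂ node eq (encList-replicate n eq)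

      encList-++-cong : ∀ {A B : Set} {e : A → Tree} {e′ : B → Tree} {xs ys : List A} {xs′ ys′ : List B} →
                        encList e xs ≡ encList e′ xs′ → encList e ys ≡ encList e′ ys′ →
                        encList e (xs ++ ys) ≡ encList e′ (xs′ ++ ys′)
      encList-++-cong {xs = []}     {xs′ = []}      eq eq′ = eq′
      encList-++-cong {xs = []}     {xs′ = _ ∷ _}   () eq′
      encList-++-cong {xs = _ ∷ _}  {xs′ = []}      () eq′
      encList-++-cong {xs = x ∷ xs} {xs′ = x′ ∷ xs′} eq eq′ =
        cong₂ node (cong left eq) (encList-++-cong {xs = xs} {xs′ = xs′} (cong right eq) eq′)
        where
        left right : Tree → Tree
        left leaf        = leaf
        left (node l _)  = l
        right leaf       = leaf
        right (node _ r) = r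

  module Listsᴸ {t₀ L₀ w : ℕ} (code : ConstantWeightCode (suc t₀) (suc L₀) w) where

    open Masks code

    zs : List Bool
    zs = replicate L false

    pad : ℕ → List Bool → List Bool
    pad i xs = fold xs (zs ++_) i

    -- For j ≤ q there are `suc q` blocks in all: j empty ones, T, and q - j empty ones.
    maskᴸ : ℕ → ℕ → List Bool → List Bool
    maskᴸ q j T = pad j (T ++ pad (q ∸ j) [])

    pad-zeros : ∀ m → pad m [] ≡ toList (Vec.replicate (m * L) false)
    pad-zeros m = trans (go m) (sym (toList-replicate (m * L) false))
      where
      go : ∀ m → pad m [] ≡ replicate (m * L) false
      go zero    = refl
      go (suc m) = trans (cong (zs ++_) (go m)) (replicate-+ L (m * L))
        where
        replicate-+ : ∀ a b → replicate a false ++ replicate b false ≡ replicate (a + b) false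
        replicate-+ zero    b = refl
        replicate-+ (suc a) b = cong (false ∷_) (replicate-+ a b)

    maskᴸ-toList : ∀ {q j} (T : Vec Bool L) → j ≤ q → maskᴸ q j (toList T) ≡ toList (mask {L} (suc q) j T)
    maskᴸ-toList {q} {zero} T _ = trans (cong (toList T ++_) (pad-zeros q)) (sym (toList-++ T _))
    maskᴸ-toList {suc q} {suc j} T (s≤s j≤q) = trans
      (cong₂ _++_ (sym (toList-replicate L false)) (maskᴸ-toList T j≤q))
      (sym (toList-++ (Vec.replicate L false) (mask (suc q) j T)))

    entry : Fin (suc t₀) → List (List Bool) × List (List Bool)
    entry r = map toList (falsifying r false) , map toList (falsifying r true)

    table : List (List (List Bool) × List (List Bool))
    table = tabulate entry

    -- A remainder is represented by the suffix of the table that starts at its entry. Counting up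
    -- then drops an entry, and the lookup reads the head. The table depends on the code only, so it
    -- is a constant of the program.
    stateOf : ℕ × Fin (suc t₀) → ℕ × List (List (List Bool) × List (List Bool))
    stateOf (j , r) = j , drop (toℕ r) table

    -- When the last entry is used up, the quotient takes the carry and the table starts afresh.
    next : ℕ × List (List (List Bool) × List (List Bool)) → ℕ × List (List (List Bool) × List (List Bool))
    next (j , tbl) = if null (drop 1 tbl) then (suc j , table) else (j , drop 1 tbl)

    drop-tabulate : ∀ {A : Set} {n} (f : Fin n → A) r → drop (toℕ r) (tabulate f) ≡ f r ∷ drop (suc (toℕ r)) (tabulate f)
    drop-tabulate f zero    = refl
    drop-tabulate f (suc r) = drop-tabulate (f ∘ suc) r

    next-cons : ∀ {j tbl e es} → drop 1 tbl ≡ e ∷ es → next (j , tbl) ≡ (j , e ∷ es)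
    next-cons eq rewrite eq = refl

    next-nil : ∀ {j tbl} → drop 1 tbl ≡ [] → next (j , tbl) ≡ (suc j , table)
    next-nil eq rewrite eq = refl

    next-advance : ∀ p → next (stateOf p) ≡ stateOf (advance t₀ p)
    next-advance (j , r) with suc (toℕ r) <? suc t₀
    ... | yes lt = trans
      (next-cons {tbl = drop (toℕ r) table} (trans (cong (drop 1) (drop-tabulate entry r)) here≡))
      (cong (j ,_) (sym (drop-tabulate entry (fromℕ< lt))))
      where
      here≡ : drop (suc (toℕ r)) table ≡ entry (fromℕ< lt) ∷ drop (suc (toℕ (fromℕ< lt))) table
      here≡ = trans (cong (λ n → drop n table) (sym (toℕ-fromℕ< lt))) (drop-tabulate entry (fromℕ< lt))
    ... | no  ≮  = next-nil {tbl = drop (toℕ r) table} (trans (cong (drop 1) (drop-tabulate entry r))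
      (drop-all (suc (toℕ r)) table (≤-trans (≤-reflexive (length-tabulate entry)) (≮⇒≥ ≮))))

    locate : ∀ i → fold (0 , table) next i ≡ stateOf (position t₀ i)
    locate zero    = refl
    locate (suc i) = trans (cong next (locate i)) (next-advance (position t₀ i))

    literalᴸ : ℕ → Lit → List (List Bool)
    literalᴸ q (b , i) = let j , r = position t₀ i in
      map (maskᴸ q j) (if b then proj₂ (entry r) else proj₁ (entry r))

    literalᴸ-toList : ∀ {q} l → proj₁ (position t₀ (proj₂ l)) < suc q →
                      literalᴸ q l ≡ map toList (literalMasks (suc q) l)
    literalᴸ-toList {q} (b , i) (s≤s j≤q) = begin
      map (maskᴸ q j) (if b then proj₂ (entry r) else proj₁ (entry r))  ≡⟨ cong (map (maskᴸ q j)) (select b) ⟩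
      map (maskᴸ q j) (map toList (falsifying r b))                    ≡⟨ map-∘ (falsifying r b) ⟨
      map (maskᴸ q j ∘ toList) (falsifying r b)                        ≡⟨ map-cong (λ T → maskᴸ-toList T j≤q) (falsifying r b) ⟩
      map (toList ∘ mask (suc q) j) (falsifying r b)                   ≡⟨ map-∘ (falsifying r b) ⟩
      map toList (literalMasks (suc q) (b , i))                        ∎
      where
      open ≡-Reasoning
      j = proj₁ (position t₀ i)
      r = proj₂ (position t₀ i)
      select : ∀ b → (if b then proj₂ (entry r) else proj₁ (entry r)) ≡ map toList (falsifying r b)
      select false = refl
      select true  = refl

    extend-clause : ℕ → Lit → List (List Bool) → List (List Bool)
    extend-clause q l ys = concatMap (λ T → map (unionᴸ (suc q * L) T) ys) (literalᴸ q l)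

    clauseᴸ : ℕ → List Lit → List (List Bool)
    clauseᴸ q c = foldr (extend-clause q) (pad (suc q) [] ∷ []) c

    clauseᴸ-toList : ∀ {q} c → (∀ {l} → l ∈ c → proj₁ (position t₀ (proj₂ l)) < suc q) →
                     clauseᴸ q c ≡ map toList (clauseMasks (suc q) c)
    clauseᴸ-toList {q} []      small = cong (_∷ []) (pad-zeros (suc q))
    clauseᴸ-toList {q} (l ∷ c) small = begin
      concatMap (λ T → map (unionᴸ α T) (clauseᴸ q c)) (literalᴸ q l)
        ≡⟨ cong₂ (λ ys → concatMap (λ T → map (unionᴸ α T) ys)) (clauseᴸ-toList c (small ∘ there)) (literalᴸ-toList l (small (here refl))) ⟩
      concatMap (λ T → map (unionᴸ α T) (map toList Ys)) (map toList Ts)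
        ≡⟨ concatMap-map _ toList Ts ⟩
      concatMap (λ T → map (unionᴸ α (toList T)) (map toList Ys)) Ts
        ≡⟨ concatMap-cong (λ T → trans (sym (map-∘ Ys)) (trans (map-cong (unionᴸ-toList T) Ys) (map-∘ Ys))) Ts ⟩
      concatMap (λ T → map toList (map (Vec.zipWith _∨_ T) Ys)) Ts
        ≡⟨ map-concatMap toList _ Ts ⟨
      map toList (clauseMasks (suc q) (l ∷ c)) ∎
      where
      open ≡-Reasoning
      α  = suc q * L
      Ts = literalMasks (suc q) l
      Ys = clauseMasks (suc q) c

    oversizedᴸ : ℕ → List (List Bool)
    oversizedᴸ q = concatMap (λ j → map (maskᴸ q j) (map toList oversized)) (downFrom (suc q))

    oversizedᴸ-toList : ∀ q → oversizedᴸ q ≡ map toList (oversizedMasks (suc q))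
    oversizedᴸ-toList q = trans
      (concatMap-∈-cong (downFrom (suc q)) λ {j} j∈ → trans (sym (map-∘ oversized))
        (trans (map-cong (λ T → maskᴸ-toList T (≤-pred (∈-downFrom⁻ j∈))) oversized) (map-∘ oversized)))
      (sym (map-concatMap toList _ (downFrom (suc q))))

    constraintsᴸ : ℕ → List (List Lit) → List (List Bool)
    constraintsᴸ q cs = oversizedᴸ q ++ concatMap (clauseᴸ q) cs

    rowsᴸ : ℕ → List (List Lit) → List (List Bool)
    rowsᴸ q cs = tabulate {n = suc q * L} (λ a → tabulate {n = suc q * L} (λ i → toℕ i ≡ᵇ toℕ a)) ++ constraintsᴸ q cs

    module _ {q : ℕ} {cs : List (List Lit)}
             (small : ∀ {c l} → c ∈ cs → l ∈ c → proj₁ (position t₀ (proj₂ l)) < suc q) where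

      constraintsᴸ-toList : constraintsᴸ q cs ≡ map toList (constraints (suc q) cs)
      constraintsᴸ-toList = trans (cong₂ _++_ (oversizedᴸ-toList q)
        (trans (concatMap-∈-cong cs λ {c} c∈ → clauseᴸ-toList c (small c∈)) (sym (map-concatMap toList _ cs))))
        (sym (map-++ toList (oversizedMasks (suc q)) _))

      rowsᴸ-toList : rowsᴸ q cs ≡ map toList (rows (suc q) cs)
      rowsᴸ-toList = trans (cong₂ _++_
        (trans (tabulate-cong {n = α} λ a → sym (toList-tabulate {n = α} λ i → toℕ i ≡ᵇ toℕ a)) (sym (map-tabulate (unit {α}) toList)))
        constraintsᴸ-toList)
        (sym (map-++ toList (tabulate (unit {α})) _))
        where α = suc q * L

-- Programs for the instance, with size bounds

module Construction where

  open While
  open Combinators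
  open Code using (ConstantWeightCode)
  open Sat using (position; position-value; Lit; allVecs; module Masks)
  open Lists using (unionᴸ; matrixᴸ; weightsᴸ; module Listsᴸ)
  open import Data.Bool.Base using (Bool; true; false; not; _∨_; if_then_else_)
  import Data.Bool.Properties as Bool
  open import Data.Fin.Subset using (∣_∣)
  open import Data.Fin.Base using (Fin; zero; suc; toℕ)
  open import Data.List.Base as List
    using (List; []; _∷_; _++_; length; map; foldr; concatMap; replicate; drop; tabulate)
  open import Data.List.Properties using (length-++; length-map; length-filter; length-tabulate)
  open import Data.List.Membership.Propositional using (_∈_)
  open import Data.List.Relation.Unary.All as All using (All; []; _∷_)
  import Data.List.Relation.Unary.All.Properties as All
  open import Data.Nat.Base
  open import Data.Nat.Properties
  open import Data.Product.Base using (∃-syntax; _,_; proj₁; proj₂)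
  open import Data.Vec.Base as Vec using (Vec; []; _∷_; toList)
  open import Relation.Binary.PropositionalEquality
  open import Relation.Nullary.Decidable using (_×-dec_)

  lit bits : Repr
  lit  = pair bool nat
  bits = list bool

  orᵖ : ∀ {Γ a b} → Prog Γ bool a → Prog Γ bool b → Prog Γ bool (λ x → a x ∨ b x)
  orᵖ {a = a} {b} P Q = cast (λ x → if-∨ (a x) (b x)) (ifᵖ P (constᵖ true) Q)
    where
    if-∨ : ∀ a b → (if a then true else b) ≡ a ∨ b
    if-∨ false b = refl
    if-∨ true  b = refl

  unionᵖ : ∀ {Γ α T y} → Prog Γ nat α → Prog Γ bits T → Prog Γ bits y → Prog Γ bits (λ x → unionᴸ (α x) (T x) (y x))
  unionᵖ {T = T} {y} A P Q = tabulateᵖ {h = λ x a → nth (T x) a ∨ nth (y x) a} A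
    λ wk′ a → orᵖ (nthᵖ (wk′ P) a) (nthᵖ (wk′ Q) a)

  size-bits : ∀ bs → size (encList encBool bs) ≤ suc (length bs * 4)
  size-bits []           = ≤-refl
  size-bits (false ∷ bs) = s≤s (≤-trans (s≤s (size-bits bs)) (m≤n+m _ 2))
  size-bits (true ∷ bs)  = s≤s (+-monoʳ-≤ 3 (size-bits bs))

  size-list : ∀ {A : Set} (e : A → Tree) {B} {xs} → All (λ x → size (e x) ≤ B) xs →
              size (encList e xs) ≤ suc (length xs * suc B)
  size-list e {B} []            = ≤-refl
  size-list e {B} {x ∷ xs} (le ∷ les) = s≤s (≤-trans (+-mono-≤ le (size-list e les)) (≤-reflexive (+-suc B (length xs * suc B))))

  length-concatMap : ∀ {A B : Set} (f : A → List B) c xs → (∀ x → length (f x) ≡ c) → length (concatMap f xs) ≡ length xs * c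
  length-concatMap f c []       eq = refl
  length-concatMap f c (x ∷ xs) eq = trans (length-++ (f x)) (cong₂ _+_ (eq x) (length-concatMap f c xs eq))

  matrixᵖ : ∀ {Γ α rows} → Prog Γ nat α → Prog Γ (list bits) rows →
            Prog Γ (list bits) (λ x → matrixᴸ (α x) (length (rows x)) (rows x))
  matrixᵖ {Γ} {α} {rows} A P = appendᵖ
    (tabulateᵖ {h = λ x a → replicate (α x) false ++ map (λ r → nth r a) (rows x)} A
      λ up a → appendᵖ (replicateᵖ (up A) (constᵖ false)) (mapᵖ (λ _ → refl) (up P) λ up′ r → nthᵖ r (up′ a)))
    (mapᵖ {h = λ x r → r ++ replicate (length (rows x)) false} (λ _ → refl) P
      λ up r → appendᵖ r (replicateᵖ (up (lengthᵖ P)) (constᵖ false)))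

  weightsᵖ : ∀ {Γ α R} → Prog Γ nat α → Prog Γ nat R →
             Prog Γ (list (pair nat nat)) (λ x → weightsᴸ (α x) (R x))
  weightsᵖ A B = appendᵖ
    (replicateᵖ A (pairᵖ (sucᵖ (addᵖ A B)) (addᵖ A B)))
    (replicateᵖ B (constᵖ (1 , 1)))

  module Programs {t₀ L₀ w : ℕ} (code : ConstantWeightCode (suc t₀) (suc L₀) w) where

    open ConstantWeightCode code using (decode)
    open Masks code hiding (rows)
    open Listsᴸ code

    entryR stateR : Repr
    entryR = pair (list bits) (list bits)
    stateR = pair nat (list entryR)

    padᵖ : ∀ {Γ i xs} → Prog Γ nat i → Prog Γ bits xs → Prog Γ bits (λ x → pad (i x) (xs x))
    padᵖ {i = i} {xs} I P = foldᵖ {f = λ _ → zs ++_} _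
      (poly-+ (poly-* (poly-size I) (poly-const (size (encList encBool zs)))) (poly-size P))
      (λ x j j≤ → ≤-trans (size-pad (xs x) j)
        (+-monoˡ-≤ _ (*-monoˡ-≤ (size (encList encBool zs)) (≤-trans j≤ (n≤size (i x))))))
      I P λ _ acc → appendᵖ (constᵖ zs) acc
      where
      size-pad : ∀ xs j → size (encList encBool (pad j xs)) ≤ j * size (encList encBool zs) + size (encList encBool xs)
      size-pad xs zero    = ≤-refl
      size-pad xs (suc j) = ≤-trans (size-++ encBool zs (pad j xs))
        (≤-trans (+-monoʳ-≤ (size (encList encBool zs)) (size-pad xs j)) (≤-reflexive (sym (+-assoc (size (encList encBool zs)) _ _))))

    maskᵖ : ∀ {Γ q j T} → Prog Γ nat q → Prog Γ nat j → Prog Γ bits T → Prog Γ bits (λ x → maskᴸ (q x) (j x) (T x))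
    maskᵖ Q J P = padᵖ J (appendᵖ P (padᵖ (monusᵖ Q J) (constᵖ [])))

    -- Intermediate states stay small: the quotient is at most the index, and the second component
    -- is a suffix of a fixed table.
    locateᵖ : ∀ {Γ i} → Prog Γ nat i → Prog Γ stateR (λ x → stateOf (position t₀ (i x)))
    locateᵖ {Γ} {i} I = cast (λ x → locate (i x)) (foldᵖ {S = stateR} {f = λ _ → next} _
      (poly-suc (poly-+ (poly-size I) (poly-const (size (enc (list entryR) table)))))
      (λ x j j≤ → subst (λ s → size (enc stateR s) ≤ _) (sym (locate j))
        (s≤s (+-mono-≤ (size-mono (≤-trans (quotient≤ j) j≤)) (size-drop (toℕ (proj₂ (position t₀ j))) table))))
      I (constᵖ (0 , table)) λ _ acc →
        ifᵖ (nullᵖ (tailᵖ (sndᵖ acc)))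
          (pairᵖ (sucᵖ (fstᵖ acc)) (constᵖ table))
          (pairᵖ (fstᵖ acc) (tailᵖ (sndᵖ acc))))
      where
      quotient≤ : ∀ j → proj₁ (position t₀ j) ≤ j
      quotient≤ j = ≤-trans (m≤m*n _ (suc t₀)) (≤-trans (m≤m+n _ _) (≤-reflexive (position-value t₀ j)))

      size-drop : ∀ k xs → size (enc (list entryR) (drop k xs)) ≤ size (enc (list entryR) xs)
      size-drop zero    xs       = ≤-refl
      size-drop (suc k) []       = ≤-refl
      size-drop (suc k) (x ∷ xs) = ≤-trans (size-drop k xs) (≤-trans (m≤n+m _ _) (n≤1+n _))

    literalᵖ : ∀ {Γ q l} → Prog Γ nat q → Prog Γ lit l → Prog Γ (list bits) (λ x → literalᴸ (q x) (l x))
    literalᵖ {Γ} {q} {l} Q P = mapᵖ {h = λ x → maskᴸ (q x) (proj₁ (position t₀ (proj₂ (l x))))} (λ _ → refl)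
      (ifᵖ (fstᵖ P) (sndᵖ here) (fstᵖ here)) λ up T → maskᵖ (up Q) (up (fstᵖ at)) T
      where
      at : Prog Γ stateR (λ x → stateOf (position t₀ (proj₂ (l x))))
      at = locateᵖ (sndᵖ P)

      here : Prog Γ entryR (λ x → entry (proj₂ (position t₀ (proj₂ (l x)))))
      here = headᵖ (λ x → _ , drop-tabulate entry (proj₂ (position t₀ (proj₂ (l x))))) (sndᵖ at)

    αᵖ : ∀ {Γ q} → Prog Γ nat q → Prog Γ nat (λ x → suc (q x) * L)
    αᵖ Q = mulᵖ (sucᵖ Q) (constᵖ L)

    -- The `suc` makes the base of the power in `length-clauseᴸ` visibly positive, hence the power
    -- monotone in the exponent.
    length-literalᴸ : ∀ q l → length (literalᴸ q l) ≤ suc (length (allVecs L))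
    length-literalᴸ q (b , i) = ≤-trans (≤-reflexive (length-map _ (if b then _ else _))) (m≤n⇒m≤1+n (at-most b))
      where
      r = proj₂ (position t₀ i)

      few : ∀ b → length (map toList (falsifying r b)) ≤ length (allVecs L)
      few b = ≤-trans (≤-reflexive (length-map toList (falsifying r b)))
        (length-filter (λ T → (∣ T ∣ ≟ w) ×-dec (decode T r Bool.≟ not b)) (allVecs L))

      at-most : ∀ b → length (if b then proj₂ (entry r) else proj₁ (entry r)) ≤ length (allVecs L)
      at-most false = few false
      at-most true  = few true

    length-clauseᴸ : ∀ q c → length (clauseᴸ q c) ≤ suc (length (allVecs L)) ^ length c
    length-clauseᴸ q []      = ≤-refl
    length-clauseᴸ q (l ∷ c) = ≤-trans
      (≤-reflexive (length-concatMap _ (length (clauseᴸ q c)) (literalᴸ q l) λ T → length-map _ (clauseᴸ q c)))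
      (*-mono-≤ (length-literalᴸ q l) (length-clauseᴸ q c))

    clauseᴸ-lengths : ∀ q c → All (λ y → length y ≡ suc q * L) (clauseᴸ q c)
    clauseᴸ-lengths q []      = trans (cong length (pad-zeros (suc q))) (length-toList (Vec.replicate (suc q * L) false)) ∷ []
      where
      length-toList : ∀ {n} (v : Vec Bool n) → length (toList v) ≡ n
      length-toList []      = refl
      length-toList (_ ∷ v) = cong suc (length-toList v)
    clauseᴸ-lengths q (l ∷ c) = All.concat⁺ (All.map⁺ (All.universal
      (λ T → All.map⁺ (All.universal
        (λ y → length-tabulate {n = suc q * L} (λ a → nth T (toℕ a) ∨ nth y (toℕ a))) (clauseᴸ q c)))
      (literalᴸ q l)))

    -- The number of rows is exponential in the length of the clause only. As that is at most the
    -- constant `k`, also for the suffixes met during the fold, the number is bounded by a constant.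
    clauseᵖ : ∀ {Γ q c} k → (∀ x → length (c x) ≤ k) → Prog Γ nat q → Prog Γ (list lit) c →
              Prog Γ (list bits) (λ x → clauseᴸ (q x) (c x))
    clauseᵖ {Γ} {q} {c} k short Q P = foldrᵖ {f = λ x → extend-clause (q x)} {z = λ x → pad (suc (q x)) [] ∷ []} _
      (poly-suc (poly-* (poly-const (suc (length (allVecs L)) ^ k)) (poly-suc (poly-suc (poly-* (poly-size (αᵖ Q)) (poly-const 4))))))
      (λ x before us eq → ≤-trans (size-list encBits (All.map (λ {y} len → ≤-trans (size-bits y)
          (s≤s (*-monoˡ-≤ 4 (≤-trans (≤-reflexive len) (n≤size (suc (q x) * L)))))) (clauseᴸ-lengths (q x) us)))
        (s≤s (*-monoˡ-≤ _ (≤-trans (length-clauseᴸ (q x) us)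
          (^-monoʳ-≤ (suc (length (allVecs L))) (≤-trans (length-suffix before us eq) (short x)))))))
      P (consᵖ (padᵖ (sucᵖ Q) (constᵖ [])) (constᵖ [])) λ up l ys →
        concatMapᵖ {h = λ { (x , s) T → map (unionᴸ (suc (q x) * L) T)
                                           (foldr (extend-clause (q x)) (pad (suc (q x)) [] ∷ []) (after s)) }}
          (λ _ → refl) (literalᵖ (up Q) l)
          λ up′ T → mapᵖ {h = λ { ((x , s) , T , _) → unionᴸ (suc (q x) * L) T }} (λ _ → refl) (up′ ys)
            λ up″ y → unionᵖ (up″ (up′ (αᵖ (up Q)))) (up″ T) y
      where
      encBits : List Bool → Tree
      encBits = encList encBool

    module _ {Γ : Ctx} {q : Pt Γ → ℕ} {cs : Pt Γ → List (List Lit)} (k : ℕ)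
             (short : ∀ x {c} → c ∈ cs x → length c ≤ k)
             (Q : Prog Γ nat q) (P : Prog Γ (list (list lit)) cs) where

      constraintsᵖ : Prog Γ (list bits) (λ x → constraintsᴸ (q x) (cs x))
      constraintsᵖ = appendᵖ
        (concatMapᵖ {h = λ x j → map (maskᴸ (q x) j) (map toList oversized)} (λ _ → refl) (downFromᵖ (sucᵖ Q))
          λ up j → mapᵖ {h = λ { (x , j , _) → maskᴸ (q x) j }} (λ _ → refl) (constᵖ (map toList oversized))
            λ up′ T → maskᵖ (up′ (up Q)) (up′ j) T)
        (concatMapᵖ {h = λ x → clauseᴸ (q x)} (λ _ → refl) P
          λ up c → clauseᵖ k (λ { (x , _ , c∈) → short x c∈ }) (up Q) c)

      rowsᵖ : Prog Γ (list bits) (λ x → rowsᴸ (q x) (cs x))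
      rowsᵖ = appendᵖ
        (tabulateᵖ {h = λ x a → tabulate {n = suc (q x) * L} (λ i → toℕ i ≡ᵇ a)} (αᵖ Q)
          λ {_} {π} {a} up A → tabulateᵖ {h = λ y i → i ≡ᵇ a y} (up (αᵖ Q)) λ up′ i → equalᵖ i (up′ A))
        constraintsᵖ

-- The reduction from k-SAT and its running time

open While
open Combinators
open Code using (ConstantWeightCode; block-code)
open Rate using (Parameters; rate; frac; frac-parts; bound-mono)
open Cover using (coverInstance; score; max-score; vc-small)
open Sat using (position; position-value; quotient-mono; Lit; Satisfies; module Masks)
open Lists using (matrixᴸ; matrixᴸ-adj; weightsᴸ-w; module Listsᴸ)
open Construction
open import Data.Bool.Base using (Bool; true; false)
open import Data.Fin.Base using (Fin; zero; suc; toℕ; fromℕ<)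
open import Data.Fin.Properties using (toℕ<n; fromℕ<-toℕ)
open import Data.Integer.Base using (∣_∣)
open import Data.List.Base as List using (List; []; _∷_; length; map)
open import Data.List.Membership.Propositional using (_∈_)
open import Data.List.Membership.Propositional.Properties using (∈-map⁻)
open import Data.List.Properties using (length-map)
open import Data.List.Relation.Unary.All as All using (All; []; _∷_)
import Data.List.Relation.Unary.All.Properties as All
open import Data.List.Relation.Unary.Any as Any using (Any)
import Data.List.Relation.Unary.Any.Properties as Any
open import Data.Nat.Base hiding (_/_)
open import Data.Nat.Properties
open import Data.Product.Base using (∃-syntax; _×_; _,_; proj₁; proj₂)
open import Data.Rational.Base using (ℚ; ↥_; ↧ₙ_)
open import Data.Sum.Base using (_⊎_; inj₁; inj₂)
open import Data.Vec.Base as Vec using (Vec; []; _∷_; toList)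
open import Function.Base using (_∘_; id)
open import Relation.Binary.PropositionalEquality
open import Relation.Nullary using (¬_; yes; no; contradiction)

tree : Repr
tree = repr Tree id

poly-^ : ∀ {Γ g} d → Poly Γ g → Poly Γ (λ x → g x ^ d)
poly-^ zero    p = poly-const 1
poly-^ (suc d) p = poly-* p (poly-^ d p)

erase : ∀ {n} → Literal n → Lit
erase (i , b) = b , toℕ i

encList-map : ∀ {A B : Set} {e : A → Tree} {e′ : B → Tree} (f : A → B) xs → (∀ x → e x ≡ e′ (f x)) →
              encList e xs ≡ encList e′ (map f xs)
encList-map f []       eq = refl
encList-map f (x ∷ xs) eq = cong₂ node (eq x) (encList-map f xs eq)

cross-multiply : ∀ {s N g} a b → a * suc g ≡ s → b * suc g ≡ N → a * N ≡ b * s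
cross-multiply {g = g} a b refl refl = begin
  a * (b * suc g)   ≡⟨ *-assoc a b (suc g) ⟨
  a * b * suc g     ≡⟨ cong (_* suc g) (*-comm a b) ⟩
  b * a * suc g     ≡⟨ *-assoc b a (suc g) ⟩
  b * (a * suc g)   ∎
  where open ≡-Reasoning

answer : ∀ {P : Set} a b → (a ≡ b → P) → (a ≢ b → ¬ P) →
         (encBool (a ≡ᵇ b) ≡ encBool true × P) ⊎ (encBool (a ≡ᵇ b) ≡ encBool false × ¬ P)
answer zero    zero    yes′ no′ = inj₁ (refl , yes′ refl)
answer zero    (suc b) yes′ no′ = inj₂ (refl , no′ λ ())
answer (suc a) zero    yes′ no′ = inj₂ (refl , no′ λ ())
answer (suc a) (suc b) yes′ no′ = answer a b (yes′ ∘ cong suc) (λ neq → no′ (neq ∘ suc-injective))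

-- `suc` of this `bd` is by computation the size of `encCNF φ`, so a `Poly` bound has the shape that
-- the notion of solvability asks for.
Input : ℕ → Ctx
Input k = record
  { Pt    = kCNF k
  ; bd    = λ φ → size (encℕ (#vars φ)) + size (encList (encList encLiteral) (clauses φ))
  ; arity = 1
  ; env   = λ φ → encCNF φ ∷ []
  }
  where open kCNF

-- The environment under two `let`s, binding the query and the output of the solver. `bd` remains
-- that of the formula, so the output has to be shown polynomially small.
WithOutput : ∀ {k} → (kCNF k → Tree) → (kCNF k → Tree) → Ctx
WithOutput {k} query out = extend (extend (Input k) id query) id out

module Reduction {t₀ L₀ w : ℕ} (C : ConstantWeightCode (suc t₀) (suc L₀) w) (k : ℕ) where

  open Masks C
  open Listsᴸ C
  open Programs C
  open kCNF

  lits : kCNF k → List (List Lit)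
  lits φ = map (map erase) (clauses φ)

  -- `q` counts the full blocks of variables. One further block takes the remaining variables and is
  -- present even if there are none, which keeps `α` positive. `n` is the predecessor of `N`, since
  -- `frac n` divides by `suc n`.
  q α R N n : kCNF k → ℕ
  q φ = proj₁ (position t₀ (#vars φ))
  α φ = suc (q φ) * L
  R φ = length (rows (suc (q φ)) (lits φ))
  N φ = α φ + R φ
  n φ = L₀ + q φ * L + R φ

  goal : kCNF k → ℕ
  goal φ = suc (q φ) * w + (N φ * α φ + N φ * length (constraints (suc (q φ)) (lits φ)))

  short : ∀ φ {c} → c ∈ lits φ → length c ≤ k
  short φ c∈ with ∈-map⁻ (map erase) c∈
  ... | c , c∈′ , refl = ≤-trans (≤-reflexive (length-map erase c)) (All.lookup (width φ) c∈′)

  small : ∀ φ {c l} → c ∈ lits φ → l ∈ c → proj₁ (position t₀ (proj₂ l)) < suc (q φ)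
  small φ c∈ l∈ with ∈-map⁻ (map erase) c∈
  ... | c , c∈′ , refl with ∈-map⁻ erase l∈
  ... | (i , b) , _ , refl = quotient-mono t₀ (<⇒≤ (toℕ<n i))

  small′ : ∀ φ → All (All (λ l → proj₁ (position t₀ (proj₂ l)) < suc (q φ))) (lits φ)
  small′ φ = All.tabulate λ c∈ → All.tabulate λ l∈ → small φ c∈ l∈

  matrixRows : ∀ φ → List (Vec Bool (α φ))
  matrixRows φ = rows (suc (q φ)) (lits φ)

  instance-of : kCNF k → RestrictedInstance
  instance-of φ = coverInstance (matrixRows φ)

  graph-of : kCNF k → WeightedGraph
  graph-of φ = RestrictedInstance.weightedGraph (instance-of φ)

  satisfiable⇒satisfies : ∀ φ → Satisfiable φ → ∃[ a ] Satisfies a (lits φ)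
  satisfiable⇒satisfies φ (a , sat) = extended , All.map⁺ (All.map (Any.map⁺ ∘ Any.map (λ {(i , b)} eq → trans (extends i) eq)) sat)
    where
    extended : ℕ → Bool
    extended i with i <? #vars φ
    ... | yes lt = a (fromℕ< lt)
    -- Blocks may have room for positions beyond the variables; no literal mentions these.
    ... | no  _  = false

    extends : ∀ i → extended (toℕ i) ≡ a i
    extends i with toℕ i <? #vars φ
    ... | yes lt = cong a (fromℕ<-toℕ i lt)
    ... | no  ≮  = contradiction (toℕ<n i) ≮

  satisfies⇒satisfiable : ∀ φ a → Satisfies a (lits φ) → Satisfiable φ
  satisfies⇒satisfiable φ a sat = a ∘ toℕ , All.map Any.map⁻ (All.map⁻ sat)

  formulaᵖ : Prog (Input k) (pair nat (list (list lit))) (λ φ → #vars φ , lits φ)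
  formulaᵖ = varᵖ zero eq (poly-≤ (poly-suc poly-bd) λ φ → ≤-reflexive (cong size (sym (eq φ))))
    where
    eq : ∀ φ → encCNF φ ≡ enc (pair nat (list (list lit))) (#vars φ , lits φ)
    eq φ = cong (node _) (encList-map (map erase) (clauses φ) λ c → encList-map erase c λ _ → refl)

  qᵖ : Prog (Input k) nat q
  qᵖ = fstᵖ (locateᵖ (fstᵖ formulaᵖ))

  allRowsᵖ : Prog (Input k) (list bits) (λ φ → map toList (matrixRows φ))
  allRowsᵖ = cast (λ φ → rowsᴸ-toList (small φ)) (rowsᵖ k short qᵖ (sndᵖ formulaᵖ))

  Rᵖ : Prog (Input k) nat R
  Rᵖ = cast (λ φ → length-map toList (matrixRows φ)) (lengthᵖ allRowsᵖ)

  instanceᵖ : Prog (Input k) tree (λ φ → encWeightedGraph (graph-of φ))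
  instanceᵖ = nodeᵖ
    (λ φ → cong₂ node
      (cong (encList (encList encBool)) (trans
        (cong (λ r → matrixᴸ (α φ) r (map toList (matrixRows φ))) (length-map toList (matrixRows φ)))
        (matrixᴸ-adj (matrixRows φ))))
      (weightsᴸ-w (matrixRows φ)))
    (matrixᵖ (αᵖ qᵖ) allRowsᵖ) (weightsᵖ (αᵖ qᵖ) Rᵖ)

  Nᵖ : Prog (Input k) nat N
  Nᵖ = addᵖ (αᵖ qᵖ) Rᵖ

  goalᵖ : Prog (Input k) nat goal
  goalᵖ = addᵖ (mulᵖ (sucᵖ qᵖ) (constᵖ w)) (addᵖ (mulᵖ Nᵖ (αᵖ qᵖ)) (mulᵖ Nᵖ
    (cast (λ φ → trans (cong length (constraintsᴸ-toList (small φ))) (length-map toList (constraints (suc (q φ)) (lits φ))))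
      (lengthᵖ (constraintsᵖ k short qᵖ (sndᵖ formulaᵖ))))))

  module Answer (out : kCNF k → Tree) (answers : ∀ φ → WMMVC-Answer (graph-of φ) (out φ)) where

    value : kCNF k → ℚ
    value φ = proj₁ (answers φ)

    optimal : ∀ φ → WeightedGraph.IsWMMVC (graph-of φ) (value φ)
    optimal φ = proj₁ (proj₂ (answers φ))

    best : ∀ φ → ∃[ s ] value φ ≡ frac (n φ) (score (matrixRows φ) s)
    best φ = proj₁ (max-score (matrixRows φ) (optimal φ))

    maxScore : kCNF k → ℕ
    maxScore φ = score (matrixRows φ) (proj₁ (best φ))

    reached⇒satisfiable : ∀ φ → maxScore φ ≡ goal φ → Satisfiable φ
    reached⇒satisfiable φ eq =
      satisfies⇒satisfiable φ _ (target⇒satisfies (q φ) (lits φ) (small′ φ) (proj₁ (best φ)) eq)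

    -- The encoded assignment scores `goal` and extends to a minimal cover by its private rows, so
    -- the maximum is no smaller; no column set scores more.
    satisfiable⇒reached : ∀ φ → Satisfiable φ → maxScore φ ≡ goal φ
    satisfiable⇒reached φ sat =
      let a , sat′ = satisfiable⇒satisfies φ sat
          s = encodeAll (suc (q φ)) a
      in ≤-antisym (score≤target (q φ) (lits φ) (small′ φ) (proj₁ (best φ)))
        (subst (_≤ maxScore φ) (satisfies⇒target (q φ) (lits φ) (small′ φ) a sat′)
          (proj₂ (max-score (matrixRows φ) (optimal φ)) s (proj₂ (best φ)) (private-rows (q φ) (lits φ) (small′ φ) s)))

    num den : kCNF k → ℕ
    num φ = ∣ ↥ value φ ∣
    den φ = ↧ₙ (value φ)

    parts : ∀ φ → ∃[ g ] num φ * suc g ≡ maxScore φ × den φ * suc g ≡ N φ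
    parts φ = subst (λ x → ∃[ g ] ∣ ↥ x ∣ * suc g ≡ maxScore φ × ↧ₙ x * suc g ≡ N φ)
      (sym (proj₂ (best φ))) (frac-parts (n φ) (maxScore φ))

    cross : ∀ φ → num φ * N φ ≡ den φ * maxScore φ
    cross φ = let g , eqₙ , eqd = parts φ in cross-multiply (num φ) (den φ) eqₙ eqd

    -- num / den is compared with goal / N, which need not be in lowest terms.
    accept : kCNF k → Bool
    accept φ = num φ * N φ ≡ᵇ den φ * goal φ

    accept-correct : ∀ φ → SAT-Answer φ (encBool (accept φ))
    accept-correct φ = answer (num φ * N φ) (den φ * goal φ)
      (λ eq → reached⇒satisfiable φ (*-cancelˡ-≡ (maxScore φ) (goal φ) (den φ) (trans (sym (cross φ)) eq)))
      (λ neq sat → neq (trans (cross φ) (cong (den φ *_) (satisfiable⇒reached φ sat))))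

    Output : Ctx
    Output = WithOutput (λ φ → encWeightedGraph (graph-of φ)) out

    up : ∀ {S f} → Prog (Input k) S f → Prog Output S f
    up = reindex {Input k} {Output} id shift₂ (λ _ → refl) (λ _ _ → refl)

    -- Reduction to lowest terms only shrinks: the numerator is at most the maximal score, hence at
    -- most `goal`, and the denominator is at most `N`. Both are computed in polynomial time in
    -- unary, so the output is small.
    valueᵖ : Prog Output (pair nat nat) (λ φ → num φ , den φ)
    valueᵖ = varᵖ zero (λ φ → proj₂ (proj₂ (answers φ))) (poly-≤ (poly-suc (poly-+ (poly-size (up goalᵖ)) (poly-size (up Nᵖ))))
      λ φ → s≤s (+-mono-≤ (size-mono (num≤ φ)) (size-mono (den≤ φ))))
      where
      num≤ : ∀ φ → num φ ≤ goal φ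
      num≤ φ = let g , eqₙ , _ = parts φ in
        ≤-trans (m≤m*n (num φ) (suc g)) (≤-trans (≤-reflexive eqₙ) (score≤target (q φ) (lits φ) (small′ φ) (proj₁ (best φ))))

      den≤ : ∀ φ → den φ ≤ N φ
      den≤ φ = let g , _ , eq = parts φ in ≤-trans (m≤m*n (den φ) (suc g)) (≤-reflexive eq)

    acceptᵖ : Prog Output bool accept
    acceptᵖ = equalᵖ (mulᵖ (fstᵖ valueᵖ) (up Nᵖ)) (mulᵖ (sndᵖ valueᵖ) (up goalᵖ))

-- The solver's time `t` stands between construction `t₁` and decision `t₂`. Everything but `t` is
-- gathered into the additive term of `transfer`.
total-time : ∀ {ε} (ρ : Parameters ε) → let open Parameters ρ in ∀ {t₁ t₂ t P q n M} x →
             t ≤ P ·[2- ε ]^ x → ∣ ↥ x ∣ ≤ ↧ₙ x * suc (suc q * (suc t₀ + ℓ)) → q * suc t₀ ≤ n →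
             suc (t₁ + suc t₂) + P * 2 ^ suc (suc t₀ + ℓ) ≤ M →
             suc (t₁ + suc (t + t₂)) ≤ M ·[2- δ ]^ fromℕ n
total-time ρ {t₁} {t₂} {t} {P} {q} {n} {M} x fast vc≤ q≤ M≥ =
  subst (λ u → u ≤ M ·[2- δ ]^ fromℕ n)
    (cong suc (trans (+-assoc t₁ (suc t₂) t) (cong (λ m → t₁ + suc m) (+-comm t₂ t))))
    (bound-mono {δ} {suc (t₁ + suc t₂) + t} {suc (t₁ + suc t₂) + P * 2 ^ suc (suc t₀ + ℓ)} {M} (fromℕ n) M≥
      (transfer {t} {P} {q} {n} (suc (t₁ + suc t₂)) x fast vc≤ q≤))
  where open Parameters ρ

module _ {ε} (ρ : Parameters ε) {Instance : Set} {encode : Instance → Tree}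
         {Answer : Instance → Tree → Set} {IsParam : Instance → ℚ → Set} where

  open Parameters ρ

  -- A reduction with one query: build the instance, run the solver, inspect its output. The outputs
  -- are known only through their specification, so `decide` must supply a program for any function
  -- `out` that meets it.
  transfer-algorithm : ∀ k (q : kCNF k → ℕ) (I : kCNF k → Instance) →
    (∀ φ → q φ * suc t₀ ≤ kCNF.#vars φ) →
    (∀ φ {x} → IsParam (I φ) x → ∣ ↥ x ∣ ≤ ↧ₙ x * suc (suc (q φ) * (suc t₀ + ℓ))) →
    Prog (Input k) tree (encode ∘ I) →
    (∀ out → (∀ φ → Answer (I φ) (out φ)) →
      ∃[ accept ] Prog (WithOutput (encode ∘ I) out) bool accept × (∀ φ → SAT-Answer φ (encBool (accept φ)))) →
    SolvableInTime-O*[2- ε ]^param encode Answer IsParam → kSAT-Solvable k δ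
  transfer-algorithm k q I q≤ param≤ queryᵖ decide (p , C , d , solves) =
    program , coeff total-poly , deg total-poly , solve
    where
    out : kCNF k → Tree
    out φ = proj₁ (solves (I φ))

    decision = decide out λ φ → let _ , _ , _ , _ , answer , _ = solves (I φ) in answer
    accept   = proj₁ decision
    acceptᵖ  = proj₁ (proj₂ decision)

    program : Program
    -- The single variable of `p` is made to refer to the instance just built.
    program = let′ (exp queryᵖ) (let′ (ren (λ _ → zero) p) (exp acceptᵖ))

    factor : ℕ
    factor = 2 ^ suc (suc t₀ + ℓ)

    total : kCNF k → ℕ
    total φ = suc (cost queryᵖ φ + suc (cost acceptᵖ φ)) + C * size (encode (I φ)) ^ d * factor

    total-poly : Poly (Input k) total
    total-poly = poly-+
      (poly-suc (poly-+ (poly-cost queryᵖ)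
        (poly-suc (poly-reindex {WithOutput (encode ∘ I) out} {Input k} id (λ _ → refl) (poly-cost acceptᵖ)))))
      (poly-* (poly-* (poly-const C) (poly-^ d (poly-size queryᵖ))) (poly-const factor))

    solve : ∀ φ → ∃[ v ] ∃[ t ] ∃[ x ]
      ( (encCNF φ ∷ [] ⊢ program ⇓ v ∥ t) × SAT-Answer φ v × x ≡ fromℕ (kCNF.#vars φ)
      × t ≤ coeff total-poly * size (encCNF φ) ^ deg total-poly ·[2- δ ]^ x )
    solve φ =
      let _ , t , x , run-p , _ , is-param , fast = solves (I φ)
          t₁ , run₁ , le₁ = run queryᵖ φ
          t₂ , run₂ , le₂ = run acceptᵖ φ
      in encBool (accept φ) , suc (t₁ + suc (t + t₂)) , fromℕ (kCNF.#vars φ)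
       , ⇓let run₁ (⇓let (ren-⇓ (λ { zero → refl }) run-p) run₂)
       , proj₂ (proj₂ decision) φ
       , refl
       , total-time ρ {t₁} {t₂} {t} {C * size (encode (I φ)) ^ d} {q φ} {kCNF.#vars φ}
           {coeff total-poly * size (encCNF φ) ^ deg total-poly} x fast (param≤ φ is-param) (q≤ φ)
           (≤-trans (+-monoˡ-≤ (C * size (encode (I φ)) ^ d * factor) (s≤s (+-mono-≤ le₁ (s≤s le₂)))) (bound total-poly φ))

SAT-solvable : ∀ {ε} (ρ : Parameters ε) → let open Parameters ρ in
               ∀ {w} → ConstantWeightCode (suc t₀) (suc t₀ + ℓ) w →
               RestrictedWMMVC-Solvable ε → ∀ k → kSAT-Solvable k δ
SAT-solvable {ε} ρ C solvable k = transfer-algorithm ρ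
  {RestrictedInstance} {encWeightedGraph ∘ weightedGraph} {WMMVC-Answer ∘ weightedGraph} {WeightedGraph.IsVCw ∘ weightedGraph}
  k q instance-of
  (λ φ → ≤-trans (m≤m+n _ _) (≤-reflexive (position-value t₀ (kCNF.#vars φ))))
  (λ φ is-vc → vc-small (matrixRows φ) is-vc)
  instanceᵖ
  (λ out answers → let open Answer out answers in accept , acceptᵖ , accept-correct)
  solvable
  where
  open Parameters ρ
  open RestrictedInstance using (weightedGraph)
  open Reduction C k

lemma1 : ∀ (ε : ℝ) → Positive ε → SETH → ¬ RestrictedWMMVC-Solvable ε
lemma1 ε pos seth solvable =
  let ρ = rate ε pos
      open Parameters ρ
      -- The code and δ are fixed by ε beforehand, so the reduction is available for whatever `k`
      -- the hypothesis returns.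
      k , hard = seth δ δ-positive
  in hard (SAT-solvable ρ (proj₂ (block-code (suc t₀) ℓ room)) solvable k)
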